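{- Given a graph $G$, it is NP-complete to decide whether $G$ admits a pairing dominating set.
   Context: Given a graph $G=(V,E)$, a pairing dominating set is a set of pairs of vertices $\{(u_1,v_1),\ldots,(u_k,v_k)\}$, where all $2k$ vertices are distinct, such that $V=\bigcup_{i=1}^k \big(N[u_i]\cap N[v_i]\big)$, with $N[x]$ the closed neighborhood of $x$. -}

module Defs where

open import Data.Bool using (Bool; true; false)
open import Data.Fin using (Fin)
open import Data.Fin.Subset using (Subset; ⊤; ⁅_⁆; _∪_; _∩_; ⋃)
open import Data.List as List using (List; []; _∷_; _++_; length; concatMap)
open import Data.List.Relation.Unary.Unique.Propositional using (Unique)
open import Data.Maybe using (Maybe; just; nothing; maybe′)
open import Data.Nat using (ℕ; zero; suc; _+_; _*_; _≤_)
open import Data.Product using (_×_; _,_; ∃; ∃-syntax; Σ-syntax)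
open import Data.Vec as Vec using (Vec)
open import Function using (_∘_)
open import Function.Bundles using (_⇔_)
open import Relation.Binary.PropositionalEquality using (_≡_)

data Symbol (aux : ℕ) : Set where
  blank : Symbol aux
  bit   : Bool → Symbol aux
  other : Fin aux → Symbol aux

data Move : Set where
  left stay right : Move

-- The machine has 1 + extra tapes; the first one carries the input and,
-- on halting, the output.  It halts where δ is undefined.
record Machine : Set where
  field
    states aux extra : ℕ
    start : Fin states
    δ     : Fin states → Vec (Symbol aux) (suc extra) →
            Maybe (Fin states × Vec (Symbol aux × Move) (suc extra))

-- A two-way infinite tape, as a zipper around the scanned cell.  Both lists
-- start next to that cell, and all cells beyond their ends are blank.
record Tape (aux : ℕ) : Set where
  constructor tape
  field
    before : List (Symbol aux)
    head   : Symbol aux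
    after  : List (Symbol aux)

module _ {aux : ℕ} where

  write : Symbol aux → Tape aux → Tape aux
  write s (tape ls _ rs) = tape ls s rs

  move : Move → Tape aux → Tape aux
  move left  (tape []       s rs)       = tape [] blank (s ∷ rs)
  move left  (tape (l ∷ ls) s rs)       = tape ls l (s ∷ rs)
  move stay  t                          = t
  move right (tape ls       s [])       = tape (s ∷ ls) blank []
  move right (tape ls       s (r ∷ rs)) = tape (s ∷ ls) r rs

  load : List Bool → Tape aux
  load []       = tape [] blank []
  load (b ∷ bs) = tape [] (bit b) (List.map bit bs)

  leadingBits : List (Symbol aux) → List Bool
  leadingBits (bit b ∷ ss) = b ∷ leadingBits ss
  leadingBits _            = []

  -- The word from the scanned cell rightwards, up to the first non-bit.
  unload : Tape aux → List Bool
  unload (tape _ s rs) = leadingBits (s ∷ rs)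

module _ (M : Machine) where
  open Machine M

  record Config : Set where
    constructor config
    field
      state : Fin states
      tapes : Vec (Tape aux) (suc extra)

  open Config

  initial : List Bool → Config
  initial x = config start (load x Vec.∷ Vec.replicate extra (load []))

  next : Config → Maybe (Fin states × Vec (Symbol aux × Move) (suc extra))
  next c = δ (state c) (Vec.map Tape.head (tapes c))

  Halted : Config → Set
  Halted c = next c ≡ nothing

  output : Config → List Bool
  output c = unload (Vec.head (tapes c))

  -- Halted configurations are fixed.
  step : Config → Config
  step c = maybe′
    (λ (q , as) → config q (Vec.zipWith (λ (s , m) → move m ∘ write s) as (tapes c)))
    c (next c)

  run : ℕ → Config → Config
  run zero    c = c
  run (suc t) c = run t (step c)

  ComputesWithin : (ℕ → ℕ) → (List Bool → List Bool) → Set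
  ComputesWithin T f = ∀ x →
    let c = run (T (length x)) (initial x) in Halted c × output c ≡ f x

-- Univariate polynomials with coefficients in ℕ, as expressions.
data Poly : Set where
  var       : Poly
  const     : ℕ → Poly
  _⊕_ _⊗_   : Poly → Poly → Poly

⟦_⟧ : Poly → ℕ → ℕ
⟦ var     ⟧ n = n
⟦ const c ⟧ n = c
⟦ p ⊕ q   ⟧ n = ⟦ p ⟧ n + ⟦ q ⟧ n
⟦ p ⊗ q   ⟧ n = ⟦ p ⟧ n * ⟦ q ⟧ n

PolyTime : (List Bool → List Bool) → Set
PolyTime f = ∃[ M ] ∃[ p ] ComputesWithin M ⟦ p ⟧ f

Language : Set₁
Language = List Bool → Set

InP : Language → Set
InP L = Σ[ χ ∈ (List Bool → Bool) ]
  PolyTime (λ x → χ x ∷ []) × (∀ x → L x ⇔ (χ x ≡ true))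

-- Self-delimiting pairing: the bits of x doubled, then 01, then u.
⟨_,_⟩ : List Bool → List Bool → List Bool
⟨ x , u ⟩ = concatMap (λ b → b ∷ b ∷ []) x ++ false ∷ true ∷ u

InNP : Language → Set₁
InNP L = ∃[ R ] InP R ×
  ∃[ p ] (∀ x → L x ⇔ (∃[ u ] length u ≤ ⟦ p ⟧ (length x) × R ⟨ x , u ⟩))

_≤ₚ_ : Language → Language → Set
L ≤ₚ L′ = ∃[ f ] PolyTime f × (∀ x → L x ⇔ L′ (f x))

NPHard : Language → Set₁
NPHard L = ∀ L′ → InNP L′ → L′ ≤ₚ L

NPComplete : Language → Set₁
NPComplete L = InNP L × NPHard L

record Graph : Set where
  field
    order       : ℕ
    adj         : Fin order → Fin order → Bool
    symmetric   : ∀ u v → adj u v ≡ adj v u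
    irreflexive : ∀ v → adj v v ≡ false

module _ (G : Graph) where
  open Graph G

  N[_] : Fin order → Subset order
  N[ v ] = ⁅ v ⁆ ∪ Vec.tabulate (adj v)

  record IsPairingDominatingSet (ps : List (Fin order × Fin order)) : Set where
    field
      distinct   : Unique (concatMap (λ (u , v) → u ∷ v ∷ []) ps)
      dominating : ⋃ (List.map (λ (u , v) → N[ u ] ∩ N[ v ]) ps) ≡ ⊤

  HasPairingDominatingSet : Set
  HasPairingDominatingSet = ∃ IsPairingDominatingSet

  -- The order in unary, a 0, and the adjacency matrix row by row.
  encode : List Bool
  encode = List.replicate order true ++ false ∷
           concatMap (λ u → List.map (adj u) (List.allFin order)) (List.allFin order)

PairingDominatingSet : Language
PairingDominatingSet w = ∃[ G ] encode G ≡ w × HasPairingDominatingSet G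

{-# OPTIONS --safe #-}

-- Membership: a certificate is the matrix of the chosen pairs.  Whether it is one is a formula of
-- bounded arithmetic over the word, and such formulas are compiled to machines whose counters are
-- unary tapes, which takes polynomial time because every value is polynomially bounded.
--
-- Hardness: a computation on a guessed certificate is described by clauses over facts such as "with
-- s steps left, cell j holds σ".  Each fact becomes four elements which three triples force to be
-- perfectly matched among themselves, in three possible ways that encode the truth value; a clause
-- becomes a set of elements that must contain a matched pair.  Such a family of sets is turned into
-- a graph by making the elements a clique and joining sufficiently many copies of each set to its
-- elements.  The adjacency of this graph is again a formula of bounded arithmetic.

module Submission where

open import Data.Bool using (Bool; true; false; _∨_; if_then_else_)
import Data.Bool.Properties as Bool
open import Data.Empty using (⊥; ⊥-elim)
open import Data.Fin as Fin using (Fin; zero; suc; toℕ; fromℕ<; #_)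
import Data.Fin.Properties as Fin
import Data.Fin.Subset as Subset
import Data.Fin.Subset.Properties as Subset
open import Data.List as List using (List; []; _∷_; _++_; length; concatMap)
import Data.List.Membership.DecPropositional as DecMembership
open import Data.List.Membership.Propositional using (_∈_)
import Data.List.Membership.Propositional.Properties as ∈
import Data.List.Properties as List
open import Data.List.Relation.Unary.All as All using (All; []; _∷_)
import Data.List.Relation.Unary.All.Properties as All
open import Data.List.Relation.Unary.AllPairs using ([]; _∷_)
open import Data.List.Relation.Unary.Any as Any using (here; there)
import Data.List.Relation.Unary.Any.Properties as Any
open import Data.List.Relation.Unary.Unique.Propositional using (Unique)
import Data.List.Relation.Unary.Unique.Propositional.Properties as Unique
open import Data.Maybe using (Maybe; just; nothing; maybe′)
import Data.Maybe.Properties as Maybe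
open import Data.Nat
open import Data.Nat.DivMod using (_/_; _%_; m≡m%n+[m/n]*n; m%n<n; m<n*o⇒m/o<n)
open import Data.Nat.Properties
open import Data.Product using (_×_; _,_; ∃; ∃-syntax; proj₁; proj₂)
open import Data.Product.Properties using (≡-dec)
open import Data.Sum using (_⊎_; inj₁; inj₂; [_,_]′)
open import Data.Unit using (⊤; tt)
open import Data.Vec as Vec using (Vec; []; _∷_; lookup)
import Data.Vec.Properties as Vec
open import Defs
open import Function using (_∘_; id; case_of_)
open import Function.Bundles using (_⇔_; mk⇔; Equivalence)
open import Relation.Binary.Definitions using (tri<; tri≈; tri>)
open import Relation.Binary.PropositionalEquality
open import Relation.Nullary using (¬_; Dec; yes; no; contradiction; does)
open import Relation.Nullary.Decidable using (dec-true; dec-false; _×-dec_)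

-- Structured programs and their machines

-- Both halves have to end in Turing machines, and the second must do so for an arbitrary language
-- in NP. So the work of a machine is reduced to one task: printing a word whose bits are given by a
-- single formula. This forces the reduction to be uniform. A family of clauses or of sets is a
-- fixed finite list of schemata in two numbers s and j, so that the adjacency relation is one
-- formula of fixed size, which depends on the verifier of the language but not on the input.
--
-- On the graph side, a copy of a set is adjacent to elements only. A pair that dominates the copy
-- therefore lies within the set, or it contains the copy itself together with an element. Disjoint
-- pairs can be of the second sort for at most as many copies as there are elements, and one copy
-- more excludes it. The clique takes care of the elements themselves, because any pair of elements
-- dominates all of them. Hence the gadgets only have to control which elements are matched, and
-- they must keep the elements of different variables apart.

data Cmd (n : ℕ) : Set where
  prim  : (Vec (Symbol 0) n → Fin n → Symbol 0 × Move) → Cmd n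
  _⨟_   : Cmd n → Cmd n → Cmd n
  while : (Vec (Symbol 0) n → Bool) → Cmd n → Cmd n
  cond  : (Vec (Symbol 0) n → Bool) → Cmd n → Cmd n → Cmd n

infixr 5 _⨟_

idle : ∀ {n} → Vec (Symbol 0) n → Fin n → Symbol 0 × Move
idle h f = lookup h f , stay

Ctl : ∀ {n} → Cmd n → Set
Ctl (prim a)     = ⊤
Ctl (c ⨟ d)      = Ctl c ⊎ Ctl d
Ctl (while p c)  = ⊤ ⊎ Ctl c
Ctl (cond p c d) = ⊤ ⊎ (Ctl c ⊎ Ctl d)

entry : ∀ {n} (c : Cmd n) → Ctl c
entry (prim a)     = tt
entry (c ⨟ d)      = inj₁ (entry c)
entry (while p c)  = inj₁ tt
entry (cond p c d) = inj₁ tt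

-- The next control point, where nothing means leaving the command.
goto : ∀ {n} (c : Cmd n) → Ctl c → Vec (Symbol 0) n → Maybe (Ctl c)
goto (prim a)     _               h = nothing
goto (c ⨟ d)      (inj₁ q)        h = just (maybe′ inj₁ (inj₂ (entry d)) (goto c q h))
goto (c ⨟ d)      (inj₂ q)        h = maybe′ (just ∘ inj₂) nothing (goto d q h)
goto (while p c)  (inj₁ _)        h = if p h then just (inj₂ (entry c)) else nothing
goto (while p c)  (inj₂ q)        h = just (maybe′ inj₂ (inj₁ tt) (goto c q h))
goto (cond p c d) (inj₁ _)        h = just (if p h then inj₂ (inj₁ (entry c)) else inj₂ (inj₂ (entry d)))
goto (cond p c d) (inj₂ (inj₁ q)) h = maybe′ (just ∘ inj₂ ∘ inj₁) nothing (goto c q h)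
goto (cond p c d) (inj₂ (inj₂ q)) h = maybe′ (just ∘ inj₂ ∘ inj₂) nothing (goto d q h)

action : ∀ {n} (c : Cmd n) → Ctl c → Vec (Symbol 0) n → Fin n → Symbol 0 × Move
action (prim a)     _               = a
action (c ⨟ d)      (inj₁ q)        = action c q
action (c ⨟ d)      (inj₂ q)        = action d q
action (while p c)  (inj₁ _)        = idle
action (while p c)  (inj₂ q)        = action c q
action (cond p c d) (inj₁ _)        = idle
action (cond p c d) (inj₂ (inj₁ q)) = action c q
action (cond p c d) (inj₂ (inj₂ q)) = action d q

size : ∀ {n} → Cmd n → ℕ
size (prim a)     = 1
size (c ⨟ d)      = size c + size d
size (while p c)  = suc (size c)
size (cond p c d) = suc (size c + size d)

number : ∀ {n} (c : Cmd n) → Ctl c → Fin (size c)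
number (prim a)     _               = zero
number (c ⨟ d)      (inj₁ q)        = number c q Fin.↑ˡ size d
number (c ⨟ d)      (inj₂ q)        = size c Fin.↑ʳ number d q
number (while p c)  (inj₁ _)        = zero
number (while p c)  (inj₂ q)        = suc (number c q)
number (cond p c d) (inj₁ _)        = zero
number (cond p c d) (inj₂ (inj₁ q)) = suc (number c q Fin.↑ˡ size d)
number (cond p c d) (inj₂ (inj₂ q)) = suc (size c Fin.↑ʳ number d q)

point : ∀ {n} (c : Cmd n) → Fin (size c) → Ctl c
point (prim a)     _       = tt
point (c ⨟ d)      f       = [ inj₁ ∘ point c , inj₂ ∘ point d ]′ (Fin.splitAt (size c) f)
point (while p c)  zero    = inj₁ tt
point (while p c)  (suc f) = inj₂ (point c f)
point (cond p c d) zero    = inj₁ tt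
point (cond p c d) (suc f) =
  inj₂ ([ inj₁ ∘ point c , inj₂ ∘ point d ]′ (Fin.splitAt (size c) f))

point-number : ∀ {n} (c : Cmd n) q → point c (number c q) ≡ q
point-number (prim a)     _        = refl
point-number (c ⨟ d)      (inj₁ q)
  rewrite Fin.splitAt-↑ˡ (size c) (number c q) (size d) = cong inj₁ (point-number c q)
point-number (c ⨟ d)      (inj₂ q)
  rewrite Fin.splitAt-↑ʳ (size c) (size d) (number d q) = cong inj₂ (point-number d q)
point-number (while p c)  (inj₁ _) = refl
point-number (while p c)  (inj₂ q) = cong inj₂ (point-number c q)
point-number (cond p c d) (inj₁ _) = refl
point-number (cond p c d) (inj₂ (inj₁ q))
  rewrite Fin.splitAt-↑ˡ (size c) (number c q) (size d) = cong (inj₂ ∘ inj₁) (point-number c q)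
point-number (cond p c d) (inj₂ (inj₂ q))
  rewrite Fin.splitAt-↑ʳ (size c) (size d) (number d q) = cong (inj₂ ∘ inj₂) (point-number d q)

-- State `zero` halts, and the control points are shifted by one to make room for it. A `nothing`
-- from `goto`, which means leaving the program, becomes `zero`.
machine : ∀ {e} → Cmd (suc e) → Machine
machine {e} c = record
  { states = suc (size c)
  ; aux    = 0
  ; extra  = e
  ; start  = suc (number c (entry c))
  ; δ      = λ where
      zero    h → nothing
      (suc f) h → just ( maybe′ (suc ∘ number c) zero (goto c (point c f) h)
                       , Vec.tabulate (action c (point c f) h))
  }

heads : ∀ {n} → Vec (Tape 0) n → Vec (Symbol 0) n
heads = Vec.map Tape.head

act : Symbol 0 × Move → Tape 0 → Tape 0
act (s , m) = move m ∘ write s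

apply : ∀ {n} → (Vec (Symbol 0) n → Fin n → Symbol 0 × Move) → Vec (Tape 0) n → Vec (Tape 0) n
apply a ts = Vec.zipWith act (Vec.tabulate (a (heads ts))) ts

lookup-apply : ∀ {n} a (ts : Vec (Tape 0) n) f →
  lookup (apply a ts) f ≡ act (a (heads ts) f) (lookup ts f)
lookup-apply a ts f = trans
  (Vec.lookup-zipWith act f (Vec.tabulate (a (heads ts))) ts)
  (cong (λ z → act z (lookup ts f)) (Vec.lookup∘tabulate (a (heads ts)) f))

lookup-extensional : ∀ {A : Set} {n} (xs ys : Vec A n) →
  (∀ f → lookup xs f ≡ lookup ys f) → xs ≡ ys
lookup-extensional xs ys eq = trans (sym (Vec.tabulate∘lookup xs))
  (trans (Vec.tabulate-cong eq) (Vec.tabulate∘lookup ys))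

apply-idle : ∀ {n} (ts : Vec (Tape 0) n) → apply idle ts ≡ ts
apply-idle ts = lookup-extensional _ _ λ f → trans (lookup-apply idle ts f)
  (cong (λ s → write s (lookup ts f)) (Vec.lookup-map f Tape.head ts))

-- The step count is exact. Testing a condition costs one step, because the control point of a
-- `while` or `cond` idles once before it branches.
data Exec {n} : Cmd n → Vec (Tape 0) n → ℕ → Vec (Tape 0) n → Set where
  exec-prim  : ∀ {a ts} → Exec (prim a) ts 1 (apply a ts)
  exec-seq   : ∀ {c d ts ts₁ ts₂ m k} → Exec c ts m ts₁ → Exec d ts₁ k ts₂ →
               Exec (c ⨟ d) ts (m + k) ts₂
  exec-stop  : ∀ {p c ts} → p (heads ts) ≡ false → Exec (while p c) ts 1 ts
  exec-loop  : ∀ {p c ts ts₁ ts₂ m k} → p (heads ts) ≡ true →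
               Exec c ts m ts₁ → Exec (while p c) ts₁ k ts₂ →
               Exec (while p c) ts (suc (m + k)) ts₂
  exec-true  : ∀ {p c d ts ts₁ m} → p (heads ts) ≡ true → Exec c ts m ts₁ →
               Exec (cond p c d) ts (suc m) ts₁
  exec-false : ∀ {p c d ts ts₁ m} → p (heads ts) ≡ false → Exec d ts m ts₁ →
               Exec (cond p c d) ts (suc m) ts₁

run-+ : ∀ M m k c → run M (m + k) c ≡ run M k (run M m c)
run-+ M zero    k c = refl
run-+ M (suc m) k c = run-+ M m k (step M c)

step-just : ∀ M c {q as} → next M c ≡ just (q , as) →
  step M c ≡ config q (Vec.zipWith (λ (s , m) → move m ∘ write s) as (Config.tapes c))
step-just M c eq = cong (maybe′ _ c) eq

step-halted : ∀ M c → Halted M c → step M c ≡ c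
step-halted M c h = cong (maybe′ _ c) h

run-halted : ∀ M c k → Halted M c → run M k c ≡ c
run-halted M c zero    h = refl
run-halted M c (suc k) h rewrite step-halted M c h = run-halted M c k h

module _ {e : ℕ} (p : Cmd (suc e)) where

  -- c sits inside p: its control points are states of the machine, and it is left into state x.
  Embeds : (c : Cmd (suc e)) → (Ctl c → Fin (suc (size p))) → Fin (suc (size p)) → Set
  Embeds c ι x = ∀ q h →
    Machine.δ (machine p) (ι q) h ≡ just (maybe′ ι x (goto c q h) , Vec.tabulate (action c q h))

  embeds-self : Embeds p (suc ∘ number p) zero
  embeds-self q h rewrite point-number p q = refl

  record Reaches (q : Fin (suc (size p))) (ts : Vec (Tape 0) (suc e)) (m : ℕ)
                 (q′ : Fin (suc (size p))) (ts′ : Vec (Tape 0) (suc e)) : Set where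
    constructor reaches
    field reached : run (machine p) m (config q ts) ≡ config q′ ts′

  private
    single : ∀ c {ι x} → Embeds c ι x → ∀ q ts →
      Reaches (ι q) ts 1 (maybe′ ι x (goto c q (heads ts))) (apply (action c q) ts)
    single c em q ts = reaches (step-just (machine p) (config _ ts) (em q (heads ts)))

    _then_ : ∀ {q₀ q₁ q₂ ts₀ ts₁ ts₂ m k} → Reaches q₀ ts₀ m q₁ ts₁ → Reaches q₁ ts₁ k q₂ ts₂ →
      Reaches q₀ ts₀ (m + k) q₂ ts₂
    _then_ {m = m} {k} (reaches r) (reaches s) =
      reaches (trans (run-+ (machine p) m k _) (trans (cong (run (machine p) k) r) s))

    infixr 4 _then_

    idling : ∀ c {ι x} → Embeds c ι x → ∀ q ts {q′} → action c q ≡ idle →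
      maybe′ ι x (goto c q (heads ts)) ≡ q′ → Reaches (ι q) ts 1 q′ ts
    idling c em q ts idl refl = subst (Reaches _ ts 1 _)
      (trans (cong (λ a → apply a ts) idl) (apply-idle ts)) (single c em q ts)

    -- A subcommand c of d, left towards x inside d, or left together with d.
    embeds-inner : ∀ c d {ι x} → Embeds d ι x → (f : Ctl c → Ctl d) (y : Ctl d) →
      (∀ q h → goto d (f q) h ≡ just (maybe′ f y (goto c q h))) →
      (∀ q → action d (f q) ≡ action c q) → Embeds c (ι ∘ f) (ι y)
    embeds-inner c d em f y g a q h with goto c q h | em (f q) h | g q h | a q
    ... | just _  | eq | g′ | a′ rewrite g′ | a′ = eq
    ... | nothing | eq | g′ | a′ rewrite g′ | a′ = eq

    embeds-last : ∀ c d {ι x} → Embeds d ι x → (f : Ctl c → Ctl d) →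
      (∀ q h → goto d (f q) h ≡ maybe′ (just ∘ f) nothing (goto c q h)) →
      (∀ q → action d (f q) ≡ action c q) → Embeds c (ι ∘ f) x
    embeds-last c d em f g a q h with goto c q h | em (f q) h | g q h | a q
    ... | just _  | eq | g′ | a′ rewrite g′ | a′ = eq
    ... | nothing | eq | g′ | a′ rewrite g′ | a′ = eq

  -- The embedding and the exit are arbitrary because the induction descends to subcommands, whose
  -- exit is usually another control point of the program and not the halting state.
  exec-reaches : ∀ {c ts m ts′} → Exec c ts m ts′ → ∀ {ι x} → Embeds c ι x →
    Reaches (ι (entry c)) ts m x ts′
  exec-reaches (exec-prim {a}) em = single (prim a) em _ _
  exec-reaches (exec-seq {c} {d} a b) em =
    exec-reaches a (embeds-inner c (c ⨟ d) em inj₁ (inj₂ (entry d)) (λ _ _ → refl) (λ _ → refl)) then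
    exec-reaches b (embeds-last d (c ⨟ d) em inj₂ (λ _ _ → refl) (λ _ → refl))
  exec-reaches (exec-stop {p′} {c} {ts} f) {ι} {x} em = idling (while p′ c) em (inj₁ tt) ts refl
    (cong (λ b → maybe′ ι x (if b then just (inj₂ (entry c)) else nothing)) f)
  exec-reaches (exec-loop {p′} {c} {ts} t a b) {ι} {x} em =
    idling (while p′ c) em (inj₁ tt) ts refl
      (cong (λ b → maybe′ ι x (if b then just (inj₂ (entry c)) else nothing)) t) then
    exec-reaches a (embeds-inner c (while p′ c) em inj₂ (inj₁ tt) (λ _ _ → refl) (λ _ → refl)) then
    exec-reaches b em
  exec-reaches (exec-true {p′} {c} {d} {ts} t a) {ι} {x} em =
    idling (cond p′ c d) em (inj₁ tt) ts refl
      (cong (λ b → ι (if b then inj₂ (inj₁ (entry c)) else inj₂ (inj₂ (entry d)))) t) then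
    exec-reaches a (embeds-last c (cond p′ c d) em (inj₂ ∘ inj₁) (λ _ _ → refl) (λ _ → refl))
  exec-reaches (exec-false {p′} {c} {d} {ts} t a) {ι} {x} em =
    idling (cond p′ c d) em (inj₁ tt) ts refl
      (cong (λ b → ι (if b then inj₂ (inj₁ (entry c)) else inj₂ (inj₂ (entry d)))) t) then
    exec-reaches a (embeds-last d (cond p′ c d) em (inj₂ ∘ inj₂) (λ _ _ → refl) (λ _ → refl))

-- The execution may end before the time bound. Halted configurations are fixed, so running on until
-- the bound changes nothing.
computes : ∀ {e} (p : Cmd (suc e)) (T : ℕ → ℕ) (f : List Bool → List Bool) →
  (∀ x → ∃[ ts ] ∃[ m ] m ≤ T (length x) ×
     Exec p (load x ∷ Vec.replicate e (load [])) m ts × unload (Vec.head ts) ≡ f x) →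
  ComputesWithin (machine p) T f
computes p T f h x with ts , m , m≤ , ex , out ← h x =
  subst (λ c → Halted (machine p) c × output (machine p) c ≡ f x) (sym final) (refl , out)
  where
  final : run (machine p) (T (length x)) (initial (machine p) x) ≡ config zero ts
  final = trans
    (cong (λ k → run (machine p) k (initial (machine p) x)) (sym (m+[n∸m]≡n m≤)))
    (trans (run-+ (machine p) m _ _)
    (trans (cong (run (machine p) (T (length x) ∸ m)) (Reaches.reached (exec-reaches p ex (embeds-self p))))
           (run-halted (machine p) _ (T (length x) ∸ m) refl)))

-- Counters and input on tapes

nth : ∀ {A : Set} → A → List A → ℕ → A
nth d []       _       = d
nth d (x ∷ xs) zero    = x
nth d (x ∷ xs) (suc i) = nth d xs i

only : ∀ {n} → Fin n → (Vec (Symbol 0) n → Symbol 0 × Move) → Cmd n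
only f g = prim λ h f′ → if does (f Fin.≟ f′) then g h else idle h f′

module _ {n} (f : Fin n) (g : Vec (Symbol 0) n → Symbol 0 × Move) (ts : Vec (Tape 0) n) where

  exec-only : ∃[ ts′ ] Exec (only f g) ts 1 ts′ × lookup ts′ f ≡ act (g (heads ts)) (lookup ts f)
                × (∀ f′ → f ≢ f′ → lookup ts′ f′ ≡ lookup ts f′)
  exec-only = _ , exec-prim , trans (lookup-apply a ts f) (cong (λ z → act z (lookup ts f)) acted)
            , λ f′ f≢f′ → trans (lookup-apply a ts f′) (trans
                (cong (λ z → act z (lookup ts f′)) (kept f′ f≢f′))
                (cong (λ s → write s (lookup ts f′)) (Vec.lookup-map f′ Tape.head ts)))
    where
    a = λ h f′ → if does (f Fin.≟ f′) then g h else idle h f′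
    acted : (if does (f Fin.≟ f) then g (heads ts) else idle (heads ts) f) ≡ g (heads ts)
    acted with f Fin.≟ f
    ... | yes _ = refl
    ... | no f≢f = contradiction refl f≢f
    kept : ∀ f′ → f ≢ f′ →
      (if does (f Fin.≟ f′) then g (heads ts) else idle (heads ts) f′) ≡ idle (heads ts) f′
    kept f′ f≢f′ with f Fin.≟ f′
    ... | yes eq = contradiction eq f≢f′
    ... | no _ = refl

-- Counters are named by natural numbers, which lets `compile` take the next free one as `suc b`.
-- Names beyond the last tape collapse, hence the side conditions `j ≤ K` below.
clamp : ∀ n → ℕ → Fin (suc n)
clamp zero    _       = zero
clamp (suc n) zero    = zero
clamp (suc n) (suc j) = suc (clamp n j)

toℕ-clamp : ∀ {n j} → j ≤ n → toℕ (clamp n j) ≡ j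
toℕ-clamp {zero}  z≤n     = refl
toℕ-clamp {suc n} z≤n     = refl
toℕ-clamp {suc n} (s≤s p) = cong suc (toℕ-clamp p)

mark : Symbol 0
mark = bit true

cell : List Bool → ℕ → Symbol 0
cell x = nth blank (List.map bit x)

-- Tape 0 collects the output, tape 1 holds the input, and the others are counters.
record Store : Set where
  constructor store
  field
    out : List Bool
    pos : ℕ
    cnt : ℕ → ℕ

open Store public

-- A counter is the distance of the head from the only visited blank cell.
Counts : ℕ → Tape 0 → Set
Counts v t = Tape.head t ∷ Tape.before t ≡ List.replicate v mark ++ blank ∷ []

-- `here` admits anything to the left of position 0, since the head never has to go there.
data Behind (x : List Bool) : ℕ → List (Symbol 0) → Set where
  here  : ∀ {ls} → Behind x 0 ls
  there : ∀ {p ls} → Behind x p ls → Behind x (suc p) (cell x p ∷ ls)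

-- The cells ahead are compared position by position, not as lists, because moving past the end of
-- the word appends blanks to the tape.
record InputAt (x : List Bool) (p : ℕ) (t : Tape 0) : Set where
  constructor inputAt
  field
    behind : Behind x p (Tape.before t)
    at     : Tape.head t ≡ cell x p
    ahead  : ∀ i → nth blank (Tape.after t) i ≡ cell x (suc p + i)

module _ {K : ℕ} where

  counter : ℕ → Fin (3 + K)
  counter j = suc (suc (clamp K j))

  counter-injective : ∀ {i j} → i ≤ K → j ≤ K → counter i ≡ counter j → i ≡ j
  counter-injective i≤ j≤ eq = trans (sym (toℕ-clamp i≤))
    (trans (cong toℕ (Fin.suc-injective (Fin.suc-injective eq))) (toℕ-clamp j≤))

  -- `dec` leaves stale marks to the right of the head. They do no harm, because `Counts` does not
  -- mention those cells and `inc` writes its mark afresh.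
  inc dec : ℕ → Cmd (3 + K)
  inc j = only (counter j) (λ h → lookup h (counter j) , right) ⨟ only (counter j) (λ _ → mark , stay)
  dec j = only (counter j) (λ h → lookup h (counter j) , left)

  advance retreat : Cmd (3 + K)
  advance = only (suc zero) (λ h → lookup h (suc zero) , right)
  retreat = only (suc zero) (λ h → lookup h (suc zero) , left)

  -- Writing from right to left fits loops that count their index down to 0: the finished word is
  -- then in order.
  emit : Bool → Cmd (3 + K)
  emit b = only zero (λ _ → bit b , left)

  isMark : Symbol 0 → Bool
  isMark (bit b) = b
  isMark _       = false

  positive : ℕ → Vec (Symbol 0) (3 + K) → Bool
  positive j h = isMark (lookup h (counter j))

  scanned : Vec (Symbol 0) (3 + K) → Bool
  scanned h = isMark (lookup h (suc zero))

-- Stores up to pointwise equality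

infix 4 _≈_
-- Updating counters in different orders gives functions that agree only pointwise, so propositional
-- equality of stores would be too strict.
record _≈_ (s s′ : Store) : Set where
  constructor same
  field
    out≈ : out s ≡ out s′
    pos≈ : pos s ≡ pos s′
    cnt≈ : ∀ i → cnt s i ≡ cnt s′ i
open _≈_ public

≈-refl : ∀ {s} → s ≈ s
≈-refl = same refl refl λ _ → refl

≈-sym : ∀ {s t} → s ≈ t → t ≈ s
≈-sym (same a b c) = same (sym a) (sym b) (λ i → sym (c i))

≈-trans : ∀ {s t u} → s ≈ t → t ≈ u → s ≈ u
≈-trans (same a b c) (same a′ b′ c′) = same (trans a a′) (trans b b′) (λ i → trans (c i) (c′ i))

opaque

  update : (ℕ → ℕ) → ℕ → ℕ → ℕ → ℕ
  update f r v i = if does (i ≟ r) then v else f i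

  update-same : ∀ {f r v} → update f r v r ≡ v
  update-same {r = r} rewrite dec-true (r ≟ r) refl = refl

  update-other : ∀ {f r v i} → i ≢ r → update f r v i ≡ f i
  update-other {r = r} {i = i} i≢r rewrite dec-false (i ≟ r) i≢r = refl

set : ℕ → ℕ → Store → Store
set r v s = store (out s) (pos s) (update (cnt s) r v)

set-unique : ∀ {r v s s′} → out s′ ≡ out s → pos s′ ≡ pos s → cnt s′ r ≡ v →
  (∀ i → i ≢ r → cnt s′ i ≡ cnt s i) → s′ ≈ set r v s
set-unique {r} {v} {s} {s′} o p h t = same o p λ i → case i ≟ r of λ where
  (yes refl) → trans h (sym (update-same))
  (no i≢r)   → trans (t i i≢r) (sym (update-other i≢r))

set-cong : ∀ {r v s s′} → s ≈ s′ → set r v s ≈ set r v s′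
set-cong {r} {v} {s} {s′} (same o p c) = set-unique o p (update-same)
  λ i i≢r → trans (update-other i≢r) (c i)

set-id : ∀ {r v s} → cnt s r ≡ v → set r v s ≈ s
set-id {r} {v} {s} eq = ≈-sym (set-unique refl refl eq λ _ _ → refl)

set-set : ∀ {r v w s} → set r v (set r w s) ≈ set r v s
set-set {r} {v} {w} {s} = set-unique refl refl (update-same)
  λ i i≢r → trans (update-other i≢r) (update-other i≢r)

set-comm : ∀ {r q v w s} → r ≢ q → set r v (set q w s) ≈ set q w (set r v s)
set-comm {r} {q} {v} {w} {s} r≢q = set-unique refl refl
  (trans (update-other (r≢q ∘ sym)) (update-same)) go
  where
  go : ∀ i → i ≢ q → cnt (set r v (set q w s)) i ≡ cnt (set r v s) i
  go i i≢q = case i ≟ r of λ where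
    (yes refl) → trans (update-same) (sym (update-same))
    (no i≢r)   → trans (update-other i≢r) (trans (update-other i≢q) (sym (update-other i≢r)))

-- Stores represented by tapes, and timed runs

module Running (K : ℕ) (x : List Bool) where

  -- Nothing is said about the scanned cell of tape 0 or the cells to its left. The original input
  -- may remain there until `emit` overwrites it.
  record Rep (s : Store) (ts : Vec (Tape 0) (3 + K)) : Set where
    constructor rep
    field
      outOK : Tape.after (lookup ts zero) ≡ List.map bit (out s)
      posOK : InputAt x (pos s) (lookup ts (suc zero))
      cntOK : ∀ j → j ≤ K → Counts (cnt s j) (lookup ts (counter j))

  rep-≈ : ∀ {s s′ ts} → s ≈ s′ → Rep s ts → Rep s′ ts
  rep-≈ {s} {s′} {ts} (same o p c) (rep a b d) = rep
    (trans a (cong (List.map bit) o)) (subst (λ p → InputAt x p (lookup ts (suc zero))) p b)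
    λ j j≤ → subst (λ v → Counts v (lookup ts (counter j))) (c j) (d j j≤)

  record Run (c : Cmd (3 + K)) (s : Store) (T : ℕ) (s′ : Store) : Set where
    constructor runs
    field
      exec : ∀ ts → Rep s ts → ∃[ ts′ ] ∃[ m ] m ≤ T × Exec c ts m ts′ × Rep s′ ts′
  open Run public

  run-≈ : ∀ {c s₁ s₂ s₃ s₄ T} → s₁ ≈ s₂ → Run c s₂ T s₃ → s₃ ≈ s₄ → Run c s₁ T s₄
  run-≈ p (runs r) q = runs λ ts R → let ts′ , m , m≤ , ex , R′ = r ts (rep-≈ p R) in
    ts′ , m , m≤ , ex , rep-≈ q R′

  run-≤ : ∀ {c s T T′ s′} → T ≤ T′ → Run c s T s′ → Run c s T′ s′
  run-≤ T≤ (runs r) = runs λ ts R → let ts′ , m , m≤ , ex , R′ = r ts R in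
    ts′ , m , ≤-trans m≤ T≤ , ex , R′

  run-seq : ∀ {c d s₁ s₂ s₃ T U} → Run c s₁ T s₂ → Run d s₂ U s₃ → Run (c ⨟ d) s₁ (T + U) s₃
  run-seq (runs r) (runs q) = runs λ ts R → let
    ts₁ , m , m≤ , ex , R₁ = r ts R
    ts₂ , k , k≤ , ex′ , R₂ = q ts₁ R₁ in
    ts₂ , m + k , +-mono-≤ m≤ k≤ , exec-seq ex ex′ , R₂

  Tests : (Vec (Symbol 0) (3 + K) → Bool) → Store → Bool → Set
  Tests p s b = ∀ ts → Rep s ts → p (heads ts) ≡ b

  run-stop : ∀ {p c s} → Tests p s false → Run (while p c) s 1 s
  run-stop t = runs λ ts R → ts , 1 , ≤-refl , exec-stop (t ts R) , R

  run-loop : ∀ {p c s s₁ s₂ T U} → Tests p s true → Run c s T s₁ → Run (while p c) s₁ U s₂ →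
    Run (while p c) s (suc (T + U)) s₂
  run-loop t (runs r) (runs q) = runs λ ts R → let
    ts₁ , m , m≤ , ex , R₁ = r ts R
    ts₂ , k , k≤ , ex′ , R₂ = q ts₁ R₁ in
    ts₂ , suc (m + k) , s≤s (+-mono-≤ m≤ k≤) , exec-loop (t ts R) ex ex′ , R₂

  run-true : ∀ {p c d s s₁ T} → Tests p s true → Run c s T s₁ → Run (cond p c d) s (suc T) s₁
  run-true t (runs r) = runs λ ts R → let ts₁ , m , m≤ , ex , R₁ = r ts R in
    ts₁ , suc m , s≤s m≤ , exec-true (t ts R) ex , R₁

  run-false : ∀ {p c d s s₁ T} → Tests p s false → Run d s T s₁ → Run (cond p c d) s (suc T) s₁
  run-false t (runs r) = runs λ ts R → let ts₁ , m , m≤ , ex , R₁ = r ts R in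
    ts₁ , suc m , s≤s m≤ , exec-false (t ts R) ex , R₁

  tests-positive : ∀ {j v} s → j ≤ K → cnt s j ≡ v → Tests (positive j) s (0 <ᵇ v)
  tests-positive {j} {v} s j≤ refl ts R
    rewrite Vec.lookup-map (counter {K} j) Tape.head ts = go (lookup ts (counter j)) (cnt s j) (Rep.cntOK R j j≤)
    where
    go : ∀ t v → Counts v t → isMark {K} (Tape.head t) ≡ (0 <ᵇ v)
    go (tape ls h rs) zero    refl = refl
    go (tape ls h rs) (suc v) refl = refl

  tests-scanned : ∀ s {b} → isMark {K} (cell x (pos s)) ≡ b → Tests scanned s b
  tests-scanned s refl ts R rewrite Vec.lookup-map (suc zero) Tape.head ts
    = cong (isMark {K}) (InputAt.at (Rep.posOK R))

  private
    keep : ∀ {ts : Vec (Tape 0) (3 + K)} {f} →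
      lookup (heads ts) f ≡ Tape.head (lookup ts f)
    keep {ts} {f} = Vec.lookup-map f Tape.head ts

    push : ∀ {v s t} → s ≡ Tape.head t → Counts v t → Counts (suc v) (act (mark , stay) (act (s , right) t))
    push {t = tape ls h []}       refl eq = cong (mark ∷_) eq
    push {t = tape ls h (_ ∷ rs)} refl eq = cong (mark ∷_) eq

    pop : ∀ {v s t} → s ≡ Tape.head t → Counts (suc v) t → Counts v (act (s , left) t)
    pop {zero}  {t = tape .(_ ∷ []) h rs} refl refl = refl
    pop {suc v} {t = tape .(_ ∷ _) h rs}  refl refl = refl

    put : ∀ {b t ss} → Tape.after t ≡ ss → Tape.after (act (bit b , left) t) ≡ bit b ∷ ss
    put {t = tape []       h rs} refl = refl
    put {t = tape (_ ∷ ls) h rs} refl = refl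

    forth : ∀ {p s t} → s ≡ Tape.head t → InputAt x p t → InputAt x (suc p) (act (s , right) t)
    forth {p} {t = tape ls h []} refl (inputAt b refl f) = inputAt (there b)
      (trans (f 0) (cong (cell x ∘ suc) (+-identityʳ p)))
      (λ i → trans (f (suc i)) (cong (cell x ∘ suc) (+-suc p i)))
    forth {p} {t = tape ls h (r ∷ rs)} refl (inputAt b refl f) = inputAt (there b)
      (trans (f 0) (cong (cell x ∘ suc) (+-identityʳ p)))
      (λ i → trans (f (suc i)) (cong (cell x ∘ suc) (+-suc p i)))

    back : ∀ {p s t} → s ≡ Tape.head t → InputAt x (suc p) t → InputAt x p (act (s , left) t)
    back {p} {t = tape _ h rs} refl (inputAt (there b) refl f) = inputAt b refl λ where
      zero    → cong (cell x ∘ suc) (sym (+-identityʳ p))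
      (suc i) → trans (f i) (cong (cell x ∘ suc) (sym (+-suc p i)))

    others : ∀ {i j} → i ≤ K → j ≤ K → i ≢ j → counter {K} j ≢ counter i
    others i≤ j≤ i≢j eq = i≢j (sym (counter-injective j≤ i≤ eq))

  run-inc : ∀ {j v} s → j ≤ K → cnt s j ≡ v → Run (inc j) s 2 (set j (suc v) s)
  run-inc {j} s j≤ refl = runs λ ts (rep a b c) → let
    ts₁ , ex₁ , here₁ , there₁ = exec-only (counter j) (λ h → lookup h (counter j) , right) ts
    ts₂ , ex₂ , here₂ , there₂ = exec-only (counter j) (λ _ → mark , stay) ts₁
    rest = λ f ne → trans (there₂ f ne) (there₁ f ne) in
    ts₂ , 2 , ≤-refl , exec-seq ex₁ ex₂ , rep
      (trans (cong Tape.after (rest zero λ ())) a)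
      (subst (InputAt x _) (sym (rest (suc zero) λ ())) b)
      λ i i≤ → case i ≟ j of λ where
        (yes refl) → subst₂ Counts (sym (update-same))
           (sym (trans here₂ (cong (act (mark , stay)) here₁))) (push {t = lookup ts (counter j)} (keep {ts}) (c j j≤))
        (no i≢j) → subst₂ Counts (sym (update-other i≢j)) (sym (rest _ (others i≤ j≤ i≢j))) (c i i≤)

  run-dec : ∀ {j v} s → j ≤ K → cnt s j ≡ suc v → Run (dec j) s 1 (set j v s)
  run-dec {j} {v} s j≤ eq = runs λ ts (rep a b c) → let
    ts₁ , ex₁ , here₁ , rest = exec-only (counter j) (λ h → lookup h (counter j) , left) ts in
    ts₁ , 1 , ≤-refl , ex₁ , rep
      (trans (cong Tape.after (rest zero λ ())) a)
      (subst (InputAt x _) (sym (rest (suc zero) λ ())) b)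
      λ i i≤ → case i ≟ j of λ where
        (yes refl) → subst₂ Counts (sym (update-same)) (sym here₁)
           (pop {t = lookup ts (counter j)} (keep {ts}) (subst (λ v → Counts v (lookup ts (counter j))) eq (c j j≤)))
        (no i≢j) → subst₂ Counts (sym (update-other i≢j)) (sym (rest _ (others i≤ j≤ i≢j))) (c i i≤)

  run-emit : ∀ b s → Run (emit b) s 1 (store (b ∷ out s) (pos s) (cnt s))
  run-emit b s = runs λ ts (rep a p c) → let
    ts₁ , ex₁ , here₁ , rest = exec-only zero (λ _ → bit b , left) ts in
    ts₁ , 1 , ≤-refl , ex₁ , rep
      (trans (cong Tape.after here₁) (put {t = lookup ts zero} a))
      (subst (InputAt x _) (sym (rest (suc zero) λ ())) p)
      λ i i≤ → subst (Counts _) (sym (rest _ λ ())) (c i i≤)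

  run-advance : ∀ s → Run advance s 1 (store (out s) (suc (pos s)) (cnt s))
  run-advance s = runs λ ts (rep a p c) → let
    ts₁ , ex₁ , here₁ , rest = exec-only (suc zero) (λ h → lookup h (suc zero) , right) ts in
    ts₁ , 1 , ≤-refl , ex₁ , rep
      (trans (cong Tape.after (rest zero λ ())) a)
      (subst (InputAt x _) (sym here₁) (forth {t = lookup ts (suc zero)} (keep {ts}) p))
      λ i i≤ → subst (Counts _) (sym (rest _ λ ())) (c i i≤)

  run-retreat : ∀ {p} s → pos s ≡ suc p → Run retreat s 1 (store (out s) p (cnt s))
  run-retreat s refl = runs λ ts (rep a p c) → let
    ts₁ , ex₁ , here₁ , rest = exec-only (suc zero) (λ h → lookup h (suc zero) , left) ts in
    ts₁ , 1 , ≤-refl , ex₁ , rep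
      (trans (cong Tape.after (rest zero λ ())) a)
      (subst (InputAt x _) (sym here₁) (back {t = lookup ts (suc zero)} (keep {ts}) p))
      λ i i≤ → subst (Counts _) (sym (rest _ λ ())) (c i i≤)

-- Terms of bounded arithmetic and their compilation

data Term (k : ℕ) : Set where
  ix          : Fin k → Term k
  num         : ℕ → Term k
  len         : Term k
  bitAt       : Term k → Term k
  _⊞_ _⊠_ _⊟_ : Term k → Term k → Term k
  sum         : Term k → Term (suc k) → Term k

infixl 8 _⊞_ _⊟_
infixl 9 _⊠_

Σ< : ℕ → (ℕ → ℕ) → ℕ
Σ< zero    f = 0
Σ< (suc n) f = f n + Σ< n f

bitℕ : Bool → ℕ
bitℕ b = if b then 1 else 0

eval : ∀ {k} → Term k → List Bool → Vec ℕ k → ℕ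
eval (ix i)    x ρ = lookup ρ i
eval (num c)   x ρ = c
eval len       x ρ = length x
eval (bitAt t) x ρ = bitℕ (nth false x (eval t x ρ))
eval (t ⊞ u)   x ρ = eval t x ρ + eval u x ρ
eval (t ⊠ u)   x ρ = eval t x ρ * eval u x ρ
eval (t ⊟ u)   x ρ = eval t x ρ ∸ eval u x ρ
eval (sum t u) x ρ = Σ< (eval t x ρ) (λ i → eval u x (i ∷ ρ))

_∘ₚ_ : Poly → Poly → Poly
var     ∘ₚ r = r
const c ∘ₚ r = const c
(p ⊕ q) ∘ₚ r = (p ∘ₚ r) ⊕ (q ∘ₚ r)
(p ⊗ q) ∘ₚ r = (p ∘ₚ r) ⊗ (q ∘ₚ r)

⟦∘ₚ⟧ : ∀ p r n → ⟦ p ∘ₚ r ⟧ n ≡ ⟦ p ⟧ (⟦ r ⟧ n)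
⟦∘ₚ⟧ var       r n = refl
⟦∘ₚ⟧ (const c) r n = refl
⟦∘ₚ⟧ (p ⊕ q)   r n = cong₂ _+_ (⟦∘ₚ⟧ p r n) (⟦∘ₚ⟧ q r n)
⟦∘ₚ⟧ (p ⊗ q)   r n = cong₂ _*_ (⟦∘ₚ⟧ p r n) (⟦∘ₚ⟧ q r n)

⟦⟧-mono : ∀ p {m n} → m ≤ n → ⟦ p ⟧ m ≤ ⟦ p ⟧ n
⟦⟧-mono var       m≤n = m≤n
⟦⟧-mono (const c) m≤n = ≤-refl
⟦⟧-mono (p ⊕ q)   m≤n = +-mono-≤ (⟦⟧-mono p m≤n) (⟦⟧-mono q m≤n)
⟦⟧-mono (p ⊗ q)   m≤n = *-mono-≤ (⟦⟧-mono p m≤n) (⟦⟧-mono q m≤n)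

-- The argument of the polynomial bounds the length of the word and all variables at once. Under
-- `sum` a new variable below `bound t` joins them, hence the substitution of `var ⊕ bound t`.
bound : ∀ {k} → Term k → Poly
bound (ix i)    = var
bound (num c)   = const c
bound len       = var
bound (bitAt t) = const 1
bound (t ⊞ u)   = bound t ⊕ bound u
bound (t ⊠ u)   = bound t ⊗ bound u
bound (t ⊟ u)   = bound t
bound (sum t u) = bound t ⊗ (bound u ∘ₚ (var ⊕ bound t))

Σ<-≤ : ∀ n f {c} → (∀ i → i < n → f i ≤ c) → Σ< n f ≤ n * c
Σ<-≤ zero    f h = z≤n
Σ<-≤ (suc n) f h = +-mono-≤ (h n ≤-refl) (Σ<-≤ n f λ i i<n → h i (m≤n⇒m≤1+n i<n))

bitℕ≤1 : ∀ b → bitℕ b ≤ 1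
bitℕ≤1 true  = ≤-refl
bitℕ≤1 false = z≤n

extend-≤ : ∀ {k} {ρ : Vec ℕ k} {B C i} → (∀ j → lookup ρ j ≤ B) → i < C →
  ∀ j → lookup (i ∷ ρ) j ≤ B + C
extend-≤ {B = B} h i< zero    = ≤-trans (<⇒≤ i<) (m≤n+m _ B)
extend-≤ {B = B} h i< (suc j) = ≤-trans (h j) (m≤m+n B _)

eval-≤ : ∀ {k} (t : Term k) x ρ {B} → (∀ i → lookup ρ i ≤ B) → length x ≤ B →
  eval t x ρ ≤ ⟦ bound t ⟧ B
eval-≤ (ix i)    x ρ h l = h i
eval-≤ (num c)   x ρ h l = ≤-refl
eval-≤ len       x ρ h l = l
eval-≤ (bitAt t) x ρ h l = bitℕ≤1 _
eval-≤ (t ⊞ u)   x ρ h l = +-mono-≤ (eval-≤ t x ρ h l) (eval-≤ u x ρ h l)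
eval-≤ (t ⊠ u)   x ρ h l = *-mono-≤ (eval-≤ t x ρ h l) (eval-≤ u x ρ h l)
eval-≤ (t ⊟ u)   x ρ h l = ≤-trans (m∸n≤m _ (eval u x ρ)) (eval-≤ t x ρ h l)
eval-≤ (sum t u) x ρ {B} h l = ≤-trans
  (Σ<-≤ (eval t x ρ) _ λ i i< → eval-≤ u x (i ∷ ρ)
    (extend-≤ h (<-≤-trans i< (eval-≤ t x ρ h l))) (≤-trans l (m≤m+n B _)))
  (*-mono-≤ (eval-≤ t x ρ h l) (≤-reflexive (sym (⟦∘ₚ⟧ (bound u) (var ⊕ bound t) B))))

need : ∀ {k} → Term k → ℕ
need (ix i)    = 1
need (num c)   = 0
need len       = 1
need (bitAt t) = 2 + need t
need (t ⊞ u)   = need t + need u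
need (t ⊠ u)   = suc (need t + need u)
need (t ⊟ u)   = 2 + (need t + need u)
need (sum t u) = suc (need t + need u)

-- A test and a `dec` take one step each, an `inc` takes two. A round of the first loop of `copy`
-- thus costs 6 and a round of the second 4, and each loop ends with one failing test.
copyTime : Poly
copyTime = ((var ⊗ const 6) ⊕ const 1) ⊕ ((var ⊗ const 4) ⊕ const 1)

time : ∀ {k} → Term k → Poly
time (ix i)    = copyTime
time (num c)   = const (c * 2 + 1)
time len       = copyTime
time (bitAt t) = time t ⊕ (((bound t ⊗ const 5) ⊕ const 1) ⊕ (const 3 ⊕ ((bound t ⊗ const 3) ⊕ const 1)))
time (t ⊞ u)   = time t ⊕ time u
time (t ⊠ u)   = time t ⊕ ((bound t ⊗ (const 2 ⊕ time u)) ⊕ const 1)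
time (t ⊟ u)   = time t ⊕ (time u ⊕ (((bound u ⊗ const 4) ⊕ const 1) ⊕ ((bound t ⊗ const 4) ⊕ const 1)))
time (sum t u) = time t ⊕ ((bound t ⊗ (const 2 ⊕ (time u ∘ₚ (var ⊕ bound t)))) ⊕ const 1)

module _ {K : ℕ} where

  skip : Cmd (3 + K)
  skip = prim idle

  -- Adds counter v to counter r, using the empty counter b.
  copy : ℕ → ℕ → ℕ → Cmd (3 + K)
  copy v b r = while (positive v) (dec v ⨟ inc b ⨟ inc r) ⨟ while (positive b) (dec b ⨟ inc v)

  incs : ℕ → ℕ → Cmd (3 + K)
  incs r zero    = skip
  incs r (suc c) = inc r ⨟ incs r c

  -- Adds the value of the term to counter r; the counters from b on are empty before and after.
  compile : ∀ {k} → Term k → Vec ℕ k → ℕ → ℕ → Cmd (3 + K)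
  compile (ix i)    env r b = copy (lookup env i) b r
  compile (num c)   env r b = incs r c
  compile len       env r b = copy 0 b r
  compile (bitAt t) env r b =
    compile t env b (suc b) ⨟
    -- The address moves from counter b to counter `suc b` while the head advances, so the way back
    -- is still known once the bit has been read.
    while (positive b) (dec b ⨟ inc (suc b) ⨟ advance) ⨟
    cond scanned (inc r) skip ⨟
    while (positive (suc b)) (dec (suc b) ⨟ retreat)
  compile (t ⊞ u)   env r b = compile t env r b ⨟ compile u env r b
  compile (t ⊠ u)   env r b =
    compile t env b (suc b) ⨟ while (positive b) (dec b ⨟ compile u env r (suc b))
  compile (t ⊟ u)   env r b =
    compile t env b (suc b) ⨟ compile u env (suc b) (2 + b) ⨟
    -- Skipping when counter b is already empty makes the subtraction truncated.
    while (positive (suc b)) (dec (suc b) ⨟ cond (positive b) (dec b) skip) ⨟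
    while (positive b) (dec b ⨟ inc r)
  compile (sum t u) env r b =
    -- The loop counter doubles as the bound variable. Since `dec` comes first, it takes the values
    -- from one below the bound down to 0.
    compile t env b (suc b) ⨟ while (positive b) (dec b ⨟ compile u (b ∷ env) r (suc b))

-- Correctness and running time of compiled terms

opaque
  unfolding update

  set-absorb₂ : ∀ {p q a b a′ b′ s} → set p a (set q b (set p a′ (set q b′ s))) ≈ set p a (set q b s)
  set-absorb₂ {p} {q} {a} {b} {a′} {b′} {s} = same refl refl go
    where
    go : ∀ i → cnt (set p a (set q b (set p a′ (set q b′ s)))) i ≡ cnt (set p a (set q b s)) i
    go i with i ≡ᵇ p | i ≡ᵇ q
    ... | true  | _     = refl
    ... | false | true  = refl
    ... | false | false = refl

  set-absorb₃ : ∀ {p q r a b c a′ b′ c′ s} →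
    set p a (set q b (set r c (set p a′ (set q b′ (set r c′ s))))) ≈ set p a (set q b (set r c s))
  set-absorb₃ {p} {q} {r} {a} {b} {c} {a′} {b′} {c′} {s} = same refl refl go
    where
    go : ∀ i → cnt (set p a (set q b (set r c (set p a′ (set q b′ (set r c′ s)))))) i
             ≡ cnt (set p a (set q b (set r c s))) i
    go i with i ≡ᵇ p | i ≡ᵇ q | i ≡ᵇ r
    ... | true  | _     | _     = refl
    ... | false | true  | _     = refl
    ... | false | false | true  = refl
    ... | false | false | false = refl

≡⇒≈ : ∀ {s t} → s ≡ t → s ≈ t
≡⇒≈ refl = ≈-refl

at : ℕ → Store → Store
at p s = store (out s) p (cnt s)

-- Results are added to counter r. It must not be counter 0, which holds the length of the word, nor
-- a counter that holds a variable.
record Fits {k} (env : Vec ℕ k) (r b : ℕ) : Set where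
  constructor fits
  field
    r<b   : r < b
    r≢0   : r ≢ 0
    env<b : ∀ i → lookup env i < b
    env≢r : ∀ i → lookup env i ≢ r

fits-next : ∀ {k} {env : Vec ℕ k} {r b} → Fits env r b → Fits env b (suc b)
fits-next (fits r< r≢ e< e≢) = fits ≤-refl (λ where refl → case r< of λ ())
  (λ i → m≤n⇒m≤1+n (e< i)) (λ i → <⇒≢ (e< i))

fits-suc : ∀ {k} {env : Vec ℕ k} {r b} → Fits env r b → Fits env r (suc b)
fits-suc (fits r< r≢ e< e≢) = fits (m≤n⇒m≤1+n r<) r≢ (λ i → m≤n⇒m≤1+n (e< i)) e≢

fits-bind : ∀ {k} {env : Vec ℕ k} {r b} → Fits env r b → Fits (b ∷ env) r (suc b)
fits-bind (fits r< r≢ e< e≢) = fits (m≤n⇒m≤1+n r<) r≢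
  (λ { zero → ≤-refl ; (suc i) → m≤n⇒m≤1+n (e< i) })
  (λ { zero → <⇒≢ r< ∘ sym ; (suc i) → e≢ i })

map-update : ∀ {k} (env : Vec ℕ k) {f r v} → (∀ i → lookup env i ≢ r) →
  Vec.map (update f r v) env ≡ Vec.map f env
map-update []        h = refl
map-update (e ∷ env) h = cong₂ _∷_ (update-other (h zero)) (map-update env (h ∘ suc))

-- The accumulator after a loop whose index runs downwards. This is the order in which `Σ<` adds its
-- terms and in which `emit` builds a word.
iter : ∀ {A : Set} → (ℕ → A → A) → ℕ → A → A
iter g zero    a = a
iter g (suc m) a = iter g m (g m a)

iter-Σ< : ∀ f n a → iter (λ m c → c + f m) n a ≡ a + Σ< n f
iter-Σ< f zero    a = sym (+-identityʳ a)
iter-Σ< f (suc n) a = trans (iter-Σ< f n (a + f n)) (+-assoc a (f n) (Σ< n f))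

iter-suc : ∀ n a → iter (λ _ → suc) n a ≡ n + a
iter-suc zero    a = refl
iter-suc (suc n) a = trans (iter-suc n (suc a)) (+-suc n a)

iter-pred : ∀ n a → iter (λ _ → pred) n a ≡ a ∸ n
iter-pred zero    a = refl
iter-pred (suc n) zero    = trans (iter-pred n 0) (0∸n≡0 n)
iter-pred (suc n) (suc a) = iter-pred n a

Σ<-const : ∀ n c → Σ< n (λ _ → c) ≡ n * c
Σ<-const zero    c = refl
Σ<-const (suc n) c = cong (c +_) (Σ<-const n c)

module Compiling (K : ℕ) (x : List Bool) where
  open Running K x

  record Ready (b : ℕ) (s : Store) : Set where
    constructor ready
    field
      pos≡0 : pos s ≡ 0
      len≡  : cnt s 0 ≡ length x
      fresh : ∀ i → b ≤ i → cnt s i ≡ 0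

  ready-≤ : ∀ {b b′ s} → b ≤ b′ → Ready b s → Ready b′ s
  ready-≤ b≤ (ready p l f) = ready p l λ i b′≤ → f i (≤-trans b≤ b′≤)

  ready-set : ∀ {b r v s} → r < b → r ≢ 0 → Ready b s → Ready b (set r v s)
  ready-set {s = s} r<b r≢0 (ready p l f) = ready p
    (trans (update-other (r≢0 ∘ sym)) l)
    λ i b≤i → trans (update-other (<⇒≢ (<-≤-trans r<b b≤i) ∘ sym)) (f i b≤i)

  run-skip : ∀ s → Run skip s 1 s
  run-skip s = runs λ ts R → ts , 1 , ≤-refl , subst (Exec skip ts 1) (apply-idle ts) exec-prim , R

  -- The rule for every loop controlled by a counter: `S m a` is the store with m rounds to go and
  -- accumulator a. In a round, `suc T` pays for the test and the body; the final 1 pays for the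
  -- failing test.
  countdown : ∀ {A : Set} {b body T} → b ≤ K → (S : ℕ → A → Store) (g : ℕ → A → A) →
    (∀ m a → cnt (S m a) b ≡ m) → ∀ M → (∀ m a → m < M → Run body (S (suc m) a) T (S m (g m a))) →
    ∀ a → Run (while (positive b) body) (S M a) (M * suc T + 1) (S 0 (iter g M a))
  countdown b≤ S g c zero    h a = run-stop (tests-positive (S 0 a) b≤ (c 0 a))
  countdown {T = T} b≤ S g c (suc M) h a = run-≤ (≤-reflexive (cong suc (sym (+-assoc T (M * suc T) 1))))
    (run-loop (tests-positive (S (suc M) a) b≤ (c (suc M) a)) (h M a ≤-refl)
      (countdown b≤ S g c M (λ m a m< → h m a (m≤n⇒m≤1+n m<)) (g M a)))

  run-incs : ∀ {r} c s → r ≤ K → Run (incs r c) s (c * 2 + 1) (set r (cnt s r + c) s)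
  run-incs {r} zero s r≤ = run-≈ ≈-refl (run-skip s) (≈-sym (set-id (sym (+-identityʳ _))))
  run-incs {r} (suc c) s r≤ = run-≈ ≈-refl (run-seq (run-inc s r≤ refl) (run-incs c _ r≤))
    (≈-trans set-set (same refl refl λ i → cong (λ v → cnt (set r v s) i)
      (trans (cong (_+ c) (update-same)) (sym (+-suc (cnt s r) c)))))

  -- The second half of copy: counter b, which holds the old value of v, is moved back.
  run-restore : ∀ {v b} s → v ≤ K → b ≤ K → v ≢ b → cnt s b ≡ 0 → ∀ V → cnt s v ≡ V →
    Run (while (positive b) (dec b ⨟ inc v)) (set v 0 (set b V s)) (V * 4 + 1) s
  run-restore {v} {b} s v≤ b≤ v≢b b0 V vV = run-≈ ≈-refl
    (countdown b≤ (λ m a → set v a (set b m s)) (λ _ → suc)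
      (λ m a → trans (update-other (v≢b ∘ sym)) (update-same)) V
      (λ m a _ → run-≈ ≈-refl
        (run-seq (run-dec _ b≤ (trans (update-other (v≢b ∘ sym)) (update-same)))
                 (run-inc _ v≤ (trans (update-other v≢b) (update-same))))
        set-absorb₂) 0)
    (≈-trans (set-cong (set-id b0)) (set-id (trans vV (sym (trans (iter-suc V 0) (+-identityʳ V))))))

  run-copy : ∀ {v b r} s → v ≤ K → b ≤ K → r ≤ K → v ≢ b → r ≢ b → v ≢ r → cnt s b ≡ 0 →
    ∀ V → cnt s v ≡ V → Run (copy v b r) s (⟦ copyTime ⟧ V) (set r (cnt s r + V) s)
  run-copy {v} {b} {r} s v≤ b≤ r≤ v≢b r≢b v≢r b0 V vV = run-≈
    (≈-sym (≈-trans (set-id (trans (update-other r≢b) (trans (update-other (v≢r ∘ sym)) (sym (+-identityʳ _)))))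
      (≈-trans (set-id (trans (update-other (v≢b ∘ sym)) b0)) (set-id vV))))
    (run-seq
      (countdown v≤ S (λ _ → suc) lookup-v V
        (λ m a _ → run-≈ ≈-refl
          (run-seq (run-dec _ v≤ (lookup-v (suc m) a))
          (run-seq (run-inc _ b≤ (trans (update-other (v≢b ∘ sym)) (trans (update-other (r≢b ∘ sym)) (update-same))))
                   (run-inc _ r≤ (trans (update-other r≢b) (trans (update-other (v≢r ∘ sym)) (update-same))))))
          (≈-trans set-absorb₃ (≡⇒≈ (cong (λ w → set r w (set b (suc a) (set v m s))) (sym (+-suc (cnt s r) a))))))
        0)
      (run-≈ shape (run-restore s₁ v≤ b≤ v≢b (trans (update-other (r≢b ∘ sym)) b0) V
        (trans (update-other v≢r) vV)) ≈-refl))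
    ≈-refl
    where
    S : ℕ → ℕ → Store
    S m a = set r (cnt s r + a) (set b a (set v m s))
    s₁ = set r (cnt s r + V) s
    lookup-v : ∀ m a → cnt (S m a) v ≡ m
    lookup-v m a = trans (update-other v≢r) (trans (update-other v≢b) (update-same))
    shape : S 0 (iter (λ _ → suc) V 0) ≈ set v 0 (set b V s₁)
    shape rewrite trans (iter-suc V 0) (+-identityʳ V) =
      ≈-trans (set-comm r≢b) (≈-trans (set-cong (set-comm (v≢r ∘ sym))) (set-comm (v≢b ∘ sym)))

  -- Products, sums and the final move of a truncated difference are all loops of this kind, with f
  -- constant in the first and last case.
  sum-loop : ∀ {b r s c T f} M → b ≤ K → r ≢ b → cnt s b ≡ 0 →
    (∀ m a → m < M → Run c (set r a (set b m s)) T (set r (a + f m) (set r a (set b m s)))) →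
    Run (while (positive b) (dec b ⨟ c)) (set b M s) (M * (2 + T) + 1) (set r (cnt s r + Σ< M f) s)
  sum-loop {b} {r} {s} {f = f} M b≤ r≢b b0 h = run-≈
    (≈-sym (set-id (update-other r≢b)))
    (countdown b≤ S (λ m a → a + f m) (λ m a → trans (update-other (r≢b ∘ sym)) update-same) M
      (λ m a m< → run-≈ ≈-refl
        (run-seq (run-dec _ b≤ (trans (update-other (r≢b ∘ sym)) update-same))
          (run-≈ (≈-trans (set-comm (r≢b ∘ sym)) (set-cong set-set)) (h m a m<) ≈-refl))
        set-set)
      (cnt s r))
    (≈-trans (≡⇒≈ (cong (S 0) (iter-Σ< f M (cnt s r)))) (set-cong (set-id b0)))
    where
    S : ℕ → ℕ → Store
    S m a = set r a (set b m s)

  -- A blank is as unmarked as a 0, in agreement with the default `false` beyond the end of the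
  -- word.
  isMark-cell : ∀ y i → isMark {K} (nth blank (List.map bit y) i) ≡ nth false y i
  isMark-cell []      i       = refl
  isMark-cell (b ∷ y) zero    = refl
  isMark-cell (b ∷ y) (suc i) = isMark-cell y i

  run-bitAt : ∀ {b r s} M → r < b → suc b ≤ K → Ready b s →
    Run (while (positive b) (dec b ⨟ inc (suc b) ⨟ advance) ⨟
         cond scanned (inc r) skip ⨟
         while (positive (suc b)) (dec (suc b) ⨟ retreat))
        (set b M s) ((M * 5 + 1) + (3 + (M * 3 + 1))) (set r (cnt s r + bitℕ (nth false x M)) s)
  run-bitAt {b} {r} {s} M r<b sb≤ (ready p l f) = run-seq
    (run-≈ (≈-trans (≈-sym (set-id (trans (update-other (<⇒≢ ≤-refl ∘ sym)) (f (suc b) (n≤1+n b))))) (same refl p λ _ → refl))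
      (countdown b≤ S₁ (λ _ → suc) (λ m a → trans (update-other (<⇒≢ ≤-refl)) update-same) M
        (λ m a _ → run-≈ ≈-refl
          (run-seq (run-dec _ b≤ (trans (update-other (<⇒≢ ≤-refl)) update-same))
          (run-seq (run-inc _ sb≤ (trans (update-other (<⇒≢ ≤-refl ∘ sym)) update-same))
                   (run-advance _)))
          (set-absorb₂)) 0)
      (≡⇒≈ (cong (S₁ 0) (trans (iter-suc M 0) (+-identityʳ M)))))
    (run-seq look
      (run-≈ ((set-comm (<⇒≢ (m≤n⇒m≤1+n r<b))))
        (countdown sb≤ S₂ (λ _ a → a) (λ _ _ → update-same) M
          (λ m a _ → run-≈ ≈-refl
            (run-seq (run-dec _ sb≤ update-same) (run-retreat _ refl))
            (set-set)) tt)
        (≈-trans ((≈-trans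
            (set-id (trans (update-other (<⇒≢ (m≤n⇒m≤1+n r<b) ∘ sym)) (trans (update-other (<⇒≢ ≤-refl ∘ sym)) (f _ (n≤1+n b)))))
            (set-cong (set-id (f b ≤-refl)))))
          (same refl (sym p) λ _ → refl))))
    where
    b≤ = ≤-trans (n≤1+n b) sb≤
    bb = nth false x M
    v = cnt s r + bitℕ bb
    S₁ : ℕ → ℕ → Store
    S₁ m a = at a (set (suc b) a (set b m s))
    S₂ : ℕ → ⊤ → Store
    S₂ m _ = at m (set (suc b) m (set r v (set b 0 s)))
    r-kept : cnt (S₁ 0 M) r ≡ cnt s r
    r-kept = trans (update-other (<⇒≢ (m≤n⇒m≤1+n r<b))) (update-other (<⇒≢ r<b))
    look : Run (cond scanned (inc r) skip) (S₁ 0 M) 3 (set r v (S₁ 0 M))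
    look with nth false x M in eq
    ... | true  = run-true (tests-scanned (S₁ 0 M) (trans (isMark-cell x M) eq))
          (run-≈ ≈-refl (run-inc _ (≤-trans (<⇒≤ r<b) b≤) r-kept)
            (≡⇒≈ (cong (λ w → set r w (S₁ 0 M)) (sym (+-comm (cnt s r) 1)))))
    ... | false = run-≤ (s≤s (s≤s z≤n)) (run-false (tests-scanned (S₁ 0 M) (trans (isMark-cell x M) eq))
          (run-≈ ≈-refl (run-skip _) (≈-sym (set-id (trans r-kept (sym (+-identityʳ _)))))))

  run-monus : ∀ {b r s} M U → r < b → suc b ≤ K → Ready b s →
    Run (while (positive (suc b)) (dec (suc b) ⨟ cond (positive b) (dec b) skip) ⨟
         while (positive b) (dec b ⨟ inc r))
        (set (suc b) U (set b M s)) ((U * 4 + 1) + (M * 4 + 1)) (set r (cnt s r + (M ∸ U)) s)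
  run-monus {b} {r} {s} M U r<b sb≤ (ready p l f) = run-seq
    (countdown sb≤ S (λ _ → pred) (λ _ _ → update-same) U
      (λ m a _ → run-seq (run-dec _ sb≤ update-same) (run-≈ set-set (body m a) ≈-refl)) M)
    (run-≈ (≈-trans (≡⇒≈ (cong (S 0) (iter-pred U M)))
             (set-id (trans (update-other (<⇒≢ ≤-refl ∘ sym)) (f (suc b) (n≤1+n b)))))
      (run-≤ (+-monoˡ-≤ 1 (*-monoˡ-≤ 4 (m∸n≤m M U)))
        (sum-loop {f = λ _ → 1} (M ∸ U) b≤ (<⇒≢ r<b) (f b ≤-refl)
          λ m a _ → run-≈ ≈-refl (run-inc _ (≤-trans (<⇒≤ r<b) b≤) update-same)
            (≡⇒≈ (cong (λ w → set r w (set r a (set b m s))) (sym (+-comm a 1))))))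
      (≡⇒≈ (cong (λ w → set r (cnt s r + w) s) (trans (Σ<-const (M ∸ U) 1) (*-identityʳ (M ∸ U))))))
    where
    b≤ = ≤-trans (n≤1+n b) sb≤
    S : ℕ → ℕ → Store
    S m a = set (suc b) m (set b a s)
    at-b : ∀ m a → cnt (S m a) b ≡ a
    at-b m a = trans (update-other (<⇒≢ ≤-refl)) update-same
    body : ∀ m a → Run (cond (positive b) (dec b) skip) (S m a) 2 (S m (pred a))
    body m zero    = run-false (tests-positive _ b≤ (at-b m 0)) (run-skip _)
    body m (suc a) = run-true (tests-positive _ b≤ (at-b m (suc a)))
      (run-≈ ≈-refl (run-dec _ b≤ (at-b m (suc a)))
        (≈-trans (set-comm (<⇒≢ ≤-refl)) (set-cong set-set)))

  -- The recursion composes because the final store differs from the initial one in counter r alone: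
  -- all scratch counters are empty again, so `Ready` holds for the next subterm. The vector ρ holds
  -- the values of the counters in `env`.
  compile-runs : ∀ {k} (t : Term k) {env r b s ρ B} → Fits env r b → Ready b s → b + need t ≤ K →
    Vec.map (cnt s) env ≡ ρ → (∀ i → lookup ρ i ≤ B) → length x ≤ B →
    Run (compile t env r b) s (⟦ time t ⟧ B) (set r (cnt s r + eval t x ρ) s)
  compile-runs (ix i) {env} {r} {b} {s} {ρ} (fits r< r≢ e< e≢) rd room refl h l =
    run-≤ (⟦⟧-mono copyTime (h i))
      (run-copy s (≤-trans (<⇒≤ (e< i)) b≤) b≤ (≤-trans (<⇒≤ r<) b≤) (<⇒≢ (e< i)) (<⇒≢ r<) (e≢ i)
        (Ready.fresh rd b ≤-refl) (lookup ρ i) (sym (Vec.lookup-map i (cnt s) env)))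
    where b≤ = ≤-trans (m≤m+n b 1) room
  compile-runs (num c) {b = b} F rd room eq h l = run-incs c _ (≤-trans (<⇒≤ (Fits.r<b F)) (≤-trans (m≤m+n b 0) room))
  compile-runs len {r = r} {b} {s} (fits r< r≢ e< e≢) rd room eq h l =
    run-≤ (⟦⟧-mono copyTime l)
      (run-copy s z≤n b≤ (≤-trans (<⇒≤ r<) b≤) (λ { refl → case r< of λ () }) (<⇒≢ r<) (r≢ ∘ sym)
        (Ready.fresh rd b ≤-refl) (length x) (Ready.len≡ rd))
    where b≤ = ≤-trans (m≤m+n b 1) room
  compile-runs (bitAt t) {b = b} {s} {ρ} {B} F rd room eq h l =
    run-seq (compile-runs t (fits-next F) (ready-≤ (n≤1+n b) rd) room′ eq h l)
      (run-≈ (≡⇒≈ (cong (λ w → set b (w + eval t x ρ) s) (Ready.fresh rd b ≤-refl)))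
        (run-≤ (+-mono-≤ (+-monoˡ-≤ 1 (*-monoˡ-≤ 5 M≤)) (+-monoʳ-≤ 3 (+-monoˡ-≤ 1 (*-monoˡ-≤ 3 M≤))))
          (run-bitAt (eval t x ρ) (Fits.r<b F) (≤-trans (m≤m+n (suc b) _) room′) rd))
        ≈-refl)
    where
    M≤ = eval-≤ t x ρ h l
    room′ : suc b + need t ≤ K
    room′ = ≤-trans (n≤1+n _) (≤-trans (≤-reflexive (sym (trans (+-suc b _) (cong suc (+-suc b (need t)))))) room)
  compile-runs (t ⊞ u) {env} {r} {b} {s} {ρ} F rd room refl h l =
    run-≈ ≈-refl
      (run-seq (compile-runs t F rd (≤-trans (+-monoʳ-≤ b (m≤m+n (need t) _)) room) refl h l)
        (compile-runs u F (ready-set (Fits.r<b F) (Fits.r≢0 F) rd) (≤-trans (+-monoʳ-≤ b (m≤n+m _ (need t))) room)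
          (map-update env (Fits.env≢r F)) h l))
      (≈-trans set-set (≡⇒≈ (cong (λ w → set r w s) (trans (cong (_+ eval u x ρ) update-same)
        (+-assoc (cnt s r) (eval t x ρ) (eval u x ρ))))))
  compile-runs (t ⊠ u) {env} {r} {b} {s} {ρ} {B} F@(fits r< r≢ e< e≢) rd room refl h l =
    run-seq (compile-runs t (fits-next F) (ready-≤ (n≤1+n b) rd) (≤-trans (s≤s (+-monoʳ-≤ b (m≤m+n (need t) _))) room′) refl h l)
      (run-≈ (≡⇒≈ (cong (λ w → set b (w + M) s) (Ready.fresh rd b ≤-refl)))
        (run-≤ (+-monoˡ-≤ 1 (*-monoˡ-≤ (2 + ⟦ time u ⟧ B) (eval-≤ t x ρ h l)))
          (sum-loop {f = λ _ → eval u x ρ} M b≤ (<⇒≢ r<) (Ready.fresh rd b ≤-refl) λ m a _ →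
            run-≈ ≈-refl
              (compile-runs u (fits-suc F) (ready-set (m≤n⇒m≤1+n r<) r≢ (ready-set ≤-refl b≢0 (ready-≤ (n≤1+n b) rd)))
                (≤-trans (s≤s (+-monoʳ-≤ b (m≤n+m _ (need t)))) room′)
                (trans (map-update env e≢) (map-update env (<⇒≢ ∘ e<))) h l)
              (≡⇒≈ (cong (λ w → set r (w + eval u x ρ) (set r a (set b m s))) update-same))))
        (≡⇒≈ (cong (λ w → set r (cnt s r + w) s) (Σ<-const M (eval u x ρ)))))
    where
    M = eval t x ρ
    b≤ = ≤-trans (m≤m+n b _) room
    b≢0 : b ≢ 0
    b≢0 refl = case r< of λ ()
    room′ : suc b + (need t + need u) ≤ K
    room′ = subst (_≤ K) (+-suc b _) room
  compile-runs (t ⊟ u) {env} {r} {b} {s} {ρ} {B} F rd room refl h l =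
    run-seq (compile-runs t (fits-next F) (ready-≤ (n≤1+n b) rd)
              (≤-trans (s≤s (≤-trans (+-monoʳ-≤ b (m≤m+n (need t) _)) (n≤1+n _))) room′) refl h l)
    (run-≈ (≡⇒≈ (cong (λ w → set b (w + M) s) (Ready.fresh rd b ≤-refl)))
      (run-seq (compile-runs u (fits-next (fits-next F)) (ready-set (n≤1+n (suc b)) b≢0 (ready-≤ (≤-trans (n≤1+n b) (n≤1+n _)) rd))
                 (≤-trans (s≤s (s≤s (+-monoʳ-≤ b (m≤n+m _ (need t))))) room′)
                 (map-update env (<⇒≢ ∘ Fits.env<b F)) h l)
        (run-≈ (≡⇒≈ (cong (λ w → set (suc b) (w + U) (set b M s)) (trans (update-other (<⇒≢ ≤-refl ∘ sym)) (Ready.fresh rd (suc b) (n≤1+n b)))))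
          (run-≤ (+-mono-≤ (+-monoˡ-≤ 1 (*-monoˡ-≤ 4 (eval-≤ u x ρ h l))) (+-monoˡ-≤ 1 (*-monoˡ-≤ 4 (eval-≤ t x ρ h l))))
            (run-monus M U (Fits.r<b F) (≤-trans (s≤s (≤-trans (m≤m+n b _) (n≤1+n _))) room′) rd))
          ≈-refl))
      ≈-refl)
    where
    M = eval t x ρ
    U = eval u x ρ
    b≢0 : b ≢ 0
    b≢0 refl = case Fits.r<b F of λ ()
    room′ : suc (suc (b + (need t + need u))) ≤ K
    room′ = subst (_≤ K) (trans (+-suc b _) (cong suc (+-suc b _))) room
  compile-runs (sum t u) {env} {r} {b} {s} {ρ} {B} F@(fits r< r≢ e< e≢) rd room refl h l =
    run-seq (compile-runs t (fits-next F) (ready-≤ (n≤1+n b) rd) (≤-trans (s≤s (+-monoʳ-≤ b (m≤m+n (need t) _))) room′) refl h l)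
      (run-≈ (≡⇒≈ (cong (λ w → set b (w + M) s) (Ready.fresh rd b ≤-refl)))
        (run-≤ (+-monoˡ-≤ 1 (*-mono-≤ (eval-≤ t x ρ h l) (+-monoʳ-≤ 2 (≤-reflexive (sym (⟦∘ₚ⟧ (time u) (var ⊕ bound t) B))))))
          (sum-loop {f = λ i → eval u x (i ∷ ρ)} M b≤ (<⇒≢ r<) (Ready.fresh rd b ≤-refl) λ m a m< →
            run-≈ ≈-refl
              (compile-runs u (fits-bind F) (ready-set (m≤n⇒m≤1+n r<) r≢ (ready-set ≤-refl b≢0 (ready-≤ (n≤1+n b) rd)))
                (≤-trans (s≤s (+-monoʳ-≤ b (m≤n+m _ (need t)))) room′)
                (cong₂ _∷_ (trans (update-other (<⇒≢ r< ∘ sym)) update-same)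
                  (trans (map-update env e≢) (map-update env (<⇒≢ ∘ e<))))
                (extend-≤ h (<-≤-trans m< (eval-≤ t x ρ h l))) (≤-trans l (m≤m+n B _)))
              (≡⇒≈ (cong (λ w → set r (w + eval u x (m ∷ ρ)) (set r a (set b m s))) update-same))))
        ≈-refl)
    where
    M = eval t x ρ
    b≤ = ≤-trans (m≤m+n b _) room
    b≢0 : b ≢ 0
    b≢0 refl = case r< of λ ()
    room′ : suc b + (need t + need u) ≤ K
    room′ = subst (_≤ K) (+-suc b _) room

-- Formulas of bounded arithmetic

infix  7 _≐_ _≼_
infixr 6 _∧′_
infixr 5 _∨′_

data Form (k : ℕ) : Set where
  _≐_ _≼_   : Term k → Term k → Form k
  _∧′_ _∨′_ : Form k → Form k → Form k
  ¬′_       : Form k → Form k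
  ∃< ∀<     : Term k → Form (suc k) → Form k

Holds : ∀ {k} → Form k → List Bool → Vec ℕ k → Set
Holds (t ≐ u)  x ρ = eval t x ρ ≡ eval u x ρ
Holds (t ≼ u)  x ρ = eval t x ρ ≤ eval u x ρ
Holds (φ ∧′ ψ) x ρ = Holds φ x ρ × Holds ψ x ρ
Holds (φ ∨′ ψ) x ρ = Holds φ x ρ ⊎ Holds ψ x ρ
Holds (¬′ φ)   x ρ = ¬ Holds φ x ρ
Holds (∃< t φ) x ρ = ∃[ i ] i < eval t x ρ × Holds φ x (i ∷ ρ)
Holds (∀< t φ) x ρ = ∀ i → i < eval t x ρ → Holds φ x (i ∷ ρ)

-- Truth values are the numbers 0 and 1. Subtraction from 1 is negation, and applied twice it cuts a
-- positive number down to 1. Two numbers are equal when both truncated differences vanish.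
toTerm : ∀ {k} → Form k → Term k
toTerm (t ≐ u)  = num 1 ⊟ ((t ⊟ u) ⊞ (u ⊟ t))
toTerm (t ≼ u)  = num 1 ⊟ (t ⊟ u)
toTerm (φ ∧′ ψ) = toTerm φ ⊠ toTerm ψ
toTerm (φ ∨′ ψ) = num 1 ⊟ ((num 1 ⊟ toTerm φ) ⊠ (num 1 ⊟ toTerm ψ))
toTerm (¬′ φ)   = num 1 ⊟ toTerm φ
toTerm (∃< t φ) = num 1 ⊟ (num 1 ⊟ sum t (toTerm φ))
toTerm (∀< t φ) = num 1 ⊟ sum t (num 1 ⊟ toTerm φ)

Indicates : Set → ℕ → Set
Indicates P v = (P × v ≡ 1) ⊎ (¬ P × v ≡ 0)

indicates-∃ : ∀ (P : ℕ → Set) (f : ℕ → ℕ) → (∀ i → Indicates (P i) (f i)) → ∀ n →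
  Indicates (∃[ i ] i < n × P i) (1 ∸ (1 ∸ Σ< n f))
indicates-∃ P f h zero = inj₂ ((λ ()) , refl)
indicates-∃ P f h (suc n) with h n
... | inj₁ (p , eq) rewrite eq | 0∸n≡0 (Σ< n f) = inj₁ ((n , ≤-refl , p) , refl)
... | inj₂ (¬p , eq) rewrite eq with indicates-∃ P f h n
...   | inj₁ ((i , i<n , p) , eq′) = inj₁ ((i , m≤n⇒m≤1+n i<n , p) , eq′)
...   | inj₂ (¬q , eq′) = inj₂ ((λ (i , i≤n , p) → case m≤n⇒m<n∨m≡n (s≤s⁻¹ i≤n) of λ where
          (inj₁ i<n)  → ¬q (i , i<n , p)
          (inj₂ refl) → ¬p p) , eq′)

indicates-∀ : ∀ (P : ℕ → Set) (f : ℕ → ℕ) → (∀ i → Indicates (P i) (f i)) → ∀ n →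
  Indicates (∀ i → i < n → P i) (1 ∸ Σ< n (λ i → 1 ∸ f i))
indicates-∀ P f h zero = inj₁ ((λ _ ()) , refl)
indicates-∀ P f h (suc n) with h n
... | inj₂ (¬p , eq) rewrite eq | 0∸n≡0 (Σ< n (λ i → 1 ∸ f i)) = inj₂ ((λ q → ¬p (q n ≤-refl)) , refl)
... | inj₁ (p , eq) rewrite eq with indicates-∀ P f h n
...   | inj₂ (¬q , eq′) = inj₂ ((λ q → ¬q λ i i<n → q i (m≤n⇒m≤1+n i<n)) , eq′)
...   | inj₁ (q , eq′) = inj₁ ((λ i i≤n → case m≤n⇒m<n∨m≡n (s≤s⁻¹ i≤n) of λ where
          (inj₁ i<n)  → q i i<n
          (inj₂ refl) → p) , eq′)

indicates-toTerm : ∀ {k} (φ : Form k) x ρ → Indicates (Holds φ x ρ) (eval (toTerm φ) x ρ)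
indicates-toTerm (t ≐ u) x ρ with <-cmp (eval t x ρ) (eval u x ρ)
... | tri≈ _ eq _ rewrite eq | n∸n≡0 (eval u x ρ) = inj₁ (refl , refl)
... | tri< lt ne _ rewrite m≤n⇒m∸n≡0 (<⇒≤ lt) with eval u x ρ ∸ eval t x ρ | m<n⇒0<n∸m lt
...   | suc d | _ rewrite 0∸n≡0 d = inj₂ (ne , refl)
indicates-toTerm (t ≐ u) x ρ | tri> _ ne lt with eval t x ρ ∸ eval u x ρ | m<n⇒0<n∸m lt
...   | suc d | _ rewrite 0∸n≡0 (d + (eval u x ρ ∸ eval t x ρ)) = inj₂ (ne , refl)
indicates-toTerm (t ≼ u) x ρ with ≤-<-connex (eval t x ρ) (eval u x ρ)
... | inj₁ le rewrite m≤n⇒m∸n≡0 le = inj₁ (le , refl)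
... | inj₂ lt with eval t x ρ ∸ eval u x ρ | m<n⇒0<n∸m lt
...   | suc d | _ rewrite 0∸n≡0 d = inj₂ (<⇒≱ lt , refl)
indicates-toTerm (φ ∧′ ψ) x ρ with indicates-toTerm φ x ρ | indicates-toTerm ψ x ρ
... | inj₁ (p , eq)  | inj₁ (q , eq′)  rewrite eq | eq′ = inj₁ ((p , q) , refl)
... | inj₁ (p , eq)  | inj₂ (¬q , eq′) rewrite eq | eq′ = inj₂ (¬q ∘ proj₂ , refl)
... | inj₂ (¬p , eq) | _               rewrite eq = inj₂ (¬p ∘ proj₁ , refl)
indicates-toTerm (φ ∨′ ψ) x ρ with indicates-toTerm φ x ρ | indicates-toTerm ψ x ρ
... | inj₁ (p , eq)  | _               rewrite eq = inj₁ (inj₁ p , refl)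
... | inj₂ (¬p , eq) | inj₁ (q , eq′)  rewrite eq | eq′ = inj₁ (inj₂ q , refl)
... | inj₂ (¬p , eq) | inj₂ (¬q , eq′) rewrite eq | eq′ = inj₂ ([ ¬p , ¬q ]′ , refl)
indicates-toTerm (¬′ φ) x ρ with indicates-toTerm φ x ρ
... | inj₁ (p , eq)  rewrite eq = inj₂ ((λ ¬p → ¬p p) , refl)
... | inj₂ (¬p , eq) rewrite eq = inj₁ (¬p , refl)
indicates-toTerm (∃< t φ) x ρ =
  indicates-∃ _ _ (λ i → indicates-toTerm φ x (i ∷ ρ)) (eval t x ρ)
indicates-toTerm (∀< t φ) x ρ =
  indicates-∀ _ _ (λ i → indicates-toTerm φ x (i ∷ ρ)) (eval t x ρ)

holds? : ∀ {k} (φ : Form k) x ρ → Dec (Holds φ x ρ)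
holds? φ x ρ = [ yes ∘ proj₁ , no ∘ proj₁ ]′ (indicates-toTerm φ x ρ)

decide : ∀ {k} → Form k → List Bool → Vec ℕ k → Bool
decide φ x ρ = does (holds? φ x ρ)

decide⇒ : ∀ {k} (φ : Form k) x ρ → decide φ x ρ ≡ true → Holds φ x ρ
decide⇒ φ x ρ eq with holds? φ x ρ
... | yes p = p

decide⇐ : ∀ {k} (φ : Form k) x ρ → Holds φ x ρ → decide φ x ρ ≡ true
decide⇐ φ x ρ = dec-true (holds? φ x ρ)

eval-toTerm : ∀ {k} (φ : Form k) x ρ → eval (toTerm φ) x ρ ≡ bitℕ (decide φ x ρ)
eval-toTerm φ x ρ with indicates-toTerm φ x ρ
... | inj₁ (_ , eq) = eq
... | inj₂ (_ , eq) = eq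

-- Machines that tabulate a formula

isBit : Symbol 0 → Bool
isBit (bit _) = true
isBit _       = false

module _ {K : ℕ} where

  transfer : Vec (Symbol 0) (3 + K) → Fin (3 + K) → Symbol 0 × Move
  transfer h zero             = lookup h zero , right
  transfer h (suc zero)       = lookup h zero , right
  transfer h (suc (suc zero)) = mark , right
  transfer h (suc (suc (suc f))) = idle h (suc (suc (suc f)))

  -- One pass copies the word to tape 1 and counts its length in unary on tape 2, which becomes
  -- counter 0. The first move leaves a blank at the bottom of that counter. During the pass its
  -- head is one cell beyond the last mark, and the last move corrects this.
  input : Cmd (3 + K)
  input =
    only (suc (suc zero)) (λ _ → blank , right) ⨟
    while (λ h → isBit (lookup h zero)) (prim transfer) ⨟
    only (suc (suc zero)) (λ h → lookup h (suc (suc zero)) , left)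

  -- The length is spent on bringing the input head back to position 0. Counter 1 saves it
  -- meanwhile, and the second loop restores it.
  rewind : Cmd (3 + K)
  rewind = while (positive 0) (dec 0 ⨟ inc 1 ⨟ retreat) ⨟ while (positive 1) (dec 1 ⨟ inc 0)

  tabulating : Term 0 → Term 1 → Cmd (3 + K)
  tabulating N φ = compile N [] 1 2 ⨟
    while (positive 1)
      (dec 1 ⨟ compile φ (1 ∷ []) 2 3 ⨟ cond (positive 2) (dec 2 ⨟ emit true) (emit false))

  -- The output grows leftwards over the old input, starting at the blank behind it. The last move
  -- puts the head on its first bit, where `unload` begins to read.
  program : Term 0 → Term 1 → Cmd (3 + K)
  program N φ = input ⨟ (rewind ⨟ tabulating N φ) ⨟ only zero (λ h → lookup h zero , right)

Loaded : List Bool → Tape 0 → Set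
Loaded []       t = Tape.head t ≡ blank × Tape.after t ≡ []
Loaded (b ∷ bs) t = Tape.head t ≡ bit b × Tape.after t ≡ List.map bit bs

loaded-load : ∀ x → Loaded x (load x)
loaded-load []      = refl , refl
loaded-load (b ∷ x) = refl , refl

unload-right : ∀ t y → Tape.after t ≡ List.map bit y → unload (act (Tape.head t , right) t) ≡ y
unload-right (tape ls h _) []      refl = refl
unload-right (tape ls h _) (b ∷ y) refl = cong (b ∷_) (go y)
  where
  go : ∀ y → leadingBits {0} (List.map bit y) ≡ y
  go []      = refl
  go (b ∷ y) = cong (b ∷_) (go y)

iter-∷ : ∀ (b : ℕ → Bool) n a → iter (λ m → b m ∷_) n a ≡ List.applyUpTo b n ++ a
iter-∷ b zero    a = refl
iter-∷ b (suc n) a = trans (iter-∷ b n (b n ∷ a))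
  (trans (sym (List.++-assoc (List.applyUpTo b n) (b n ∷ []) a)) (cong (_++ a) (List.applyUpTo-∷ʳ b n)))

totalTime : Term 0 → Term 1 → Poly
totalTime N φ = (const 1 ⊕ (((var ⊗ const 2) ⊕ const 1) ⊕ const 1)) ⊕
  (((((var ⊗ const 5) ⊕ const 1) ⊕ ((var ⊗ const 4) ⊕ const 1)) ⊕
    (time N ⊕ ((bound N ⊗ (const 2 ⊕ ((time φ ∘ₚ (var ⊕ bound N)) ⊕ const 3))) ⊕ const 1))) ⊕
   const 1)

module Tabulating (N : Term 0) (φ : Form 1) (x : List Bool) where

  -- Counters 0, 1 and 2 hold the length, the index and the value of the formula; the scratch
  -- counters for φ start at 3.
  K = 3 + (need N + need (toTerm φ))
  open Running K x
  open Compiling K x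

  n M : ℕ
  n = length x
  M = eval N x []

  answer : ℕ → Bool
  answer i = decide φ x (i ∷ [])

  zeros : Store
  zeros = store [] 0 (λ _ → 0)

  record Transferring (rest : List Bool) (p : ℕ) (ts : Vec (Tape 0) (3 + K)) : Set where
    constructor atInput
    field
      source : Loaded rest (lookup ts zero)
      behind : Behind x p (Tape.before (lookup ts (suc zero)))
      target : Tape.head (lookup ts (suc zero)) ≡ blank × Tape.after (lookup ts (suc zero)) ≡ []
      count  : Tape.before (lookup ts (suc (suc zero))) ≡ List.replicate p mark ++ blank ∷ []
      others : ∀ f → Counts 0 (lookup ts (suc (suc (suc f))))
      unread : ∀ i → cell x (p + i) ≡ cell rest i
      total  : p + length rest ≡ n

  run-transferring : ∀ rest p ts → Transferring rest p ts →
    ∃[ ts′ ] Exec (while (λ h → isBit (lookup h zero)) (prim transfer)) ts (length rest * 2 + 1) ts′ ×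
      Transferring [] n ts′
  run-transferring [] p ts t@(atInput (eq , _) _ _ _ _ _ tot) =
    ts , exec-stop (cong isBit (trans (Vec.lookup-map zero Tape.head ts) eq)) ,
    subst (λ p → Transferring [] p ts) (trans (sym (+-identityʳ p)) tot) t
  run-transferring (b ∷ bs) p ts t@(atInput (hd , af) bh (hd₁ , af₁) cn ot un tot) =
    let ts″ , ex , t″ = run-transferring bs (suc p) ts′ t′ in
    ts″ , exec-loop (cong isBit scan) exec-prim ex , t″
    where
    scan : lookup (heads ts) zero ≡ bit b
    scan = trans (Vec.lookup-map zero Tape.head ts) hd
    ts′ = apply transfer ts
    here′ : ∀ f → lookup ts′ f ≡ act (transfer (heads ts) f) (lookup ts f)
    here′ = lookup-apply transfer ts
    source′ : ∀ cs t s → Tape.after t ≡ List.map bit cs → Loaded cs (act (s , right) t)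
    source′ []      (tape ls h _) s refl = refl , refl
    source′ (_ ∷ _) (tape ls h _) s refl = refl , refl
    fresh-right : ∀ t s → Tape.after t ≡ [] → act (s , right) t ≡ tape (s ∷ Tape.before t) blank []
    fresh-right (tape ls h .[]) s refl = refl
    before-right : ∀ (t : Tape 0) s → Tape.before (act (s , right) t) ≡ s ∷ Tape.before t
    before-right (tape ls h [])      s = refl
    before-right (tape ls h (_ ∷ _)) s = refl
    tape₁ : lookup ts′ (suc zero) ≡ tape (cell x p ∷ Tape.before (lookup ts (suc zero))) blank []
    tape₁ = trans (here′ (suc zero)) (trans (fresh-right (lookup ts (suc zero)) _ af₁)
      (cong (λ s → tape (s ∷ _) blank []) (trans scan (trans (sym (un 0)) (cong (cell x) (+-identityʳ p))))))
    t′ : Transferring bs (suc p) ts′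
    t′ = atInput
      (subst (Loaded bs) (sym (here′ zero)) (source′ bs (lookup ts zero) _ af))
      (subst (Behind x (suc p) ∘ Tape.before) (sym tape₁) (there bh))
      (cong Tape.head tape₁ , cong Tape.after tape₁)
      (trans (cong Tape.before (here′ (suc (suc zero)))) (trans (before-right (lookup ts (suc (suc zero))) mark) (cong (mark ∷_) cn)))
      (λ f → subst (Counts 0) (sym (trans (here′ (suc (suc (suc f))))
         (cong (λ s → write s (lookup ts (suc (suc (suc f))))) (Vec.lookup-map (suc (suc (suc f))) Tape.head ts)))) (ot f))
      (λ i → trans (cong (cell x) (sym (+-suc p i))) (un (suc i)))
      (trans (sym (+-suc p (length bs))) tot)

  start : Vec (Tape 0) (3 + K)
  start = load x ∷ Vec.replicate (2 + K) (load [])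

  s₀ : Store
  s₀ = set 0 n zeros

  run-input : ∃[ ts ] Exec input start (1 + ((n * 2 + 1) + 1)) ts
    × Rep (at n s₀) ts
  run-input =
    let ts₁ , ex₁ , h₁ , o₁ = exec-only (suc (suc zero)) (λ _ → blank , right) start
        ts₂ , ex₂ , atInput (_ , a) bh (hd , af) cn ot un _ = run-transferring x 0 ts₁ (atInput
          (subst (Loaded x) (sym (o₁ zero λ ())) (loaded-load x)) here
          (cong Tape.head (o₁ (suc zero) λ ()) , cong Tape.after (o₁ (suc zero) λ ()))
          (cong Tape.before h₁)
          (λ f → subst (Counts 0) (sym (trans (o₁ (suc (suc (suc f))) λ ()) (Vec.lookup-replicate f (load [])))) refl)
          (λ _ → refl) refl)
        ts₃ , ex₃ , h₃ , o₃ = exec-only (suc (suc zero)) (λ h → lookup h (suc (suc zero)) , left) ts₂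
    in ts₃ , exec-seq ex₁ (exec-seq ex₂ ex₃) , rep
      (trans (cong Tape.after (o₃ zero λ ())) a)
      (subst (InputAt x n) (sym (o₃ (suc zero) λ ())) (inputAt bh
        (trans hd (sym (trans (cong (cell x) (sym (+-identityʳ n))) (un 0))))
        (λ i → trans (cong (λ ss → nth blank ss i) af)
          (sym (trans (cong (cell x) (sym (+-suc n i))) (un (suc i)))))))
      λ where
        zero    _  → subst₂ Counts (sym update-same) (sym h₃) (pulled (lookup ts₂ (suc (suc zero))) _ n cn)
        (suc j) j≤ → subst₂ Counts (sym (update-other λ ())) (sym (o₃ (suc (suc (suc (clamp _ j)))) λ ())) (ot (clamp _ j))
    where
    pulled : ∀ t s m → Tape.before t ≡ List.replicate m mark ++ blank ∷ [] → Counts m (act (s , left) t)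
    pulled (tape _ h rs) s zero    refl = refl
    pulled (tape _ h rs) s (suc m) refl = refl

  run-rewind : Run rewind (at n s₀) ((n * 5 + 1) + (n * 4 + 1)) s₀
  run-rewind = run-seq
    (run-≈ (≈-sym (set-id (update-other λ ())))
      (countdown {b = 0} z≤n S (λ _ → suc) (λ m a → trans (update-other λ ()) update-same) n
        (λ m a _ → run-≈ ≈-refl
          (run-seq (run-dec _ z≤n (trans (update-other λ ()) update-same))
          (run-seq (run-inc _ (s≤s z≤n) (trans (update-other λ ()) update-same))
                   (run-retreat _ refl)))
          set-absorb₂) 0)
      (≡⇒≈ (cong (S 0) (trans (iter-suc n 0) (+-identityʳ n)))))
    (run-≈ (≈-trans (set-cong (≈-sym set-set)) (set-comm λ ()))
      (run-restore s₀ z≤n (s≤s z≤n) (λ ()) (update-other λ ()) n update-same) ≈-refl)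
    where
    S : ℕ → ℕ → Store
    S m a = at m (set 1 a (set 0 m zeros))

  ready₀ : Ready 1 s₀
  ready₀ = ready refl update-same λ { (suc i) _ → update-other λ () }

  run-tabulating : Run (tabulating N (toTerm φ)) s₀
    (⟦ time N ⟧ n + (⟦ bound N ⟧ n * (2 + (⟦ time (toTerm φ) ⟧ (n + ⟦ bound N ⟧ n) + 3)) + 1))
    (store (List.applyUpTo answer M) 0 (cnt s₀))
  run-tabulating = run-seq
    (compile-runs N {env = []} (fits (s≤s (s≤s z≤n)) (λ ()) (λ ()) λ ()) (ready-≤ (s≤s z≤n) ready₀)
      (s≤s (s≤s (≤-trans (m≤m+n (need N) _) (n≤1+n _)))) refl (λ ()) ≤-refl)
    (run-≈ (≡⇒≈ (cong (λ w → set 1 (w + M) s₀) (update-other λ ())))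
      (run-≤ (+-monoˡ-≤ 1 (*-monoˡ-≤ (2 + (T + 3)) M≤))
        (countdown (s≤s z≤n) S (λ m → answer m ∷_) (λ _ _ → update-same) M body []))
      (≈-trans (≡⇒≈ (cong (S 0) (trans (iter-∷ answer M []) (List.++-identityʳ _))))
        (same refl refl (cnt≈ (set-id {1} {0} {s₀} (update-other λ ()))))))
    where
    T = ⟦ time (toTerm φ) ⟧ (n + ⟦ bound N ⟧ n)
    M≤ = eval-≤ N x [] {n} (λ ()) ≤-refl
    S : ℕ → List Bool → Store
    S m a = store a 0 (cnt (set 1 m s₀))
    respond : ∀ m a → Run (cond (positive 2) (dec 2 ⨟ emit true) (emit false))
      (set 2 (bitℕ (answer m)) (S m a)) 3 (S m (answer m ∷ a))
    respond m a with answer m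
    ... | true = run-true (tests-positive _ (s≤s (s≤s z≤n)) update-same)
      (run-≈ ≈-refl (run-seq (run-dec _ (s≤s (s≤s z≤n)) update-same) (run-emit true _))
        (≈-trans set-set (set-id (trans (update-other λ ()) (update-other λ ())))))
    ... | false = run-≤ (s≤s (s≤s z≤n)) (run-false (tests-positive _ (s≤s (s≤s z≤n)) update-same)
      (run-≈ ≈-refl (run-emit false _) (set-id (trans (update-other λ ()) (update-other λ ())))))
    body : ∀ m a → m < M → Run _ (S (suc m) a) (1 + (T + 3)) (S m (answer m ∷ a))
    body m a m< = run-seq (run-dec _ (s≤s z≤n) update-same)
      (run-≈ set-set
        (run-seq
          (compile-runs (toTerm φ) {ρ = m ∷ []}
            (fits (s≤s (s≤s (s≤s z≤n))) (λ ()) (λ { zero → s≤s (s≤s z≤n) }) (λ { zero () }))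
            (ready-set (s≤s (s≤s z≤n)) (λ ()) (ready refl update-same λ { (suc i) _ → update-other λ () }))
            (s≤s (s≤s (s≤s (m≤n+m _ (need N)))))
            (cong (_∷ []) update-same)
            (extend-≤ {ρ = []} (λ ()) (<-≤-trans m< M≤)) (m≤m+n n _))
          (run-≈ (≡⇒≈ (cong (λ w → set 2 w (S m a))
              (cong₂ _+_ (trans (update-other λ ()) (update-other λ ())) (eval-toTerm φ x (m ∷ [])))))
            (respond m a) ≈-refl))
        ≈-refl)

  run-program : ∃[ ts ] ∃[ m ] m ≤ ⟦ totalTime N (toTerm φ) ⟧ n ×
    Exec (program N (toTerm φ)) start m ts × unload (Vec.head ts) ≡ List.applyUpTo answer M
  run-program =
    let ts₁ , e₁ , R₁ = run-input
        ts₂ , m , m≤ , e₂ , R₂ = exec (run-seq run-rewind run-tabulating) ts₁ R₁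
        ts₃ , e₃ , h₃ , _ = exec-only zero (λ h → lookup h zero , right) ts₂
    in ts₃ , (1 + ((n * 2 + 1) + 1)) + (m + 1) ,
      +-monoʳ-≤ (1 + ((n * 2 + 1) + 1)) (+-monoˡ-≤ 1 (≤-trans m≤ time≤)) ,
      exec-seq e₁ (exec-seq e₂ e₃) ,
      trans (cong unload (trans (head≡ ts₃) (trans h₃
          (cong (λ s → act (s , right) (lookup ts₂ zero)) (Vec.lookup-map zero Tape.head ts₂)))))
        (unload-right (lookup ts₂ zero) _ (Rep.outOK R₂))
    where
    head≡ : ∀ {k} (ts : Vec (Tape 0) (suc k)) → Vec.head ts ≡ lookup ts zero
    head≡ (t ∷ _) = refl
    time≤ = +-monoʳ-≤ ((n * 5 + 1) + (n * 4 + 1)) (+-monoʳ-≤ (⟦ time N ⟧ n)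
      (+-monoˡ-≤ 1 (*-monoʳ-≤ (⟦ bound N ⟧ n) (+-monoʳ-≤ 2 (+-monoˡ-≤ 3
        (≤-reflexive (sym (⟦∘ₚ⟧ (time (toTerm φ)) (var ⊕ bound N) n))))))))

-- The source of every polynomial-time function below. The verifier is the case of a single bit, the
-- reduction that of a graph encoding.
tabulated-PolyTime : (N : Term 0) (φ : Form 1) →
  PolyTime (λ x → List.applyUpTo (λ i → decide φ x (i ∷ [])) (eval N x []))
tabulated-PolyTime N φ = machine (program N (toTerm φ)) , totalTime N (toTerm φ) ,
  computes (program N (toTerm φ)) ⟦ totalTime N (toTerm φ) ⟧ _ (Tabulating.run-program N φ)

-- Positions in lists and in concatenated rows

module _ {A : Set} {d : A} where

  nth-++ˡ : ∀ xs {ys i} → i < length xs → nth d (xs ++ ys) i ≡ nth d xs i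
  nth-++ˡ (x ∷ xs) {i = zero}  _       = refl
  nth-++ˡ (x ∷ xs) {i = suc i} (s≤s p) = nth-++ˡ xs p

  nth-++ʳ : ∀ xs {ys} i → nth d (xs ++ ys) (length xs + i) ≡ nth d ys i
  nth-++ʳ []       i = refl
  nth-++ʳ (x ∷ xs) i = nth-++ʳ xs i

  nth-replicate : ∀ n {a i} → i < n → nth d (List.replicate n a) i ≡ a
  nth-replicate (suc n) {i = zero}  _       = refl
  nth-replicate (suc n) {i = suc i} (s≤s p) = nth-replicate n p

  nth-beyond : ∀ xs {i} → length xs ≤ i → nth d xs i ≡ d
  nth-beyond []       _       = refl
  nth-beyond (x ∷ xs) (s≤s p) = nth-beyond xs p

  nth-applyUpTo : ∀ (f : ℕ → A) n {i} → i < n → nth d (List.applyUpTo f n) i ≡ f i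
  nth-applyUpTo f (suc n) {zero}  _       = refl
  nth-applyUpTo f (suc n) {suc i} (s≤s p) = nth-applyUpTo (f ∘ suc) n p

  nth-tabulate : ∀ {n} (f : Fin n → A) v → nth d (List.tabulate f) (toℕ v) ≡ f v
  nth-tabulate f zero    = refl
  nth-tabulate f (suc v) = nth-tabulate (f ∘ suc) v

  nth-extensional : ∀ xs ys → length xs ≡ length ys →
    (∀ i → i < length xs → nth d xs i ≡ nth d ys i) → xs ≡ ys
  nth-extensional []       []       _  _ = refl
  nth-extensional (x ∷ xs) (y ∷ ys) eq h =
    cong₂ _∷_ (h 0 (s≤s z≤n)) (nth-extensional xs ys (suc-injective eq) λ i i< → h (suc i) (s≤s i<))

  module _ {B : Set} {N : ℕ} (f : B → List A) (len : ∀ b → length (f b) ≡ N) where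

    length-rows : ∀ {m} (g : Fin m → B) → length (concatMap f (List.tabulate g)) ≡ m * N
    length-rows {zero}  g = refl
    length-rows {suc m} g = trans (List.length-++ (f (g zero))) (cong₂ _+_ (len (g zero)) (length-rows (g ∘ suc)))

    nth-rows : ∀ {m} (g : Fin m → B) u j → j < N →
      nth d (concatMap f (List.tabulate g)) (toℕ u * N + j) ≡ nth d (f (g u)) j
    nth-rows {suc m} g zero    j j< = nth-++ˡ (f (g zero)) (≤-trans j< (≤-reflexive (sym (len (g zero)))))
    nth-rows {suc m} g (suc u) j j< = trans
      (cong (nth d (concatMap f (List.tabulate g)))
        (trans (cong (λ l → l + toℕ u * N + j) (sym (len (g zero)))) (+-assoc (length (f (g zero))) _ j)))
      (trans (nth-++ʳ (f (g zero)) _) (nth-rows (g ∘ suc) u j j<))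

-- Graphs as words

-- An encoding described by its length and its bits, which is the only access that formulas have to
-- a word.
record Word (N : ℕ) (w : List Bool) (a : Fin N → Fin N → Bool) : Set where
  constructor word
  field
    length≡ : length w ≡ N + suc (N * N)
    ones    : ∀ i → i < N → nth false w i ≡ true
    stop    : nth false w N ≡ false
    entries : ∀ u v → nth false w (N + suc (toℕ u * N + toℕ v)) ≡ a u v

encode-word : ∀ G → Word (Graph.order G) (encode G) (Graph.adj G)
encode-word G = word
  (trans (List.length-++ ones′) (cong₂ _+_ len₁ (cong suc (length-rows {d = false} row len-row id))))
  (λ i i< → trans (nth-++ˡ ones′ (≤-trans i< (≤-reflexive (sym len₁)))) (nth-replicate order i<))
  (trans (cong (nth false (encode G)) (trans (sym (+-identityʳ order)) (cong (_+ 0) (sym len₁)))) (nth-++ʳ ones′ 0))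
  λ u v → trans (cong (λ l → nth false (encode G) (l + suc (toℕ u * order + toℕ v))) (sym len₁)) (trans (nth-++ʳ ones′ (suc (toℕ u * order + toℕ v)))
    (trans (nth-rows row len-row id u (toℕ v) (Fin.toℕ<n v))
    (trans (cong (λ l → nth false l (toℕ v)) (List.map-tabulate id (adj u))) (nth-tabulate (adj u) v))))
  where
  open Graph G
  ones′ = List.replicate order true
  len₁ = List.length-replicate order
  row = λ u → List.map (adj u) (List.allFin order)
  len-row : ∀ u → length (row u) ≡ order
  len-row u = trans (List.length-map (adj u) (List.allFin order)) (List.length-tabulate id)

word-unique : ∀ {N w w′ a a′} → Word N w a → Word N w′ a′ → (∀ u v → a u v ≡ a′ u v) → w ≡ w′
word-unique {N} {w} {w′} (word l o s e) (word l′ o′ s′ e′) agree = nth-extensional w w′ (trans l (sym l′)) go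
  where
  go : ∀ i → i < length w → nth false w i ≡ nth false w′ i
  go i i< with <-cmp i N
  ... | tri< i<N _ _ = trans (o i i<N) (sym (o′ i i<N))
  ... | tri≈ _ refl _ = trans s (sym s′)
  ... | tri> _ _ N<i = subst (λ k → nth false w k ≡ nth false w′ k) position
        (trans (e u v) (trans (agree u v) (sym (e′ u v))))
    where
    k<NN : i ∸ suc N < N * N
    k<NN = +-cancelˡ-< (suc N) _ _ (subst₂ _<_ (sym (m+[n∸m]≡n N<i)) (trans l (+-suc N (N * N))) i<)
    k = fromℕ< k<NN
    u = proj₁ (Fin.remQuot {N} N k)
    v = proj₂ (Fin.remQuot {N} N k)
    position : N + suc (toℕ u * N + toℕ v) ≡ i
    position = trans (+-suc N _) (trans (cong (suc N +_)
      (trans (cong (_+ toℕ v) (*-comm (toℕ u) N)) (trans (sym (Fin.toℕ-combine u v))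
        (trans (cong toℕ (Fin.combine-remQuot {N} N k)) (Fin.toℕ-fromℕ< k<NN)))))
      (m+[n∸m]≡n N<i))

-- Matchings and domination

Meets : ∀ {V : Set} → V → V → V → V → Set
Meets a b c d = a ≡ c ⊎ a ≡ d ⊎ b ≡ c ⊎ b ≡ d

-- The pairs are ordered, and `disjoint` together with `proper` also forbids a pair along with its
-- reversal. Restricting the carrier by `In` lets one notion serve vertices, numbers below a bound
-- and the elements of a set family.
record Matching {V : Set} (In : V → Set) (P : V → V → Set) : Set where
  constructor matching
  field
    proper   : ∀ {a b} → In a → In b → P a b → a ≢ b
    disjoint : ∀ {a b c d} → In a → In b → In c → In d → P a b → P c d → Meets a b c d → a ≡ c × b ≡ d

Near : ∀ {V : Set} → (V → V → Set) → V → V → Set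
Near A w a = w ≡ a ⊎ A a w

Dominates : ∀ {V : Set} → (V → Set) → (A P : V → V → Set) → V → Set
Dominates In A P w = ∃[ a ] ∃[ b ] In a × In b × P a b × Near A w a × Near A w b

flatten : ∀ {V : Set} → List (V × V) → List V
flatten = concatMap (λ (u , v) → u ∷ v ∷ [])

module _ {V : Set} where

  ∈-flatten : ∀ {a b : V} {ps} → (a , b) ∈ ps → a ∈ flatten ps × b ∈ flatten ps
  ∈-flatten (here refl) = here refl , there (here refl)
  ∈-flatten (there p)   = let q , r = ∈-flatten p in there (there q) , there (there r)

  flatten-∈ : ∀ {x : V} ps → x ∈ flatten ps → ∃[ a ] ∃[ b ] (a , b) ∈ ps × (x ≡ a ⊎ x ≡ b)
  flatten-∈ (_ ∷ ps) (here eq)          = _ , _ , here refl , inj₁ eq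
  flatten-∈ (_ ∷ ps) (there (here eq))  = _ , _ , here refl , inj₂ eq
  flatten-∈ (_ ∷ ps) (there (there p))  = let a , b , q , r = flatten-∈ ps p in a , b , there q , r

  unique-matching : ∀ (ps : List (V × V)) → Unique (flatten ps) → Matching (λ _ → ⊤) (λ a b → (a , b) ∈ ps)
  unique-matching [] _ = matching (λ _ _ ()) λ _ _ _ _ ()
  unique-matching ((u , v) ∷ ps) ((u≢v ∷ u≢) ∷ (v≢ ∷ un)) = matching
    (λ { _ _ (here refl) → u≢v ; _ _ (there p) → proper tt tt p })
    λ { _ _ _ _ (here refl) (here refl) _ → refl , refl
      ; _ _ _ _ (here refl) (there q)   m → ⊥-elim (apart q m)
      ; _ _ _ _ (there p)   (here refl) m → ⊥-elim (apart p (swap m))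
      ; _ _ _ _ (there p)   (there q)   m → disjoint tt tt tt tt p q m }
    where
    open Matching (unique-matching ps un)
    apart : ∀ {c d} → (c , d) ∈ ps → Meets u v c d → ⊥
    apart q (inj₁ refl)               = All.lookup u≢ (proj₁ (∈-flatten q)) refl
    apart q (inj₂ (inj₁ refl))        = All.lookup u≢ (proj₂ (∈-flatten q)) refl
    apart q (inj₂ (inj₂ (inj₁ refl))) = All.lookup v≢ (proj₁ (∈-flatten q)) refl
    apart q (inj₂ (inj₂ (inj₂ refl))) = All.lookup v≢ (proj₂ (∈-flatten q)) refl
    swap : ∀ {a b c d : V} → Meets a b c d → Meets c d a b
    swap (inj₁ e)               = inj₁ (sym e)
    swap (inj₂ (inj₁ e))        = inj₂ (inj₂ (inj₁ (sym e)))
    swap (inj₂ (inj₂ (inj₁ e))) = inj₂ (inj₁ (sym e))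
    swap (inj₂ (inj₂ (inj₂ e))) = inj₂ (inj₂ (inj₂ (sym e)))

  -- A relation cannot tell whether a pair is listed twice, hence the separate hypothesis
  -- `Unique ps`.
  matching-unique : ∀ (ps : List (V × V)) → Unique ps → Matching (λ _ → ⊤) (λ a b → (a , b) ∈ ps) →
    Unique (flatten ps)
  matching-unique [] _ _ = []
  matching-unique ((u , v) ∷ ps) (new ∷ un) (matching pr dj) =
    (pr tt tt (here refl) ∷ All.tabulate (λ q eq → apart q (inj₁ eq))) ∷
    All.tabulate (λ q eq → apart q (inj₂ eq)) ∷
    matching-unique ps un (matching (λ _ _ p → pr tt tt (there p)) λ _ _ _ _ p q → dj tt tt tt tt (there p) (there q))
    where
    apart : ∀ {x} → x ∈ flatten ps → u ≡ x ⊎ v ≡ x → ⊥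
    apart p e with flatten-∈ ps p
    ... | a , b , q , r with dj tt tt tt tt (here refl) (there q) (meet e r)
      where
      meet : ∀ {x} → u ≡ x ⊎ v ≡ x → x ≡ a ⊎ x ≡ b → Meets u v a b
      meet (inj₁ refl) (inj₁ e) = inj₁ e
      meet (inj₁ refl) (inj₂ e) = inj₂ (inj₁ e)
      meet (inj₂ refl) (inj₁ e) = inj₂ (inj₂ (inj₁ e))
      meet (inj₂ refl) (inj₂ e) = inj₂ (inj₂ (inj₂ e))
    ...   | refl , refl = All.lookup new q refl

module _ (G : Graph) where
  open Graph G

  ∈N⇒ : ∀ {w u} → w Subset.∈ N[ G ] u → Near (λ a b → adj a b ≡ true) w u
  ∈N⇒ {w} {u} w∈ with Subset.x∈p∪q⁻ Subset.⁅ u ⁆ (Vec.tabulate (adj u)) w∈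
  ... | inj₁ p = inj₁ (Subset.x∈⁅y⁆⇒x≡y u p)
  ... | inj₂ p = inj₂ (trans (sym (Vec.lookup∘tabulate (adj u) w)) (Vec.[]=⇒lookup p))

  ∈N⇐ : ∀ {w u} → Near (λ a b → adj a b ≡ true) w u → w Subset.∈ N[ G ] u
  ∈N⇐ {w}     (inj₁ refl) = Subset.x∈p∪q⁺ (inj₁ (Subset.x∈⁅x⁆ w))
  ∈N⇐ {w} {u} (inj₂ e)    = Subset.x∈p∪q⁺ {p = Subset.⁅ u ⁆}
    (inj₂ (Vec.lookup⇒[]= w _ (trans (Vec.lookup∘tabulate (adj u) w) e)))

  ∈⋃⇒ : ∀ {A : Set} {n} {w : Fin n} (f : A → Subset.Subset n) ps → w Subset.∈ Subset.⋃ (List.map f ps) →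
    ∃[ p ] p ∈ ps × w Subset.∈ f p
  ∈⋃⇒ f []       w∈ = contradiction w∈ Subset.∉⊥
  ∈⋃⇒ f (p ∷ ps) w∈ with Subset.x∈p∪q⁻ (f p) (Subset.⋃ (List.map f ps)) w∈
  ... | inj₁ q = p , here refl , q
  ... | inj₂ q = let r , r∈ , w∈r = ∈⋃⇒ f ps q in r , there r∈ , w∈r

  ∈⋃⇐ : ∀ {A : Set} {n} {w : Fin n} (f : A → Subset.Subset n) {ps p} → p ∈ ps → w Subset.∈ f p →
    w Subset.∈ Subset.⋃ (List.map f ps)
  ∈⋃⇐ f (here refl)     w∈ = Subset.x∈p∪q⁺ (inj₁ w∈)
  ∈⋃⇐ f {p′ ∷ _} (there p∈) w∈ = Subset.x∈p∪q⁺ {p = f p′} (inj₂ (∈⋃⇐ f p∈ w∈))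

-- Words that encode graphs with a solution

Edge : ℕ → List Bool → ℕ → ℕ → Set
Edge N w i j = nth false w (N + suc (i * N + j)) ≡ true

record GraphWord (N : ℕ) (w : List Bool) : Set where
  constructor graphWord
  field
    length≡     : length w ≡ N + suc (N * N)
    ones        : ∀ i → i < N → nth false w i ≡ true
    stop        : nth false w N ≡ false
    symmetric   : ∀ i → i < N → ∀ j → j < N → Edge N w i j → Edge N w j i
    irreflexive : ∀ i → i < N → ¬ Edge N w i i

module _ {N : ℕ} where

  lower : ∀ {i} → i < N → Fin N
  lower i< = fromℕ< i<

  toℕ-lower : ∀ {i} (i< : i < N) → toℕ (lower i<) ≡ i
  toℕ-lower i< = Fin.toℕ-fromℕ< i<

-- Vertices become numbers and the list of pairs becomes a Boolean relation on them, ready to be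
-- written down as the matrix of a certificate.
pds⇒ : ∀ {w} → PairingDominatingSet w → ∃[ N ] GraphWord N w × ∃[ P ]
  Matching (_< N) (λ i j → P i j ≡ true) ×
  (∀ i → i < N → Dominates (_< N) (Edge N w) (λ i j → P i j ≡ true) i)
pds⇒ {w} (G , refl , ps , isPDS) = order ,
  graphWord length≡ ones stop
    (λ i i< j j< e → edge⇐ j< i< (trans (symmetric _ _) (edge⇒ i< j< e)))
    (λ i i< e → case trans (sym (edge⇒ i< i< e)) (irreflexive _) of λ ()) ,
  P , matching
    (λ _ _ p eq → let u , v , uv , i≡ , j≡ = P⇒ p in
      proper tt tt uv (Fin.toℕ-injective (trans (sym i≡) (trans eq j≡))))
    (λ _ _ _ _ p q m → let
        u , v , uv , i≡ , j≡ = P⇒ p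
        u′ , v′ , uv′ , i′≡ , j′≡ = P⇒ q
        u≡u′ , v≡v′ = disjoint tt tt tt tt uv uv′ (meets i≡ j≡ i′≡ j′≡ m)
      in trans i≡ (trans (cong toℕ u≡u′) (sym i′≡)) , trans j≡ (trans (cong toℕ v≡v′) (sym j′≡))) ,
  λ i i< → let
      (u , v) , uv , i∈ = ∈⋃⇒ G (λ (u , v) → N[ G ] u Subset.∩ N[ G ] v) ps
        (subst (lower i< Subset.∈_) (sym dominating) Subset.∈⊤)
      i∈u , i∈v = Subset.x∈p∩q⁻ (N[ G ] u) (N[ G ] v) i∈
    in toℕ u , toℕ v , Fin.toℕ<n u , Fin.toℕ<n v , P⇐ uv , near i< (∈N⇒ G i∈u) , near i< (∈N⇒ G i∈v)
  where
  open Graph G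
  open IsPairingDominatingSet isPDS
  open Word (encode-word G)
  open Matching (unique-matching ps distinct)
  open DecMembership (≡-dec _≟_ _≟_) using (_∈?_)
  psℕ = List.map (λ (u , v) → toℕ u , toℕ v) ps
  P : ℕ → ℕ → Bool
  P i j = does ((i , j) ∈? psℕ)
  P⇒ : ∀ {i j} → P i j ≡ true → ∃[ u ] ∃[ v ] (u , v) ∈ ps × i ≡ toℕ u × j ≡ toℕ v
  P⇒ {i} {j} p with (i , j) ∈? psℕ
  ... | yes ij with ∈.∈-map⁻ (λ (u , v) → toℕ u , toℕ v) ij
  ...   | (u , v) , uv , refl = u , v , uv , refl , refl
  P⇐ : ∀ {u v} → (u , v) ∈ ps → P (toℕ u) (toℕ v) ≡ true
  P⇐ {u} {v} uv = dec-true ((toℕ u , toℕ v) ∈? psℕ) (∈.∈-map⁺ _ uv)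
  meets : ∀ {u v u′ v′ : Fin order} {i j i′ j′} → i ≡ toℕ u → j ≡ toℕ v → i′ ≡ toℕ u′ → j′ ≡ toℕ v′ →
    Meets i j i′ j′ → Meets u v u′ v′
  meets refl refl refl refl (inj₁ e)               = inj₁ (Fin.toℕ-injective e)
  meets refl refl refl refl (inj₂ (inj₁ e))        = inj₂ (inj₁ (Fin.toℕ-injective e))
  meets refl refl refl refl (inj₂ (inj₂ (inj₁ e))) = inj₂ (inj₂ (inj₁ (Fin.toℕ-injective e)))
  meets refl refl refl refl (inj₂ (inj₂ (inj₂ e))) = inj₂ (inj₂ (inj₂ (Fin.toℕ-injective e)))
  entry′ : ∀ {i j} (i< : i < order) (j< : j < order) →
    nth false (encode G) (order + suc (i * order + j)) ≡ adj (lower i<) (lower j<)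
  entry′ i< j< = trans (cong₂ (λ i j → nth false (encode G) (order + suc (i * order + j)))
    (sym (toℕ-lower i<)) (sym (toℕ-lower j<))) (entries _ _)
  edge⇒ : ∀ {i j} (i< : i < order) (j< : j < order) → Edge order (encode G) i j → adj (lower i<) (lower j<) ≡ true
  edge⇒ i< j< e = trans (sym (entry′ i< j<)) e
  edge⇐ : ∀ {i j} (i< : i < order) (j< : j < order) → adj (lower i<) (lower j<) ≡ true → Edge order (encode G) i j
  edge⇐ i< j< e = trans (entry′ i< j<) e
  near : ∀ {i u} (i< : i < order) → Near (λ a b → adj a b ≡ true) (lower i<) u → Near (Edge order (encode G)) i (toℕ u)
  near i< (inj₁ eq) = inj₁ (trans (sym (toℕ-lower i<)) (cong toℕ eq))
  near {u = u} i< (inj₂ e) = inj₂ (trans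
    (cong (λ i → nth false (encode G) (order + suc (toℕ u * order + i))) (sym (toℕ-lower i<)))
    (trans (entries _ _) e))

-- The word itself supplies the adjacency matrix. Decidability of P allows the list of pairs to be
-- filtered out of all pairs, which also makes it free of repetitions.
pds⇐ : ∀ {N w P} → GraphWord N w → (∀ i j → Dec (P i j)) → Matching (_< N) P →
  (∀ i → i < N → Dominates (_< N) (Edge N w) P i) → PairingDominatingSet w
pds⇐ {N} {w} {P} (graphWord l o s sy irr) P? M dom =
  G , word-unique (encode-word G) (word l o s (λ _ _ → refl)) (λ _ _ → refl) , ps ,
  record { distinct = matching-unique ps unique (matching
             (λ _ _ p eq → Matching.proper M (Fin.toℕ<n _) (Fin.toℕ<n _) (ps⇒ p) (cong toℕ eq))
             (λ _ _ _ _ p q m → let a , b = Matching.disjoint M (Fin.toℕ<n _) (Fin.toℕ<n _) (Fin.toℕ<n _) (Fin.toℕ<n _)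
                                              (ps⇒ p) (ps⇒ q) (meets m)
                                in Fin.toℕ-injective a , Fin.toℕ-injective b))
         ; dominating = Subset.⊆-antisym (λ _ → Subset.∈⊤) (λ {x} _ → all x) }
  where
  adj : Fin N → Fin N → Bool
  adj u v = nth false w (N + suc (toℕ u * N + toℕ v))
  bool-ext : ∀ {a b : Bool} → (a ≡ true → b ≡ true) → (b ≡ true → a ≡ true) → a ≡ b
  bool-ext {true}  {b}     f g = sym (f refl)
  bool-ext {false} {true}  f g = g refl
  bool-ext {false} {false} f g = refl
  G : Graph
  G = record { order = N ; adj = adj
             ; symmetric = λ u v → bool-ext (sy _ (Fin.toℕ<n u) _ (Fin.toℕ<n v)) (sy _ (Fin.toℕ<n v) _ (Fin.toℕ<n u))
             ; irreflexive = λ v → Bool.¬-not (irr _ (Fin.toℕ<n v)) }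
  all-pairs = List.cartesianProduct (List.allFin N) (List.allFin N)
  P?′ : ∀ (p : Fin N × Fin N) → Dec (P (toℕ (proj₁ p)) (toℕ (proj₂ p)))
  P?′ (u , v) = P? (toℕ u) (toℕ v)
  ps = List.filter P?′ all-pairs
  unique : Unique ps
  unique = Unique.filter⁺ P?′ (Unique.cartesianProduct⁺ (Unique.allFin⁺ N) (Unique.allFin⁺ N))
  ps⇒ : ∀ {u v} → (u , v) ∈ ps → P (toℕ u) (toℕ v)
  ps⇒ p = proj₂ (∈.∈-filter⁻ P?′ {xs = all-pairs} p)
  ps⇐ : ∀ {u v} → P (toℕ u) (toℕ v) → (u , v) ∈ ps
  ps⇐ p = ∈.∈-filter⁺ P?′ (∈.∈-cartesianProduct⁺ (∈.∈-allFin _) (∈.∈-allFin _)) p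
  meets : ∀ {u v u′ v′ : Fin N} → Meets u v u′ v′ → Meets (toℕ u) (toℕ v) (toℕ u′) (toℕ v′)
  meets (inj₁ e)               = inj₁ (cong toℕ e)
  meets (inj₂ (inj₁ e))        = inj₂ (inj₁ (cong toℕ e))
  meets (inj₂ (inj₂ (inj₁ e))) = inj₂ (inj₂ (inj₁ (cong toℕ e)))
  meets (inj₂ (inj₂ (inj₂ e))) = inj₂ (inj₂ (inj₂ (cong toℕ e)))
  near : ∀ {x u} → Near (Edge N w) (toℕ x) (toℕ u) → Near (λ a b → adj a b ≡ true) x u
  near (inj₁ e) = inj₁ (Fin.toℕ-injective e)
  near (inj₂ e) = inj₂ e
  all : ∀ x → x Subset.∈ Subset.⋃ (List.map (λ (u , v) → N[ G ] u Subset.∩ N[ G ] v) ps)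
  all x with dom (toℕ x) (Fin.toℕ<n x)
  ... | a , b , a< , b< , p , na , nb =
    ∈⋃⇐ G (λ (u , v) → N[ G ] u Subset.∩ N[ G ] v) {p = lower a< , lower b<}
      (ps⇐ (subst₂ P (sym (toℕ-lower a<)) (sym (toℕ-lower b<)) p))
      (Subset.x∈p∩q⁺ ( ∈N⇐ G (near (subst (Near (Edge N w) (toℕ x)) (sym (toℕ-lower a<)) na))
                     , ∈N⇐ G (near (subst (Near (Edge N w) (toℕ x)) (sym (toℕ-lower b<)) nb))))

-- The verifier

nth-even : ∀ x u k → k < length x → nth false ⟨ x , u ⟩ (k + k) ≡ nth false x k
nth-even (b ∷ x) u zero    _        = refl
nth-even (b ∷ x) u (suc k) (s≤s k<) rewrite +-suc k k = nth-even x u k k<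

nth-odd : ∀ x u k → k < length x → nth false ⟨ x , u ⟩ (suc (k + k)) ≡ nth false x k
nth-odd (b ∷ x) u zero    _        = refl
nth-odd (b ∷ x) u (suc k) (s≤s k<) rewrite +-suc k k = nth-odd x u k k<

-- Stated under a map so as to serve the bits read by the verifier as well as the tape symbols of
-- the tableau.
nth-tail : ∀ {A : Set} {d : A} f x u m →
  nth d (List.map f ⟨ x , u ⟩) (length x + length x + m) ≡ nth d (List.map f (false ∷ true ∷ u)) m
nth-tail f []      u m = refl
nth-tail f (b ∷ x) u m rewrite +-suc (length x) (length x) = nth-tail f x u m

nth-certificate : ∀ x u m → nth false ⟨ x , u ⟩ (length x + length x + m) ≡ nth false (false ∷ true ∷ u) m
nth-certificate x u m = subst₂ (λ y z → nth false y (length x + length x + m) ≡ nth false z m)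
  (List.map-id ⟨ x , u ⟩) (cong (λ u → false ∷ true ∷ u) (List.map-id u)) (nth-tail id x u m)

length-pairing : ∀ x u → length ⟨ x , u ⟩ ≡ length x + length x + (2 + length u)
length-pairing []      u = refl
length-pairing (b ∷ x) u = cong suc (trans (cong suc (length-pairing x u))
  (cong (_+ (2 + length u)) (sym (+-suc (length x) (length x)))))

bitℕ-injective : ∀ {a b} → bitℕ a ≡ bitℕ b → a ≡ b
bitℕ-injective {true}  {true}  _ = refl
bitℕ-injective {false} {false} _ = refl

module _ {k : ℕ} where

  isOne : Term k → Form k
  isOne t = bitAt t ≐ num 1

  double wordLength : Term k → Term k
  double t = t ⊞ t
  wordLength N = N ⊞ (num 1 ⊞ N ⊠ N)

  -- Bit k of x is found at position 2k of `⟨ x , u ⟩`, and u begins after twice the length of x and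
  -- the two separator bits.
  edgeForm pairForm : Term k → Term k → Term k → Form k
  edgeForm N i j = isOne (double (N ⊞ (num 1 ⊞ (i ⊠ N ⊞ j))))
  pairForm N i j = isOne (double (wordLength N) ⊞ (num 2 ⊞ (i ⊠ N ⊞ j)))

  nearForm : Term k → Term k → Term k → Form k
  nearForm N w a = w ≐ a ∨′ edgeForm N a w

  meetsForm : Term k → Term k → Term k → Term k → Form k
  meetsForm a b c d = a ≐ c ∨′ a ≐ d ∨′ b ≐ c ∨′ b ≐ d

v0 : ∀ {k} → Term (1 + k)
v0 = ix zero

v1 : ∀ {k} → Term (2 + k)
v1 = ix (suc zero)

v2 : ∀ {k} → Term (3 + k)
v2 = ix (suc (suc zero))

v3 : ∀ {k} → Term (4 + k)
v3 = ix (suc (suc (suc zero)))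

v4 : ∀ {k} → Term (5 + k)
v4 = ix (suc (suc (suc (suc zero))))

-- Only the combined word is visible, so the order N is guessed and then checked: the first group of
-- conditions confirms that the prefix x has the length of an encoding of order N. The second says
-- that x encodes a graph, the third that u is the matrix of a dominating matching. Bits missing
-- from u read as 0.
verifier : ∀ {k} → Form k
verifier = ∃< len
  ((∀< (wordLength v0) (bitAt (double v0) ≐ bitAt (num 1 ⊞ double v0)) ∧′
    bitAt (double (wordLength v0)) ≐ num 0 ∧′ isOne (num 1 ⊞ double (wordLength v0))) ∧′
   (∀< v0 (isOne (double v0)) ∧′ bitAt (double v0) ≐ num 0 ∧′
    ∀< v0 (∀< v1 (¬′ edgeForm v2 v1 v0 ∨′ edgeForm v2 v0 v1)) ∧′
    ∀< v0 (¬′ edgeForm v1 v0 v0)) ∧′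
   (∀< v0 (∀< v1 (¬′ (pairForm v2 v1 v0 ∧′ v1 ≐ v0))) ∧′
    ∀< v0 (∀< v1 (∀< v2 (∀< v3
      (¬′ (pairForm v4 v3 v2 ∧′ pairForm v4 v1 v0 ∧′ meetsForm v3 v2 v1 v0) ∨′ (v3 ≐ v1 ∧′ v2 ≐ v0)))))) ∧′
   ∀< v0 (∃< v1 (∃< v2 (pairForm v3 v1 v0 ∧′ nearForm v3 v2 v1 ∧′ nearForm v3 v2 v0))))

_!_ : List Bool → ℕ → Bool
_!_ = nth false

implies : ∀ {P Q : Set} → Dec P → (P → Q) → ¬ P ⊎ Q
implies (yes p) f = inj₂ (f p)
implies (no ¬p) f = inj₁ ¬p

apply-implies : ∀ {P Q : Set} → ¬ P ⊎ Q → P → Q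
apply-implies (inj₁ ¬p) p = contradiction p ¬p
apply-implies (inj₂ q)  _ = q

index< : ∀ {N i j} → i < N → j < N → N + suc (i * N + j) < N + suc (N * N)
index< {N} {i} {j} i< j< = +-monoʳ-< N (s≤s (<-≤-trans (+-monoʳ-< (i * N) j<)
  (≤-trans (≤-reflexive (+-comm (i * N) N)) (*-monoˡ-≤ N i<))))

module _ (x u : List Bool) (N : ℕ) (len≡ : length x ≡ N + suc (N * N)) where

  private
    y = ⟨ x , u ⟩

  even : ∀ k → k < N + suc (N * N) → (bitℕ (y ! (k + k)) ≡ 1 → x ! k ≡ true) × (x ! k ≡ true → bitℕ (y ! (k + k)) ≡ 1)
  even k k< = (λ e → trans (sym eq) (bitℕ-injective e)) , λ e → cong bitℕ (trans eq e)
    where eq = nth-even x u k (≤-trans k< (≤-reflexive (sym len≡)))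

  certificate : ∀ m → y ! (N + suc (N * N) + (N + suc (N * N)) + (2 + m)) ≡ u ! m
  certificate m = trans (cong (λ l → y ! (l + l + (2 + m))) (sym len≡)) (nth-certificate x u (2 + m))

  nearForm⇒ : ∀ w a → w < N → a < N → (w ≡ a ⊎ bitℕ (y ! ((N + suc (a * N + w)) + (N + suc (a * N + w)))) ≡ 1) →
    Near (Edge N x) w a
  nearForm⇒ w a w< a< (inj₁ e) = inj₁ e
  nearForm⇒ w a w< a< (inj₂ e) = inj₂ (proj₁ (even _ (index< a< w<)) e)

  nearForm⇐ : ∀ w a → w < N → a < N → Near (Edge N x) w a →
    (w ≡ a ⊎ bitℕ (y ! ((N + suc (a * N + w)) + (N + suc (a * N + w)))) ≡ 1)
  nearForm⇐ w a w< a< (inj₁ e) = inj₁ e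
  nearForm⇐ w a w< a< (inj₂ e) = inj₂ (proj₂ (even _ (index< a< w<)) e)

  verifier⇐ : ∀ {k} {ρ : Vec ℕ k} → GraphWord N x →
    (let P = λ i j → u ! (i * N + j) ≡ true in Matching (_< N) P × (∀ w → w < N → Dominates (_< N) (Edge N x) P w)) →
    Holds verifier y ρ
  verifier⇐ {ρ = ρ} (graphWord _ o s sy irr) (matching pr dj , dom) =
    N , N<len , (doubled , end₀ , end₁) ,
    ((λ i i< → proj₂ (even i (≤-trans i< (m≤m+n N _))) (o i i<)) ,
     cong bitℕ (trans (nth-even x u N (≤-trans (m<m+n N (s≤s z≤n)) (≤-reflexive (sym len≡)))) s) ,
     (λ i i< j j< → implies (_ ≟ _) λ e →
       proj₂ (even _ (index< j< i<)) (sy i i< j j< (proj₁ (even _ (index< i< j<)) e))) ,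
     λ i i< e → irr i i< (proj₁ (even _ (index< i< i<)) e)) ,
    ((λ i i< j j< (p , eq) → pr i< j< (pair⇒ p) eq) ,
     λ i i< j j< k k< l l< → implies (holds? (pairForm v4 v3 v2 ∧′ pairForm v4 v1 v0 ∧′ meetsForm v3 v2 v1 v0) y (l ∷ k ∷ j ∷ i ∷ N ∷ ρ))
       λ (p , q , m) → dj i< j< k< l< (pair⇒ p) (pair⇒ q) m) ,
    λ w w< → let a , b , a< , b< , p , na , nb = dom w w< in
      a , a< , b , b< , cong bitℕ (trans (certificate _) p) , nearForm⇐ w a w< a< na , nearForm⇐ w b w< b< nb
    where
    pair⇒ : ∀ {m} → bitℕ (y ! (N + suc (N * N) + (N + suc (N * N)) + (2 + m))) ≡ 1 → u ! m ≡ true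
    pair⇒ e = trans (sym (certificate _)) (bitℕ-injective e)
    at-end : ∀ m → y ! (N + suc (N * N) + (N + suc (N * N)) + m) ≡ (false ∷ true ∷ u) ! m
    at-end m = trans (cong (λ l → y ! (l + l + m)) (sym len≡)) (nth-certificate x u m)
    N<len : N < length y
    N<len = ≤-trans (<-≤-trans (m<m+n N (s≤s z≤n)) (≤-reflexive (sym len≡)))
      (≤-trans (m≤m+n (length x) (length x)) (≤-trans (m≤m+n _ _) (≤-reflexive (sym (length-pairing x u)))))
    doubled : ∀ k → k < N + suc (N * N) → bitℕ (y ! (k + k)) ≡ bitℕ (y ! suc (k + k))
    doubled k k< = cong bitℕ (trans (nth-even x u k k<′) (sym (nth-odd x u k k<′)))
      where k<′ = ≤-trans k< (≤-reflexive (sym len≡))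
    end₀ : bitℕ (y ! (N + suc (N * N) + (N + suc (N * N)))) ≡ 0
    end₀ = cong bitℕ (trans (cong (y !_) (sym (+-identityʳ _))) (at-end 0))
    end₁ : bitℕ (y ! suc (N + suc (N * N) + (N + suc (N * N)))) ≡ 1
    end₁ = cong bitℕ (trans (cong (y !_) (sym (+-comm _ 1))) (at-end 1))

-- The doubled prefix of a pairing ends at its only position k with bits 2k and 2k + 1 equal to 0 and 1.
prefix-length : ∀ x u s → (∀ k → k < s → ⟨ x , u ⟩ ! (k + k) ≡ ⟨ x , u ⟩ ! suc (k + k)) →
  ⟨ x , u ⟩ ! (s + s) ≡ false → ⟨ x , u ⟩ ! suc (s + s) ≡ true → length x ≡ s
prefix-length x u s agree e₀ e₁ with <-cmp (length x) s
... | tri≈ _ eq _ = eq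
... | tri> _ _ s< = case trans (sym e₀) (trans (nth-even x u s s<) (trans (sym (nth-odd x u s s<)) e₁)) of λ ()
... | tri< <s _ _ = case trans (sym (end 0)) (trans (cong (⟨ x , u ⟩ !_) (+-identityʳ _))
    (trans (agree (length x) <s) (trans (cong (⟨ x , u ⟩ !_) (+-comm 1 _)) (end 1)))) of λ ()
  where
  end : ∀ m → ⟨ x , u ⟩ ! (length x + length x + m) ≡ (false ∷ true ∷ u) ! m
  end = nth-certificate x u

verifier⇒ : ∀ {k} {ρ : Vec ℕ k} x u → Holds verifier ⟨ x , u ⟩ ρ → PairingDominatingSet x
verifier⇒ x u (N , _ , (doubled , end₀ , end₁) , (o , s , sy , irr) , (pr , dj) , dom) =
  pds⇐ (graphWord len≡
      (λ i i< → proj₁ (even x u N len≡ i (≤-trans i< (m≤m+n N _))) (o i i<))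
      (trans (sym (nth-even x u N (≤-trans (m<m+n N (s≤s z≤n)) (≤-reflexive (sym len≡))))) (bitℕ-injective s))
      (λ i i< j j< e → proj₁ (edge j< i<) (apply-implies (sy i i< j j<) (proj₂ (edge i< j<) e)))
      (λ i i< e → irr i i< (proj₂ (edge i< i<) e)))
    (λ i j → u ! (i * N + j) Bool.≟ true)
    (matching (λ i< j< p eq → pr _ i< _ j< (pair⇐ p , eq))
      λ i< j< k< l< p q m → apply-implies (dj _ i< _ j< _ k< _ l<) (pair⇐ p , pair⇐ q , m))
    λ w w< → let a , a< , b , b< , p , na , nb = dom w w< in
      a , b , a< , b< , trans (sym (certificate x u N len≡ _)) (bitℕ-injective p) ,
      nearForm⇒ x u N len≡ w a w< a< na , nearForm⇒ x u N len≡ w b w< b< nb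
  where
  len≡ : length x ≡ N + suc (N * N)
  len≡ = prefix-length x u (N + suc (N * N)) (λ k k< → bitℕ-injective (doubled k k<))
    (bitℕ-injective end₀) (bitℕ-injective end₁)
  edge : ∀ {i j} → i < N → j < N → _
  edge i< j< = even x u N len≡ _ (index< i< j<)
  pair⇐ : ∀ {m} → u ! m ≡ true → bitℕ (⟨ x , u ⟩ ! (N + suc (N * N) + (N + suc (N * N)) + (2 + m))) ≡ 1
  pair⇐ e = cong bitℕ (trans (certificate x u N len≡ _) e)

certify : ∀ {x} → PairingDominatingSet x → ∃[ u ] length u ≤ length x × Holds {1} verifier ⟨ x , u ⟩ (0 ∷ [])
certify {x} pds with pds⇒ pds
... | N , gw , P , matching pr dj , dom = u ,
  ≤-trans (≤-reflexive (length-rows {d = false} row length-row id))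
    (≤-trans (≤-trans (n≤1+n _) (m≤n+m _ N)) (≤-reflexive (sym (GraphWord.length≡ gw)))) ,
  verifier⇐ x u N (GraphWord.length≡ gw) {ρ = 0 ∷ []} gw
    (matching (λ i< j< p → pr i< j< (P⇒ i< j< p))
       (λ i< j< k< l< p q → dj i< j< k< l< (P⇒ i< j< p) (P⇒ k< l< q)) ,
     λ w w< → let a , b , a< , b< , p , na , nb = dom w w< in a , b , a< , b< , trans (rowEntry a< b<) p , na , nb)
  where
  row : Fin N → List Bool
  row i = List.tabulate {n = N} λ j → P (toℕ i) (toℕ j)
  length-row : ∀ i → length (row i) ≡ N
  length-row i = List.length-tabulate {n = N} (λ j → P (toℕ i) (toℕ j))
  u = concatMap row (List.tabulate id)
  rowEntry : ∀ {i j} → i < N → j < N → u ! (i * N + j) ≡ P i j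
  rowEntry {i} {j} i< j< = begin
    u ! (i * N + j)                        ≡⟨ cong (λ i → u ! (i * N + j)) (sym (toℕ-lower i<)) ⟩
    u ! (toℕ (lower i<) * N + j)           ≡⟨ nth-rows row length-row id (lower i<) j j< ⟩
    row (lower i<) ! j                     ≡⟨ cong (row (lower i<) !_) (sym (toℕ-lower j<)) ⟩
    row (lower i<) ! toℕ (lower j<)        ≡⟨ nth-tabulate {d = false} (λ j → P (toℕ (lower i<)) (toℕ j)) (lower j<) ⟩
    P (toℕ (lower i<)) (toℕ (lower j<))    ≡⟨ cong₂ P (toℕ-lower i<) (toℕ-lower j<) ⟩
    P i j                                  ∎
    where open ≡-Reasoning
  P⇒ : ∀ {i j} → i < N → j < N → u ! (i * N + j) ≡ true → P i j ≡ true
  P⇒ i< j< e = trans (sym (rowEntry i< j<)) e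

pds-InNP : InNP PairingDominatingSet
pds-InNP = (λ y → decide verifier y (0 ∷ []) ≡ true) ,
  ((λ y → decide verifier y (0 ∷ [])) , tabulated-PolyTime (num 1) verifier , λ y → mk⇔ id id) ,
  -- The certificate is a matrix as large as the adjacency matrix that is part of x, so it is no
  -- longer than x.
  var , λ x → mk⇔
    (λ pds → let u , u≤ , h = certify pds in u , u≤ , decide⇐ verifier ⟨ x , u ⟩ (0 ∷ []) h)
    λ (u , _ , e) → verifier⇒ {ρ = 0 ∷ []} x u (decide⇒ verifier ⟨ x , u ⟩ (0 ∷ []) e)

-- From families of sets to graphs

divide : ∀ {n a b} → n < a * b → ∃[ q ] ∃[ r ] q < a × r < b × n ≡ q * b + r
divide {n} {a} {zero}  n< = case subst (n <_) (*-zeroʳ a) n< of λ ()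
divide {n} {a} {suc b} n< = n / suc b , n % suc b , m<n*o⇒m/o<n n< , m%n<n n (suc b) ,
  trans (m≡m%n+[m/n]*n n (suc b)) (+-comm (n % suc b) _)

digits-< : ∀ {a b q r} → q < a → r < b → q * b + r < a * b
digits-< {a} {b} {q} q< r< = <-≤-trans (+-monoʳ-< (q * b) r<)
  (≤-trans (≤-reflexive (+-comm (q * b) b)) (*-monoˡ-≤ b q<))

digits-unique : ∀ {b q q′ r r′} → r < b → r′ < b → q * b + r ≡ q′ * b + r′ → q ≡ q′ × r ≡ r′
digits-unique {b} {q} {q′} {r} {r′} r< r′< eq with <-cmp q q′
... | tri≈ _ refl _ = refl , +-cancelˡ-≡ (q * b) r r′ eq
... | tri< lt _ _ = contradiction eq (<⇒≢ (<-≤-trans (digits-< lt r<) (m≤m+n _ r′)))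
... | tri> _ _ gt = contradiction (sym eq) (<⇒≢ (<-≤-trans (digits-< gt r′<) (m≤m+n _ r)))

-- Constructive distribution over finitely many cases: with A for "the set is covered", either this
-- holds or every copy of the set is paired with an element.
commonOr : ∀ {A : Set} {n} {B : Fin n → Set} → (∀ i → A ⊎ B i) → A ⊎ (∀ i → B i)
commonOr {n = zero}  h = inj₂ λ ()
commonOr {n = suc n} h with h zero | commonOr (h ∘ suc)
... | inj₁ a | _      = inj₁ a
... | inj₂ _ | inj₁ a = inj₁ a
... | inj₂ b | inj₂ g = inj₂ λ { zero → b ; (suc i) → g i }

-- The vertices below E are the elements and form a clique; vertex suc c * E + t is a copy of
-- the set t.  Each set has more copies than there are elements, so a pair consisting of a copy
-- and an element cannot be what dominates every copy.
module Incidence (E : ℕ) (Inc : ℕ → ℕ → Set) where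

  -- There are as many sets as elements, namely E, and each set has E + 1 copies.
  order : ℕ
  order = (2 + E) * E

  Linked : ℕ → ℕ → Set
  Linked e w = ∃[ c ] c < suc E × ∃[ t ] t < E × w ≡ suc c * E + t × Inc t e

  Adj : ℕ → ℕ → Set
  Adj v w = (v < E × w < E × v ≢ w) ⊎ (v < E × Linked v w) ⊎ (w < E × Linked w v)

  Covered : (ℕ → ℕ → Set) → ℕ → Set
  Covered P t = ∃[ a ] ∃[ b ] a < E × b < E × P a b × Inc t a × Inc t b

  linked-≥ : ∀ {e w} → Linked e w → E ≤ w
  linked-≥ (c , _ , t , _ , refl , _) = ≤-trans (m≤m+n E (c * E)) (m≤m+n _ t)

  adj-sym : ∀ {v w} → Adj v w → Adj w v
  adj-sym (inj₁ (v< , w< , ne)) = inj₁ (w< , v< , ne ∘ sym)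
  adj-sym (inj₂ (inj₁ l))       = inj₂ (inj₂ l)
  adj-sym (inj₂ (inj₂ l))       = inj₂ (inj₁ l)

  adj-irrefl : ∀ {v} → ¬ Adj v v
  adj-irrefl (inj₁ (_ , _ , ne))     = ne refl
  adj-irrefl (inj₂ (inj₁ (v< , l))) = <⇒≱ v< (linked-≥ l)
  adj-irrefl (inj₂ (inj₂ (v< , l))) = <⇒≱ v< (linked-≥ l)

  E≤order : E ≤ order
  E≤order = m≤m+n E _

  copy-neighbour : ∀ {c t a} → t < E → Adj a (suc c * E + t) → a < E × Inc t a
  copy-neighbour {c} {t} t< (inj₁ (_ , w< , _)) =
    contradiction (≤-trans (m≤m+n E (c * E)) (m≤m+n _ t)) (<⇒≱ w<)
  copy-neighbour {c} {t} t< (inj₂ (inj₂ (w< , _))) =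
    contradiction (≤-trans (m≤m+n E (c * E)) (m≤m+n _ t)) (<⇒≱ w<)
  copy-neighbour {c} t< (inj₂ (inj₁ (a< , c′ , _ , t′ , t′< , eq , inc)))
    with refl ← proj₂ (digits-unique {q = suc c} {suc c′} t< t′< eq) = a< , inc

  cover⇒dominate : ∀ {P} → Matching (_< E) P → 0 < E → (∀ t → t < E → Covered P t) →
    let P′ = λ a b → a < E × b < E × P a b in
    Matching (_< order) P′ × (∀ w → w < order → Dominates (_< order) Adj P′ w)
  cover⇒dominate {P} (matching pr dj) 0<E cov =
    matching (λ _ _ (a< , b< , p) → pr a< b< p)
             (λ _ _ _ _ (a< , b< , p) (c< , d< , q) → dj a< b< c< d< p q) , dom
    where
    dom : ∀ w → w < order → Dominates (_< order) Adj (λ a b → a < E × b < E × P a b) w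
    dom w w< with divide {a = 2 + E} w<
    -- In the clique any pair of elements dominates r; the pair that covers set 0 is at hand.
    ... | zero , r , _ , r< , refl with cov 0 0<E
    ...   | a , b , a< , b< , p , _ = a , b , ≤-trans a< E≤order , ≤-trans b< E≤order , (a< , b< , p) , near a a< , near b b<
      where
      near : ∀ a → a < E → Near Adj r a
      near a a< with r ≟ a
      ... | yes eq = inj₁ eq
      ... | no ne  = inj₂ (inj₁ (a< , r< , ne ∘ sym))
    dom w w< | suc c , t , s≤s c< , t< , refl with cov t t<
    ...   | a , b , a< , b< , p , ia , ib = a , b , ≤-trans a< E≤order , ≤-trans b< E≤order , (a< , b< , p) ,
            inj₂ (inj₂ (inj₁ (a< , c , c< , t , t< , refl , ia))) , inj₂ (inj₂ (inj₁ (b< , c , c< , t , t< , refl , ib)))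

  -- If no copy of t were dominated by a pair of its elements, each of the E + 1 copies would be
  -- paired with an element. Two copies would then have the same partner, against disjointness.
  dominate⇒cover : ∀ {P} → Matching (_< order) P → (∀ w → w < order → Dominates (_< order) Adj P w) →
    ∀ t → t < E → Covered P t
  dominate⇒cover {P} (matching pr dj) dom t t< = [ id , ⊥-elim ∘ collision ]′ (commonOr {n = suc E} attempt)
    where
    copyOf : Fin (suc E) → ℕ
    copyOf c = suc (toℕ c) * E + t
    copy<order : ∀ c → copyOf c < order
    copy<order c = digits-< {a = 2 + E} (s≤s (Fin.toℕ<n c)) t<
    E≤copy : ∀ c → E ≤ copyOf c
    E≤copy c = ≤-trans (m≤m+n E _) (m≤m+n _ t)
    Partner : Fin (suc E) → ℕ → Set
    Partner c e = P (copyOf c) e ⊎ P e (copyOf c)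
    attempt : ∀ c → Covered P t ⊎ (∃[ e ] e < E × Partner c e)
    attempt c with dom (copyOf c) (copy<order c)
    ... | a , b , a< , b< , p , inj₁ refl , inj₁ refl = contradiction refl (pr a< b< p)
    ... | a , b , a< , b< , p , inj₁ refl , inj₂ nb = inj₂ (b , proj₁ (copy-neighbour {toℕ c} t< nb) , inj₁ p)
    ... | a , b , a< , b< , p , inj₂ na , inj₁ refl = inj₂ (a , proj₁ (copy-neighbour {toℕ c} t< na) , inj₂ p)
    ... | a , b , a< , b< , p , inj₂ na , inj₂ nb =
      let a<E , ia = copy-neighbour {toℕ c} t< na
          b<E , ib = copy-neighbour {toℕ c} t< nb
      in inj₁ (a , b , a<E , b<E , p , ia , ib)
    collide : ∀ i j → i ≢ j → ∀ {e e′} → e ≡ e′ → Partner i e → Partner j e′ → e < E → ⊥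
    collide i j i≢j {e} refl p q e< = go p q
      where
      e<o = ≤-trans e< E≤order
      same-copy : copyOf i ≡ copyOf j → ⊥
      same-copy eq = i≢j (Fin.toℕ-injective (suc-injective (proj₁ (digits-unique {q = suc (toℕ i)} {suc (toℕ j)} t< t< eq))))
      not-element : ∀ c → copyOf c ≢ e
      not-element c eq = <⇒≱ e< (≤-trans (E≤copy c) (≤-reflexive eq))
      go : Partner i e → Partner j e → ⊥
      go (inj₁ p) (inj₁ q) = same-copy (proj₁ (dj (copy<order i) e<o (copy<order j) e<o p q (inj₂ (inj₂ (inj₂ refl)))))
      go (inj₁ p) (inj₂ q) = not-element i (proj₁ (dj (copy<order i) e<o e<o (copy<order j) p q (inj₂ (inj₂ (inj₁ refl)))))
      go (inj₂ p) (inj₁ q) = not-element j (sym (proj₁ (dj e<o (copy<order i) (copy<order j) e<o p q (inj₂ (inj₁ refl)))))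
      go (inj₂ p) (inj₂ q) = same-copy (proj₂ (dj e<o (copy<order i) e<o (copy<order j) p q (inj₁ refl)))
    collision : (∀ c → ∃[ e ] e < E × Partner c e) → ⊥
    collision g = let i , j , i<j , eq = Fin.pigeonhole ≤-refl (λ c → lower (proj₁ (proj₂ (g c)))) in
      collide i j (Fin.<⇒≢ i<j)
        (trans (sym (toℕ-lower (proj₁ (proj₂ (g i))))) (trans (cong toℕ eq) (toℕ-lower (proj₁ (proj₂ (g j))))))
        (proj₂ (proj₂ (g i))) (proj₂ (proj₂ (g j))) (proj₁ (proj₂ (g i)))

-- Weakening of formulas

module _ {l : ℕ} where

  -- The additional variables go to the far end of the environment, so indices keep their meaning
  -- even under binders. This is why `linkForm` has s and j as its innermost variables.
  weaken : ∀ {k} → Term k → Term (k + l)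
  weaken (ix i)    = ix (i Fin.↑ˡ l)
  weaken (num c)   = num c
  weaken len       = len
  weaken (bitAt t) = bitAt (weaken t)
  weaken (t ⊞ u)   = weaken t ⊞ weaken u
  weaken (t ⊠ u)   = weaken t ⊠ weaken u
  weaken (t ⊟ u)   = weaken t ⊟ weaken u
  weaken (sum t u) = sum (weaken t) (weaken u)

  weakenForm : ∀ {k} → Form k → Form (k + l)
  weakenForm (t ≐ u)  = weaken t ≐ weaken u
  weakenForm (t ≼ u)  = weaken t ≼ weaken u
  weakenForm (φ ∧′ ψ) = weakenForm φ ∧′ weakenForm ψ
  weakenForm (φ ∨′ ψ) = weakenForm φ ∨′ weakenForm ψ
  weakenForm (¬′ φ)   = ¬′ weakenForm φ
  weakenForm (∃< t φ) = ∃< (weaken t) (weakenForm φ)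
  weakenForm (∀< t φ) = ∀< (weaken t) (weakenForm φ)

  Σ<-cong : ∀ n {f g} → (∀ i → f i ≡ g i) → Σ< n f ≡ Σ< n g
  Σ<-cong zero    h = refl
  Σ<-cong (suc n) h = cong₂ _+_ (h n) (Σ<-cong n h)

  module _ (x : List Bool) (ρ′ : Vec ℕ l) where

    eval-weaken : ∀ {k} (t : Term k) ρ → eval (weaken t) x (ρ Vec.++ ρ′) ≡ eval t x ρ
    eval-weaken (ix i)    ρ = Vec.lookup-++ˡ ρ ρ′ i
    eval-weaken (num c)   ρ = refl
    eval-weaken len       ρ = refl
    eval-weaken (bitAt t) ρ = cong (bitℕ ∘ nth false x) (eval-weaken t ρ)
    eval-weaken (t ⊞ u)   ρ = cong₂ _+_ (eval-weaken t ρ) (eval-weaken u ρ)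
    eval-weaken (t ⊠ u)   ρ = cong₂ _*_ (eval-weaken t ρ) (eval-weaken u ρ)
    eval-weaken (t ⊟ u)   ρ = cong₂ _∸_ (eval-weaken t ρ) (eval-weaken u ρ)
    eval-weaken (sum t u) ρ = trans (cong (λ n → Σ< n _) (eval-weaken t ρ))
      (Σ<-cong (eval t x ρ) λ i → eval-weaken u (i ∷ ρ))

    holds-weaken : ∀ {k} (φ : Form k) ρ → Holds (weakenForm φ) x (ρ Vec.++ ρ′) ⇔ Holds φ x ρ
    holds-weaken (t ≐ u) ρ rewrite eval-weaken t ρ | eval-weaken u ρ = mk⇔ id id
    holds-weaken (t ≼ u) ρ rewrite eval-weaken t ρ | eval-weaken u ρ = mk⇔ id id
    holds-weaken (φ ∧′ ψ) ρ = mk⇔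
      (λ (p , q) → to (holds-weaken φ ρ) p , to (holds-weaken ψ ρ) q)
      (λ (p , q) → from (holds-weaken φ ρ) p , from (holds-weaken ψ ρ) q)
      where open Equivalence
    holds-weaken (φ ∨′ ψ) ρ = mk⇔
      [ inj₁ ∘ to (holds-weaken φ ρ) , inj₂ ∘ to (holds-weaken ψ ρ) ]′
      [ inj₁ ∘ from (holds-weaken φ ρ) , inj₂ ∘ from (holds-weaken ψ ρ) ]′
      where open Equivalence
    holds-weaken (¬′ φ) ρ = mk⇔ (_∘ from (holds-weaken φ ρ)) (_∘ to (holds-weaken φ ρ))
      where open Equivalence
    holds-weaken (∃< t φ) ρ rewrite eval-weaken t ρ = mk⇔
      (λ (i , i< , p) → i , i< , to (holds-weaken φ (i ∷ ρ)) p)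
      (λ (i , i< , p) → i , i< , from (holds-weaken φ (i ∷ ρ)) p)
      where open Equivalence
    holds-weaken (∀< t φ) ρ rewrite eval-weaken t ρ = mk⇔
      (λ h i i< → to (holds-weaken φ (i ∷ ρ)) (h i i<))
      (λ h i i< → from (holds-weaken φ (i ∷ ρ)) (h i i<))
      where open Equivalence

-- Graphs given by an adjacency formula

poly : ∀ {k} → Poly → Term k
poly var       = len
poly (const c) = num c
poly (p ⊕ q)   = poly p ⊞ poly q
poly (p ⊗ q)   = poly p ⊠ poly q

eval-poly : ∀ {k} p x (ρ : Vec ℕ k) → eval (poly p) x ρ ≡ ⟦ p ⟧ (length x)
eval-poly var       x ρ = refl
eval-poly (const c) x ρ = refl
eval-poly (p ⊕ q)   x ρ = cong₂ _+_ (eval-poly p x ρ) (eval-poly q x ρ)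
eval-poly (p ⊗ q)   x ρ = cong₂ _*_ (eval-poly p x ρ) (eval-poly q x ρ)

module _ {k} {p : Poly} {x : List Bool} {ρ : Vec ℕ k} {i : ℕ} where

  <poly⇒ : i < eval (poly p) x ρ → i < ⟦ p ⟧ (length x)
  <poly⇒ = subst (i <_) (eval-poly p x ρ)

  <poly⇐ : i < ⟦ p ⟧ (length x) → i < eval (poly p) x ρ
  <poly⇐ = subst (i <_) (sym (eval-poly p x ρ))

-- The formula adj has the column, the row and the bit position as its variables.
module AdjacencyWord (N : Poly) (adj : Form 3) where

  -- The positions that carry a 1: those of the unary order, and the matrix entries of edges.
  -- Position N satisfies neither disjunct and becomes the separating 0.
  wordForm : Form 1
  wordForm = (num 1 ⊞ v0 ≼ poly N) ∨′
    ∃< (poly N) (∃< (poly N) (v2 ≐ poly N ⊞ (num 1 ⊞ (v1 ⊠ poly N ⊞ v0)) ∧′ adj))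

  sizeTerm : Term 0
  sizeTerm = poly N ⊞ (num 1 ⊞ poly N ⊠ poly N)

  opaque

    adjacencyWord : List Bool → List Bool
    adjacencyWord x = List.applyUpTo (λ i → decide wordForm x (i ∷ [])) (eval sizeTerm x [])

    adjacencyWord-PolyTime : PolyTime adjacencyWord
    adjacencyWord-PolyTime = tabulated-PolyTime sizeTerm wordForm

    length-adjacencyWord : ∀ x → length (adjacencyWord x) ≡ eval sizeTerm x []
    length-adjacencyWord x = List.length-applyUpTo _ _

    nth-adjacencyWord : ∀ x {i} → i < eval sizeTerm x [] → nth false (adjacencyWord x) i ≡ decide wordForm x (i ∷ [])
    nth-adjacencyWord x = nth-applyUpTo _ _

  module _ (x : List Bool) (Adj : ℕ → ℕ → Set)
    (adj⇔ : ∀ {v w i} → Holds adj x (w ∷ v ∷ i ∷ []) ⇔ Adj v w) where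

    private
      n = ⟦ N ⟧ (length x)

      size≡ : eval sizeTerm x [] ≡ n + suc (n * n)
      size≡ rewrite eval-poly N x [] = refl

      index≡ : ∀ v w {ρ : Vec ℕ 3} → eval (poly N) x ρ + suc (v * eval (poly N) x ρ + w) ≡ n + suc (v * n + w)
      index≡ v w {ρ} rewrite eval-poly N x ρ = refl

      bit⇒ : ∀ {i} → i < n + suc (n * n) → nth false (adjacencyWord x) i ≡ true → Holds wordForm x (i ∷ [])
      bit⇒ {i} i< e = decide⇒ wordForm x (i ∷ []) (trans (sym (nth-adjacencyWord x (subst (i <_) (sym size≡) i<))) e)

      bit⇐ : ∀ {i} → i < n + suc (n * n) → Holds wordForm x (i ∷ []) → nth false (adjacencyWord x) i ≡ true
      bit⇐ {i} i< h = trans (nth-adjacencyWord x (subst (i <_) (sym size≡) i<)) (decide⇐ wordForm x (i ∷ []) h)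

      position : ∀ {v w v′ w′} → w < n → w′ < n → n + suc (v * n + w) ≡ n + suc (v′ * n + w′) → v ≡ v′ × w ≡ w′
      position w< w′< eq = digits-unique w< w′< (suc-injective (+-cancelˡ-≡ n _ _ eq))

    edge⇔ : ∀ {v w} → v < n → w < n → Edge n (adjacencyWord x) v w ⇔ Adj v w
    edge⇔ {v} {w} v< w< = mk⇔ ⇒ λ a → bit⇐ (index< v< w<)
      (inj₂ (v , <poly⇐ {p = N} v< , w , <poly⇐ {p = N} w< , sym (index≡ v w) , Equivalence.from adj⇔ a))
      where
      ⇒ : Edge n (adjacencyWord x) v w → Adj v w
      ⇒ e with bit⇒ (index< v< w<) e
      ... | inj₁ i< = contradiction (≤-trans i< (≤-reflexive (eval-poly N x _))) (≤⇒≯ (m≤m+n n _))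
      ... | inj₂ (v′ , _ , w′ , w′< , eq , h) =
        let v≡ , w≡ = position w< (<poly⇒ {p = N} w′<) (trans eq (index≡ v′ w′)) in
        subst₂ Adj (sym v≡) (sym w≡) (Equivalence.to adj⇔ h)

    adjacencyWord-graph : (∀ {v w} → Adj v w → Adj w v) → (∀ {v} → ¬ Adj v v) → GraphWord n (adjacencyWord x)
    adjacencyWord-graph sy irr = graphWord (trans (length-adjacencyWord x) size≡)
      (λ i i< → bit⇐ (≤-trans i< (m≤m+n n _)) (inj₁ (≤-trans i< (≤-reflexive (sym (eval-poly N x _))))))
      (Bool.¬-not λ e → case bit⇒ (m<m+n n (s≤s z≤n)) e of λ where
        (inj₁ n<) → <-irrefl refl (≤-trans n< (≤-reflexive (eval-poly N x _)))
        (inj₂ (v , _ , w , _ , eq , _)) → m≢1+m+n n (trans (trans eq (index≡ v w)) (+-suc n _)))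
      (λ i i< j j< e → Equivalence.from (edge⇔ j< i<) (sy (Equivalence.to (edge⇔ i< j<) e)))
      (λ i i< e → irr (Equivalence.to (edge⇔ i< i<) e))

meets-map : ∀ {A B : Set} (f : A → B) {a b c d} → Meets a b c d → Meets (f a) (f b) (f c) (f d)
meets-map f (inj₁ e)               = inj₁ (cong f e)
meets-map f (inj₂ (inj₁ e))        = inj₂ (inj₁ (cong f e))
meets-map f (inj₂ (inj₂ (inj₁ e))) = inj₂ (inj₂ (inj₁ (cong f e)))
meets-map f (inj₂ (inj₂ (inj₂ e))) = inj₂ (inj₂ (inj₂ (cong f e)))

dominates-map : ∀ {N w} {A A′ P : ℕ → ℕ → Set} → w < N → (∀ {v w} → v < N → w < N → A v w → A′ v w) →
  Dominates (_< N) A P w → Dominates (_< N) A′ P w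
dominates-map {N} {w} {A} {A′} w< f (a , b , a< , b< , p , na , nb) = a , b , a< , b< , p , near a< na , near b< nb
  where
  near : ∀ {a} → a < N → Near A w a → Near A′ w a
  near a< (inj₁ e) = inj₁ e
  near a< (inj₂ e) = inj₂ (f a< w< e)

graph-order : ∀ {N N′ w} → GraphWord N w → GraphWord N′ w → N ≡ N′
graph-order {N} {N′} g h with <-cmp N N′
... | tri≈ _ eq _ = eq
... | tri< lt _ _ = case trans (sym (GraphWord.stop g)) (GraphWord.ones h N lt) of λ ()
... | tri> _ _ gt = case trans (sym (GraphWord.stop h)) (GraphWord.ones g N′ gt) of λ ()

solution : ∀ {N w} → GraphWord N w → PairingDominatingSet w → ∃[ P ]
  Matching (_< N) (λ i j → P i j ≡ true) ×
  (∀ i → i < N → Dominates (_< N) (Edge N w) (λ i j → P i j ≡ true) i)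
solution gw pds with pds⇒ pds
... | _ , gw′ , sol with refl ← graph-order gw gw′ = sol

-- For all s and j below the bound that satisfy the guard (with variables s and j), some pair must
-- lie within the given set of elements.
record Demand (M : ℕ) : Set where
  constructor demand
  field
    guard   : Form 2
    members : List (Term 2 × Term 2 × Fin M × Fin 4)

module Pairing {M : ℕ} (m₀ : Fin M) (B : Poly) (ds : List (Demand M)) where

  Element : Set
  Element = ℕ × ℕ × Fin M × Fin 4

  R : ℕ
  R = length ds

  memberForm : ∀ {l} → List (Term 2 × Term 2 × Fin M × Fin 4) → Form (6 + l)
  memberForm []                     = num 0 ≐ num 1
  memberForm ((a , b , m , ρ) ∷ es) =
    (v3 ≐ weaken a ∧′ v4 ≐ weaken b ∧′ ix (Fin.fromℕ 5 Fin.↑ˡ _) ≐ num (toℕ (Fin.combine m ρ))) ∨′ memberForm es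

  demandForm : ∀ {l} → ℕ → List (Demand M) → Form (6 + l)
  demandForm i []       = num 0 ≐ num 0
  demandForm i (d ∷ ds) =
    (¬′ (v2 ≐ num i ∧′ weakenForm (Demand.guard d)) ∨′ memberForm (Demand.members d)) ∧′ demandForm (suc i) ds

  -- The last digit of a code is the kind of an element, below `M * 4`, or the number of a demand,
  -- below R. A common base lets elements and sets be coded in the same range, as `Incidence`
  -- expects.
  width : ℕ
  width = M * 4 + R

  elements order : Poly
  elements = (B ⊗ B) ⊗ const width
  order    = (const 2 ⊕ elements) ⊗ elements

  codeTerm : ∀ {k} → Term k → Term k → Term k → Term k
  codeTerm s j k = (s ⊠ poly B ⊞ j) ⊠ num width ⊞ k

  v5 : ∀ {k} → Term (6 + k)
  v5 = ix (suc (suc (suc (suc (suc zero)))))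

  -- The variables are s, j, r for the set, s′, j′, k′ for the element, and then c, q, p.
  linkForm : Form 12
  linkForm =
    ix (Fin.fromℕ 7 Fin.↑ˡ _) ≐ (num 1 ⊞ ix (Fin.fromℕ 6 Fin.↑ˡ _)) ⊠ poly elements ⊞ codeTerm v0 v1 v2 ∧′
    ix (Fin.fromℕ 8 Fin.↑ˡ _) ≐ codeTerm v3 v4 v5 ∧′ demandForm 0 ds

  adjForm : Form 3
  adjForm = (num 1 ⊞ v1 ≼ poly elements ∧′ num 1 ⊞ v0 ≼ poly elements ∧′ ¬′ (v1 ≐ v0)) ∨′
    -- The two vertices are first named p and q in either order, so that the link formula need not
    -- be written twice.
    ∃< (poly order) (∃< (poly order) (((v1 ≐ v3 ∧′ v0 ≐ v2) ∨′ (v1 ≐ v2 ∧′ v0 ≐ v3)) ∧′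
      ∃< (num 1 ⊞ poly elements)
        (∃< (num width) (∃< (poly B) (∃< (poly B) (∃< (num width) (∃< (poly B) (∃< (poly B) linkForm))))))))

  open AdjacencyWord order adjForm public using (adjacencyWord; adjacencyWord-PolyTime)

  module _ (x : List Bool) where

    private
      b = ⟦ B ⟧ (length x)
      E = ⟦ elements ⟧ (length x)

    In : Element → Set
    In (s , j , _ , _) = s < b × j < b

    valueOf : ℕ → ℕ → Term 2 × Term 2 × Fin M × Fin 4 → Element
    valueOf s j (t , u , m , ρ) = eval t x (s ∷ j ∷ []) , eval u x (s ∷ j ∷ []) , m , ρ

    membersAt : Demand M → ℕ → ℕ → List Element
    membersAt d s j = List.map (valueOf s j) (Demand.members d)

    record Solves (P : Element → Element → Bool) : Set where
      field
        matches : Matching In (λ u v → P u v ≡ true)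
        covers  : ∀ f s j → s < b → j < b → Holds (Demand.guard (List.lookup ds f)) x (s ∷ j ∷ []) →
                  ∃[ u ] ∃[ v ] In u × In v × P u v ≡ true ×
                    u ∈ membersAt (List.lookup ds f) s j × v ∈ membersAt (List.lookup ds f) s j

    Listed : ℕ → ℕ → ℕ → List Element → Set
    Listed s j k us = ∃[ m ] ∃[ ρ ] k ≡ toℕ (Fin.combine m ρ) × (s , j , m , ρ) ∈ us

    -- Being an implication, it gives the set of all elements to every code whose last digit is not
    -- a demand or whose guard fails. Such a set is covered by any pair.
    Demanded : ℕ → List (Demand M) → ℕ → ℕ → ℕ → ℕ → ℕ → ℕ → Set
    Demanded i ds s j r s′ j′ k′ = ∀ f → r ≡ i + toℕ f →
      Holds (Demand.guard (List.lookup ds f)) x (s ∷ j ∷ []) → Listed s′ j′ k′ (membersAt (List.lookup ds f) s j)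

    member⇔ : ∀ {l} {ρ′ : Vec ℕ l} {s j r s′ j′ k′} es →
      Holds (memberForm es) x (s ∷ j ∷ r ∷ s′ ∷ j′ ∷ k′ ∷ ρ′) ⇔ Listed s′ j′ k′ (List.map (valueOf s j) es)
    member⇔ [] = mk⇔ (λ ()) λ { (_ , _ , _ , ()) }
    member⇔ {l} {ρ′} {s} {j} {r} {s′} {j′} {k′} ((a , b , m , ρ) ∷ es)
      with member⇔ {ρ′ = ρ′} {s} {j} {r} {s′} {j′} {k′} es
         | eval-weaken x (r ∷ s′ ∷ j′ ∷ k′ ∷ ρ′) a (s ∷ j ∷ [])
         | eval-weaken x (r ∷ s′ ∷ j′ ∷ k′ ∷ ρ′) b (s ∷ j ∷ [])
    ... | rest | ea | eb rewrite ea | eb = mk⇔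
      (λ { (inj₁ (p , q , k≡)) → m , ρ , k≡ , here (cong₂ (λ s j → s , j , m , ρ) p q)
         ; (inj₂ h) → let m , ρ , k≡ , p = Equivalence.to rest h in m , ρ , k≡ , there p })
      λ { (_ , _ , k≡ , here refl) → inj₁ (refl , refl , k≡)
        ; (m , ρ , k≡ , there p)   → inj₂ (Equivalence.from rest (m , ρ , k≡ , p)) }

    demand⇔ : ∀ {l} {ρ′ : Vec ℕ l} {s j r s′ j′ k′} i es →
      Holds (demandForm i es) x (s ∷ j ∷ r ∷ s′ ∷ j′ ∷ k′ ∷ ρ′) ⇔ Demanded i es s j r s′ j′ k′
    demand⇔ i [] = mk⇔ (λ _ ()) (λ _ → refl)
    demand⇔ {l} {ρ′} {s} {j} {r} {s′} {j′} {k′} i (d ∷ es) = mk⇔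
      (λ { (h , _) zero    r≡ g → to (member⇔ (Demand.members d))
                                     (apply-implies h (trans r≡ (+-identityʳ i) , from guard⇔ g))
         ; (_ , h) (suc f) r≡ g → to (demand⇔ (suc i) es) h f (trans r≡ (+-suc i (toℕ f))) g })
      λ h → implies (holds? (v2 ≐ num i ∧′ weakenForm (Demand.guard d)) x (s ∷ j ∷ r ∷ s′ ∷ j′ ∷ k′ ∷ ρ′))
              (λ (r≡ , g) → from (member⇔ (Demand.members d)) (h zero (trans r≡ (sym (+-identityʳ i))) (to guard⇔ g))) ,
            from (demand⇔ (suc i) es) (λ f r≡ g → h (suc f) (trans r≡ (sym (+-suc i (toℕ f)))) g)
      where
      open Equivalence
      guard⇔ = holds-weaken x (r ∷ s′ ∷ j′ ∷ k′ ∷ ρ′) (Demand.guard d) (s ∷ j ∷ [])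

    code : ℕ → ℕ → ℕ → ℕ
    code s j k = (s * b + j) * width + k

    code< : ∀ {s j k} → s < b → j < b → k < width → code s j k < E
    code< s< j< k< = digits-< (digits-< s< j<) k<

    code-unique : ∀ {s j k s′ j′ k′} → j < b → j′ < b → k < width → k′ < width →
      code s j k ≡ code s′ j′ k′ → s ≡ s′ × j ≡ j′ × k ≡ k′
    code-unique j< j′< k< k′< eq =
      let eq′ , k≡ = digits-unique k< k′< eq
          s≡ , j≡ = digits-unique j< j′< eq′ in s≡ , j≡ , k≡

    decode : ∀ {n} → n < E → ∃[ s ] ∃[ j ] ∃[ k ] s < b × j < b × k < width × n ≡ code s j k
    decode n< =
      let sj , k , sj< , k< , n≡ = divide n<
          s , j , s< , j< , sj≡ = divide sj<
      in s , j , k , s< , j< , k< , trans n≡ (cong (λ i → i * width + k) sj≡)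

    Inc : ℕ → ℕ → Set
    Inc t e = ∃[ s ] ∃[ j ] ∃[ r ] ∃[ s′ ] ∃[ j′ ] ∃[ k′ ] (s < b × j < b × r < width) × (s′ < b × j′ < b × k′ < width) ×
      t ≡ code s j r × e ≡ code s′ j′ k′ × Demanded 0 ds s j r s′ j′ k′

    open Incidence E Inc using (Adj; Linked; linked-≥; adj-sym; adj-irrefl; cover⇒dominate; dominate⇒cover; E≤order)

    codeTerm≡ : ∀ {k} (ρ : Vec ℕ k) s j k →
      eval (codeTerm s j k) x ρ ≡ code (eval s x ρ) (eval j x ρ) (eval k x ρ)
    codeTerm≡ ρ s j k rewrite eval-poly B x ρ = refl

    adj⇔ : ∀ {v w i} → Holds adjForm x (w ∷ v ∷ i ∷ []) ⇔ Adj v w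
    adj⇔ {v} {w} {i} = mk⇔ ⇒ ⇐
      where
      bound≡ : ∀ {k} {ρ : Vec ℕ k} → eval (poly elements) x ρ ≡ E
      bound≡ {ρ = ρ} = eval-poly elements x ρ
      LinkHolds : ℕ → ℕ → Set
      LinkHolds p q = Holds (∃< (num 1 ⊞ poly elements)
        (∃< (num width) (∃< (poly B) (∃< (poly B) (∃< (num width) (∃< (poly B) (∃< (poly B) linkForm)))))))
        x (q ∷ p ∷ w ∷ v ∷ i ∷ [])
      env : ℕ → ℕ → ℕ → ℕ → ℕ → ℕ → ℕ → ℕ → ℕ → Vec ℕ 12
      env s j r s′ j′ k′ c q p = s ∷ j ∷ r ∷ s′ ∷ j′ ∷ k′ ∷ c ∷ q ∷ p ∷ w ∷ v ∷ i ∷ []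
      link⇒ : ∀ {p q} → LinkHolds p q → p < E × Linked p q
      link⇒ {p} {q} (c , c< , k′ , k′< , j′ , j′< , s′ , s′< , r , r< , j , j< , s , s< , q≡ , p≡ , h) =
        subst (_< E) (sym p≡′) (code< (<poly⇒ {p = B} s′<) (<poly⇒ {p = B} j′<) k′<) ,
        c , ≤-trans c< (≤-reflexive (cong suc bound≡)) ,
        code s j r , code< (<poly⇒ {p = B} s<) (<poly⇒ {p = B} j<) r< ,
        trans q≡ (cong₂ (λ e t → suc c * e + t) bound≡ (codeTerm≡ (env s j r s′ j′ k′ c q p) v0 v1 v2)) ,
        s , j , r , s′ , j′ , k′ , (<poly⇒ {p = B} s< , <poly⇒ {p = B} j< , r<) ,
        (<poly⇒ {p = B} s′< , <poly⇒ {p = B} j′< , k′<) , refl , p≡′ , Equivalence.to (demand⇔ 0 ds) h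
        where p≡′ = trans p≡ (codeTerm≡ (env s j r s′ j′ k′ c q p) v3 v4 v5)
      link⇐ : ∀ {p q} → Linked p q → LinkHolds p q
      link⇐ {p} {q} (c , c< , _ , _ , q≡ , s , j , r , s′ , j′ , k′ , (s< , j< , r<) , (s′< , j′< , k′<) , refl , p≡ , h) =
        c , ≤-trans c< (≤-reflexive (cong suc (sym bound≡))) , k′ , k′< , j′ , <poly⇐ {p = B} j′< , s′ , <poly⇐ {p = B} s′< ,
        r , r< , j , <poly⇐ {p = B} j< , s , <poly⇐ {p = B} s< ,
        trans q≡ (sym (cong₂ (λ e t → suc c * e + t) bound≡ (codeTerm≡ (env s j r s′ j′ k′ c q p) v0 v1 v2))) ,
        trans p≡ (sym (codeTerm≡ (env s j r s′ j′ k′ c q p) v3 v4 v5)) , Equivalence.from (demand⇔ 0 ds) h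
      linked-< : ∀ {p q} → Linked p q → q < ⟦ order ⟧ (length x)
      linked-< (c , c< , t , t< , refl , _) = digits-< {a = 2 + E} (s≤s c<) t<
      ⇒ : Holds adjForm x (w ∷ v ∷ i ∷ []) → Adj v w
      ⇒ (inj₁ (v< , w< , ne)) = inj₁ (≤-trans v< (≤-reflexive bound≡) , ≤-trans w< (≤-reflexive bound≡) , ne)
      ⇒ (inj₂ (p , _ , q , _ , inj₁ (refl , refl) , h)) = inj₂ (inj₁ (link⇒ h))
      ⇒ (inj₂ (p , _ , q , _ , inj₂ (refl , refl) , h)) = inj₂ (inj₂ (link⇒ h))
      ⇐ : Adj v w → Holds adjForm x (w ∷ v ∷ i ∷ [])
      ⇐ (inj₁ (v< , w< , ne)) = inj₁ (≤-trans v< (≤-reflexive (sym bound≡)) , ≤-trans w< (≤-reflexive (sym bound≡)) , ne)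
      ⇐ (inj₂ (inj₁ (v< , l))) = inj₂ (v , <poly⇐ {p = order} (≤-trans v< E≤order) , w , <poly⇐ {p = order} (linked-< l) ,
        inj₁ (refl , refl) , link⇐ l)
      ⇐ (inj₂ (inj₂ (w< , l))) = inj₂ (w , <poly⇐ {p = order} (≤-trans w< E≤order) , v , <poly⇐ {p = order} (linked-< l) ,
        inj₂ (refl , refl) , link⇐ l)

    kind< : ∀ (m : Fin M) (ρ : Fin 4) → toℕ (Fin.combine m ρ) < width
    kind< m ρ = ≤-trans (Fin.toℕ<n (Fin.combine m ρ)) (m≤m+n (M * 4) R)

    codeOf : Element → ℕ
    codeOf (s , j , m , ρ) = code s j (toℕ (Fin.combine m ρ))

    codeOf< : ∀ {u} → In u → codeOf u < E
    codeOf< {_ , _ , m , ρ} (s< , j<) = code< s< j< (kind< m ρ)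

    codeOf-injective : ∀ {u v} → In u → In v → codeOf u ≡ codeOf v → u ≡ v
    codeOf-injective {s , j , m , ρ} {s′ , j′ , m′ , ρ′} (s< , j<) (s′< , j′<) eq
      with refl , refl , k≡ ← code-unique {s} {s′ = s′} j< j′< (kind< m ρ) (kind< m′ ρ′) eq
      with refl , refl ← Fin.combine-injective m ρ m′ ρ′ (Fin.toℕ-injective k≡) = refl

    Coded : ℕ → Set
    Coded n = ∃[ u ] In u × n ≡ codeOf u

    coded? : ∀ n → Dec (Coded n)
    coded? n with n <? E
    ... | no n≮ = no λ { (u , u∈ , refl) → n≮ (codeOf< u∈) }
    ... | yes n< with decode n<
    ...   | s , j , k , s< , j< , k< , refl with k <? M * 4
    ...     | yes k<′ = yes ((s , j , Fin.remQuot 4 (fromℕ< k<′)) , (s< , j<) ,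
                cong (code s j) (sym (trans (cong toℕ (Fin.combine-remQuot {M} 4 (fromℕ< k<′))) (Fin.toℕ-fromℕ< k<′))))
    ...     | no k≮ = no λ { ((s′ , j′ , m , ρ) , (s′< , j′<) , eq) →
                k≮ (subst (_< M * 4) (sym (proj₂ (proj₂ (code-unique {s} {s′ = s′} j< j′< k< (kind< m ρ) eq)))) (Fin.toℕ<n _)) }

    inc-members : ∀ f {s j u} → s < b → j < b → In u → u ∈ membersAt (List.lookup ds f) s j →
      Inc (code s j (toℕ f)) (codeOf u)
    inc-members f {s} {j} {s′ , j′ , m , ρ} s< j< (s′< , j′<) u∈ =
      s , j , toℕ f , s′ , j′ , _ , (s< , j< , ≤-trans (Fin.toℕ<n f) (m≤n+m R (M * 4))) , (s′< , j′< , kind< m ρ) , refl , refl ,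
      λ f′ eq g → case Fin.toℕ-injective eq of λ { refl → m , ρ , refl , u∈ }

    members-inc : ∀ f {s j e} → s < b → j < b → Holds (Demand.guard (List.lookup ds f)) x (s ∷ j ∷ []) →
      Inc (code s j (toℕ f)) e → ∃[ u ] In u × e ≡ codeOf u × u ∈ membersAt (List.lookup ds f) s j
    members-inc f {s} {j} s< j< g (s₁ , j₁ , r , s′ , j′ , k′ , (_ , j₁< , r<) , (s′< , j′< , _) , eq , e≡ , h)
      with refl , refl , refl ← code-unique {s} {s′ = s₁} j< j₁< (≤-trans (Fin.toℕ<n f) (m≤n+m R (M * 4))) r< eq
      with m , ρ , refl , u∈ ← h f refl g = (s′ , j′ , m , ρ) , (s′< , j′<) , e≡ , u∈

    -- The sets without a restriction still require a pair to exist; this is what the second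
    -- hypothesis provides.
    solvable⇔pds : 0 < b → (∀ {P} → Solves P → ∃[ u ] ∃[ v ] In u × In v × P u v ≡ true) →
      ∃ Solves ⇔ PairingDominatingSet (adjacencyWord x)
    solvable⇔pds 0<b some = mk⇔ ⇒ ⇐
      where
      open AdjacencyWord order adjForm using (edge⇔; adjacencyWord-graph)
      N = ⟦ order ⟧ (length x)
      isGraph : GraphWord N (adjacencyWord x)
      isGraph = adjacencyWord-graph x Adj adj⇔ adj-sym adj-irrefl
      module _ (P : Element → Element → Bool) (sol : Solves P) where
        open Solves sol
        Q : ℕ → ℕ → Set
        Q e e′ = ∃[ u ] ∃[ v ] In u × In v × e ≡ codeOf u × e′ ≡ codeOf v × P u v ≡ true
        Q? : ∀ e e′ → Dec (Q e e′)
        Q? e e′ with coded? e | coded? e′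
        ... | no ¬u | _ = no λ (u , v , u∈ , v∈ , e≡ , _) → ¬u (u , u∈ , e≡)
        ... | yes _ | no ¬v = no λ (u , v , u∈ , v∈ , _ , e≡ , _) → ¬v (v , v∈ , e≡)
        ... | yes (u , u∈ , refl) | yes (v , v∈ , refl) with P u v in eq
        ...   | true = yes (u , v , u∈ , v∈ , refl , refl , eq)
        ...   | false = no λ (u′ , v′ , u′∈ , v′∈ , e≡ , e′≡ , p) → case trans (sym eq)
                  (trans (cong₂ P (codeOf-injective u∈ u′∈ e≡) (codeOf-injective v∈ v′∈ e′≡)) p) of λ ()
        meets : ∀ {a c d e} → In a → In c → In d → In e → Meets (codeOf a) (codeOf c) (codeOf d) (codeOf e) → Meets a c d e
        meets a c d e (inj₁ eq)               = inj₁ (codeOf-injective a d eq)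
        meets a c d e (inj₂ (inj₁ eq))        = inj₂ (inj₁ (codeOf-injective a e eq))
        meets a c d e (inj₂ (inj₂ (inj₁ eq))) = inj₂ (inj₂ (inj₁ (codeOf-injective c d eq)))
        meets a c d e (inj₂ (inj₂ (inj₂ eq))) = inj₂ (inj₂ (inj₂ (codeOf-injective c e eq)))
        Q-matching : Matching (_< E) Q
        Q-matching = matching
          (λ { _ _ (u , v , u∈ , v∈ , refl , refl , p) eq → Matching.proper matches u∈ v∈ p (codeOf-injective u∈ v∈ eq) })
          λ { _ _ _ _ (u , v , u∈ , v∈ , refl , refl , p) (u′ , v′ , u′∈ , v′∈ , refl , refl , p′) m →
            let u≡ , v≡ = Matching.disjoint matches u∈ v∈ u′∈ v′∈ p p′ (meets u∈ v∈ u′∈ v′∈ m) in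
            cong codeOf u≡ , cong codeOf v≡ }
        Goal : ℕ → Set
        Goal t = ∃[ a ] ∃[ c ] a < E × c < E × Q a c × Inc t a × Inc t c
        undemanded : ∀ {s j r} → s < b → j < b → r < width →
          (∀ f → r ≡ toℕ f → ¬ Holds (Demand.guard (List.lookup ds f)) x (s ∷ j ∷ [])) → Goal (code s j r)
        undemanded {s} {j} {r} s< j< r< inactive = let u , v , u∈ , v∈ , p = some sol in
          codeOf u , codeOf v , codeOf< u∈ , codeOf< v∈ , (u , v , u∈ , v∈ , refl , refl , p) , vacuous u u∈ , vacuous v v∈
          where
          vacuous : ∀ u → In u → Inc (code s j r) (codeOf u)
          vacuous (s′ , j′ , m , ρ) (s′< , j′<) = s , j , r , s′ , j′ , _ , (s< , j< , r<) , (s′< , j′< , kind< m ρ) ,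
            refl , refl , λ f r≡ g → contradiction g (inactive f r≡)
        demanded : ∀ f {s j} → s < b → j < b → Goal (code s j (toℕ f))
        demanded f {s} {j} s< j< with holds? (Demand.guard (List.lookup ds f)) x (s ∷ j ∷ [])
        ... | no ¬g = undemanded s< j< (≤-trans (Fin.toℕ<n f) (m≤n+m R (M * 4)))
                λ f′ eq → case Fin.toℕ-injective eq of λ { refl → ¬g }
        ... | yes g = let u , v , u∈ , v∈ , p , u∈d , v∈d = covers f s j s< j< g in
          codeOf u , codeOf v , codeOf< u∈ , codeOf< v∈ , (u , v , u∈ , v∈ , refl , refl , p) ,
          inc-members f s< j< u∈ u∈d , inc-members f s< j< v∈ v∈d
        covered : ∀ t → t < E → Goal t
        covered t t< with decode t<
        ... | s , j , r , s< , j< , r< , refl with r <? R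
        ...   | no r≮   = undemanded s< j< r< λ f r≡ _ → r≮ (subst (_< R) (sym r≡) (Fin.toℕ<n f))
        ...   | yes r<R = subst (Goal ∘ code s j) (toℕ-lower r<R) (demanded (lower r<R) s< j<)
      ⇒ : ∃ Solves → PairingDominatingSet (adjacencyWord x)
      ⇒ (P , sol) =
        let M′ , dom = cover⇒dominate (Q-matching P sol) (<-≤-trans (s≤s z≤n) (codeOf< {0 , 0 , m₀ , zero} (0<b , 0<b))) (covered P sol) in
        pds⇐ isGraph (λ u v → u <? E ×-dec v <? E ×-dec Q? P sol u v) M′
          (λ w w< → dominates-map w< (λ v< w< → Equivalence.from (edge⇔ x Adj adj⇔ v< w<)) (dom w w<))
      ⇐ : PairingDominatingSet (adjacencyWord x) → ∃ Solves
      ⇐ pds = P′ , record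
        { matches = matching
            (λ u∈ v∈ p eq → Matching.proper isMatching (below u∈) (below v∈) p (cong codeOf eq))
            (λ u∈ v∈ u′∈ v′∈ p q m → let u≡ , v≡ = Matching.disjoint isMatching (below u∈) (below v∈) (below u′∈) (below v′∈) p q (meets-map codeOf m)
              in codeOf-injective u∈ u′∈ u≡ , codeOf-injective v∈ v′∈ v≡)
        ; covers = λ f s j s< j< g → let
              a , c , _ , _ , p , ia , ic = cov (code s j (toℕ f)) (code< s< j< (≤-trans (Fin.toℕ<n f) (m≤n+m R _)))
              u , u∈ , a≡ , u∈d = members-inc f s< j< g ia
              v , v∈ , c≡ , v∈d = members-inc f s< j< g ic
            in u , v , u∈ , v∈ , trans (sym (cong₂ P a≡ c≡)) p , u∈d , v∈d }
        where
        sol = solution isGraph pds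
        P = proj₁ sol
        isMatching = proj₁ (proj₂ sol)
        dom = proj₂ (proj₂ sol)
        P′ : Element → Element → Bool
        P′ u v = P (codeOf u) (codeOf v)
        below : ∀ {u} → In u → codeOf u < N
        below u∈ = ≤-trans (codeOf< u∈) E≤order
        cov = dominate⇒cover isMatching λ w w< → dominates-map w< (λ v< w< → Equivalence.to (edge⇔ x Adj adj⇔ v< w<)) (dom w w<)

-- From clauses to families of sets

record Clause (M : ℕ) : Set where
  constructor clause
  field
    guard    : Form 2
    literals : List (Bool × Term 2 × Term 2 × Fin M)

-- Variable (s , j , m) has the elements (s , j , m , ρ) for ρ = 0, …, 3.  The three triples force a
-- perfect matching of these four elements; the variable is true when 0 is matched with 1, and
-- false when 0 is matched with 2.
triples : ∀ {M} → Fin M → List (Demand M)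
triples {M} m = triple (# 0) (# 1) (# 2) ∷ triple (# 0) (# 1) (# 3) ∷ triple (# 1) (# 2) (# 3) ∷ []
  where
  triple : Fin 4 → Fin 4 → Fin 4 → Demand M
  triple ρ σ τ = demand (num 0 ≐ num 0) ((v0 , v1 , m , ρ) ∷ (v0 , v1 , m , σ) ∷ (v0 , v1 , m , τ) ∷ [])

side : Bool → Fin 4
side true  = # 1
side false = # 2

-- Each literal contributes the two elements whose being matched expresses its truth.
clauseDemand : ∀ {M} → Clause M → Demand M
clauseDemand (clause g ls) =
  demand g (concatMap (λ (b , t , u , m) → (t , u , m , # 0) ∷ (t , u , m , side b) ∷ []) ls)

-- The perfect matching of the four elements that stands for a truth value, each pair listed once,
-- from its smaller to its larger member.
partner : Bool → Fin 4 → Maybe (Fin 4)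
partner true  zero             = just (# 1)
partner true  (suc (suc zero)) = just (# 3)
partner false zero             = just (# 2)
partner false (suc zero)       = just (# 3)
partner _     _                = nothing

partner-proper : ∀ b {ρ} → partner b ρ ≢ just ρ
partner-proper true  {zero} ()
partner-proper true  {suc zero} ()
partner-proper true  {suc (suc zero)} ()
partner-proper true  {suc (suc (suc zero))} ()
partner-proper false {zero} ()
partner-proper false {suc zero} ()
partner-proper false {suc (suc zero)} ()
partner-proper false {suc (suc (suc zero))} ()

partner-disjoint : ∀ b {ρ ρ′ σ σ′} → partner b ρ ≡ just ρ′ → partner b σ ≡ just σ′ → Meets ρ ρ′ σ σ′ → ρ ≡ σ
partner-disjoint true {zero} {σ = zero} _ _ _ = refl
partner-disjoint true {zero} {σ = suc (suc zero)} refl refl (inj₁ ())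
partner-disjoint true {zero} {σ = suc (suc zero)} refl refl (inj₂ (inj₁ ()))
partner-disjoint true {zero} {σ = suc (suc zero)} refl refl (inj₂ (inj₂ (inj₁ ())))
partner-disjoint true {zero} {σ = suc (suc zero)} refl refl (inj₂ (inj₂ (inj₂ ())))
partner-disjoint true {suc (suc zero)} {σ = suc (suc zero)} _ _ _ = refl
partner-disjoint true {suc (suc zero)} {σ = zero} refl refl (inj₁ ())
partner-disjoint true {suc (suc zero)} {σ = zero} refl refl (inj₂ (inj₁ ()))
partner-disjoint true {suc (suc zero)} {σ = zero} refl refl (inj₂ (inj₂ (inj₁ ())))
partner-disjoint true {suc (suc zero)} {σ = zero} refl refl (inj₂ (inj₂ (inj₂ ())))
partner-disjoint false {zero} {σ = zero} _ _ _ = refl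
partner-disjoint false {zero} {σ = suc zero} refl refl (inj₁ ())
partner-disjoint false {zero} {σ = suc zero} refl refl (inj₂ (inj₁ ()))
partner-disjoint false {zero} {σ = suc zero} refl refl (inj₂ (inj₂ (inj₁ ())))
partner-disjoint false {zero} {σ = suc zero} refl refl (inj₂ (inj₂ (inj₂ ())))
partner-disjoint false {suc zero} {σ = suc zero} _ _ _ = refl
partner-disjoint false {suc zero} {σ = zero} refl refl (inj₁ ())
partner-disjoint false {suc zero} {σ = zero} refl refl (inj₂ (inj₁ ()))
partner-disjoint false {suc zero} {σ = zero} refl refl (inj₂ (inj₂ (inj₁ ())))
partner-disjoint false {suc zero} {σ = zero} refl refl (inj₂ (inj₂ (inj₂ ())))

does-true : ∀ {P : Set} (p? : Dec P) → does p? ≡ true → P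
does-true (yes p) _ = p

module Satisfiability {M : ℕ} (m₀ : Fin M) (B : Poly) (cs : List (Clause M)) where

  demands : List (Demand M)
  demands = concatMap triples (List.allFin M) ++ List.map clauseDemand cs

  open Pairing m₀ B demands using (Element; In; Solves; membersAt; valueOf; solvable⇔pds)
  open Pairing m₀ B demands public using (adjacencyWord; adjacencyWord-PolyTime)

  module _ (x : List Bool) where

    private
      b = ⟦ B ⟧ (length x)

    -- A literal counts only when its variable is in range, because beyond the range there are no
    -- elements to be matched.
    Satisfied : (ℕ → ℕ → Fin M → Bool) → ℕ → ℕ → List (Bool × Term 2 × Term 2 × Fin M) → Set
    Satisfied v s j ls = ∃[ a ] ∃[ t ] ∃[ u ] ∃[ m ] (a , t , u , m) ∈ ls ×
      (let s′ = eval t x (s ∷ j ∷ []) ; j′ = eval u x (s ∷ j ∷ []) in s′ < b × j′ < b × v s′ j′ m ≡ a)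

    Satisfies : (ℕ → ℕ → Fin M → Bool) → Set
    Satisfies v = ∀ c → c ∈ cs → ∀ s j → s < b → j < b → Holds (Clause.guard c) x (s ∷ j ∷ []) →
      Satisfied v s j (Clause.literals c)

    CoversDemand : (Element → Element → Bool) → Demand M → Set
    CoversDemand P d = ∀ {s j} → s < b → j < b → Holds (Demand.guard d) x (s ∷ j ∷ []) →
      ∃[ u ] ∃[ w ] In x u × In x w × P u w ≡ true × u ∈ membersAt x d s j × w ∈ membersAt x d s j

    solves-covers : ∀ {P} → Solves x P → ∀ {d} → d ∈ demands → CoversDemand P d
    solves-covers {P} sol d∈ s< j< g
      with Solves.covers sol (Any.index d∈) _ _ s< j< (subst (λ d → Holds (Demand.guard d) x _) (Any.lookup-index d∈) g)
    ... | u , w , u∈ , w∈ , p , u∈d , w∈d = u , w , u∈ , w∈ , p ,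
          subst (λ d → u ∈ membersAt x d _ _) (sym (Any.lookup-index d∈)) u∈d ,
          subst (λ d → w ∈ membersAt x d _ _) (sym (Any.lookup-index d∈)) w∈d

    triple-∈ : ∀ {m d} → d ∈ triples m → d ∈ demands
    triple-∈ {m} d∈ = ∈.∈-++⁺ˡ (∈.∈-concatMap⁺ triples (Any.map (λ { refl → d∈ }) (∈.∈-allFin m)))

    clause-∈ : ∀ {c} → c ∈ cs → clauseDemand c ∈ demands
    clause-∈ c∈ = ∈.∈-++⁺ʳ (concatMap triples (List.allFin M)) (∈.∈-map⁺ clauseDemand c∈)

    demands-∈ : ∀ {d} → d ∈ demands → (∃[ m ] d ∈ triples m) ⊎ (∃[ c ] c ∈ cs × d ≡ clauseDemand c)
    demands-∈ d∈ with ∈.∈-++⁻ (concatMap triples (List.allFin M)) {List.map clauseDemand cs} d∈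
    ... | inj₁ p = inj₁ (let m , q = Any.satisfied (∈.∈-concatMap⁻ triples {xs = List.allFin M} p) in m , q)
    ... | inj₂ p = inj₂ (∈.∈-map⁻ clauseDemand p)

    literal-members : ∀ {s j a t u m} ls → (a , t , u , m) ∈ ls → ∀ {g} ρ → ρ ≡ # 0 ⊎ ρ ≡ side a →
      (eval t x (s ∷ j ∷ []) , eval u x (s ∷ j ∷ []) , m , ρ) ∈ membersAt x (clauseDemand (clause g ls)) s j
    literal-members (_ ∷ ls) (here refl) ρ (inj₁ refl) = here refl
    literal-members (_ ∷ ls) (here refl) ρ (inj₂ refl) = there (here refl)
    literal-members (_ ∷ ls) (there l∈)  {g} ρ r       = there (there (literal-members ls l∈ {g} ρ r))

    members-literal : ∀ {s j s′ j′ m ρ g} ls → (s′ , j′ , m , ρ) ∈ membersAt x (clauseDemand (clause g ls)) s j →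
      ∃[ a ] ∃[ t ] ∃[ u ] (a , t , u , m) ∈ ls × s′ ≡ eval t x (s ∷ j ∷ []) × j′ ≡ eval u x (s ∷ j ∷ []) ×
        (ρ ≡ # 0 ⊎ ρ ≡ side a)
    members-literal (_ ∷ ls) (here refl)         = _ , _ , _ , here refl , refl , refl , inj₁ refl
    members-literal (_ ∷ ls) (there (here refl)) = _ , _ , _ , here refl , refl , refl , inj₂ refl
    members-literal {g = g} (_ ∷ ls) (there (there p)) =
      let a , t , u , l∈ , rest = members-literal {g = g} ls p in a , t , u , there l∈ , rest

    module FromAssignment (v : ℕ → ℕ → Fin M → Bool) (sat : Satisfies v) where

      Paired : Element → Element → Set
      Paired (s , j , m , ρ) (s′ , j′ , m′ , ρ′) = (s ≡ s′ × j ≡ j′ × m ≡ m′) × partner (v s j m) ρ ≡ just ρ′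

      paired? : ∀ u w → Dec (Paired u w)
      paired? (s , j , m , ρ) (s′ , j′ , m′ , ρ′) =
        (s ≟ s′ ×-dec j ≟ j′ ×-dec m Fin.≟ m′) ×-dec Maybe.≡-dec Fin._≟_ (partner (v s j m) ρ) (just ρ′)

      P : Element → Element → Bool
      P u w = does (paired? u w)

      P⇐ : ∀ {u w} → Paired u w → P u w ≡ true
      P⇐ {u} {w} = dec-true (paired? u w)

      P⇒ : ∀ {u w} → P u w ≡ true → Paired u w
      P⇒ {u} {w} = does-true (paired? u w)

      same-variable : ∀ {a c d e} → Paired a c → Paired d e → Meets a c d e →
        (let s , j , m , _ = a ; s′ , j′ , m′ , _ = d in (s , j , m) ≡ (s′ , j′ , m′))
      same-variable ((refl , refl , refl) , _) ((refl , refl , refl) , _) (inj₁ refl)               = refl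
      same-variable ((refl , refl , refl) , _) ((refl , refl , refl) , _) (inj₂ (inj₁ refl))        = refl
      same-variable ((refl , refl , refl) , _) ((refl , refl , refl) , _) (inj₂ (inj₂ (inj₁ refl))) = refl
      same-variable ((refl , refl , refl) , _) ((refl , refl , refl) , _) (inj₂ (inj₂ (inj₂ refl))) = refl

      disjoint : ∀ {a c d e} → Paired a c → Paired d e → Meets a c d e → a ≡ d × c ≡ e
      disjoint {s , j , m , _} p q meet with same-variable p q meet
      ... | refl with (refl , refl , refl) , r ← p | (refl , refl , refl) , r′ ← q
        with refl ← partner-disjoint (v s j m) r r′ (meets-map (λ (_ , _ , _ , ρ) → ρ) meet)
        with refl ← trans (sym r) r′ = refl , refl

      pick : ∀ {s j m ρ d} σ → s < b → j < b → partner (v s j m) ρ ≡ just σ →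
        (s , j , m , ρ) ∈ membersAt x d s j → (s , j , m , σ) ∈ membersAt x d s j →
        ∃[ u ] ∃[ w ] In x u × In x w × P u w ≡ true × u ∈ membersAt x d s j × w ∈ membersAt x d s j
      pick σ s< j< eq u∈ w∈ = _ , _ , (s< , j<) , (s< , j<) , P⇐ ((refl , refl , refl) , eq) , u∈ , w∈

      -- A triple omits one of the four elements, and the pair of the perfect matching that avoids
      -- this element lies within the triple.
      covers-triple : ∀ m {d} → d ∈ triples m → CoversDemand P d
      covers-triple m d∈ {s} {j} s< j< _ with v s j m in eq
      covers-triple m {d} (here refl)                 s< j< _ | true  = pick {d = d} (# 1) s< j< (cong (λ c → partner c (# 0)) eq) (here refl) (there (here refl))
      covers-triple m {d} (there (here refl))         s< j< _ | true  = pick {d = d} (# 1) s< j< (cong (λ c → partner c (# 0)) eq) (here refl) (there (here refl))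
      covers-triple m {d} (there (there (here refl))) s< j< _ | true  = pick {d = d} (# 3) s< j< (cong (λ c → partner c (# 2)) eq) (there (here refl)) (there (there (here refl)))
      covers-triple m {d} (here refl)                 s< j< _ | false = pick {d = d} (# 2) s< j< (cong (λ c → partner c (# 0)) eq) (here refl) (there (there (here refl)))
      covers-triple m {d} (there (here refl))         s< j< _ | false = pick {d = d} (# 3) s< j< (cong (λ c → partner c (# 1)) eq) (there (here refl)) (there (there (here refl)))
      covers-triple m {d} (there (there (here refl))) s< j< _ | false = pick {d = d} (# 3) s< j< (cong (λ c → partner c (# 1)) eq) (here refl) (there (there (here refl)))

      partner-side : ∀ a → partner a (# 0) ≡ just (side a)
      partner-side true  = refl
      partner-side false = refl

      covers-clause : ∀ {c} → c ∈ cs → CoversDemand P (clauseDemand c)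
      covers-clause {clause g ls} c∈ {s} {j} s< j< h with sat _ c∈ s j s< j< h
      ... | a , t , u , m , l∈ , s′< , j′< , refl = _ , _ , (s′< , j′<) , (s′< , j′<) ,
            P⇐ ((refl , refl , refl) , partner-side _) ,
            literal-members ls l∈ {g} (# 0) (inj₁ refl) , literal-members ls l∈ {g} _ (inj₂ refl)

      solves : Solves x P
      solves = record
        { matches = matching
            (λ { {u} _ _ p refl → partner-proper (v _ _ _) (proj₂ (P⇒ {u} {u} p)) })
            (λ _ _ _ _ p q → disjoint (P⇒ p) (P⇒ q))
        ; covers  = λ f s j s< j< → [ (λ (m , d∈) → covers-triple m d∈ s< j<)
                                    , (λ (c , c∈ , eq) → subst (CoversDemand P) (sym eq) (covers-clause c∈) s< j<) ]′
                                    (demands-∈ (∈.∈-lookup f))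
        }

    module FromPairs (P : Element → Element → Bool) (sol : Solves x P) where

      open Matching (Solves.matches sol)

      Mates : Element → Element → Set
      Mates u w = P u w ≡ true ⊎ P w u ≡ true

      mates-sym : ∀ {u w} → Mates u w → Mates w u
      mates-sym (inj₁ p) = inj₂ p
      mates-sym (inj₂ p) = inj₁ p

      mates-proper : ∀ {u} → In x u → ¬ Mates u u
      mates-proper u∈ (inj₁ p) = proper u∈ u∈ p refl
      mates-proper u∈ (inj₂ p) = proper u∈ u∈ p refl

      mates-unique : ∀ {u w w′} → In x u → In x w → In x w′ → Mates u w → Mates u w′ → w ≡ w′
      mates-unique u∈ w∈ w′∈ (inj₁ p) (inj₁ q) = proj₂ (disjoint u∈ w∈ u∈ w′∈ p q (inj₁ refl))
      mates-unique u∈ w∈ w′∈ (inj₂ p) (inj₂ q) = proj₁ (disjoint w∈ u∈ w′∈ u∈ p q (inj₂ (inj₂ (inj₂ refl))))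
      mates-unique u∈ w∈ w′∈ (inj₁ p) (inj₂ q) =
        let u≡w′ , w≡u = disjoint u∈ w∈ w′∈ u∈ p q (inj₂ (inj₁ refl)) in trans w≡u u≡w′
      mates-unique u∈ w∈ w′∈ (inj₂ p) (inj₁ q) =
        let w≡u , u≡w′ = disjoint w∈ u∈ u∈ w′∈ p q (inj₂ (inj₂ (inj₁ refl))) in trans w≡u u≡w′

      mates-in-triple : ∀ {a c d u w : Element} → u ∈ a ∷ c ∷ d ∷ [] → w ∈ a ∷ c ∷ d ∷ [] → In x u →
        P u w ≡ true → Mates a c ⊎ Mates a d ⊎ Mates c d
      mates-in-triple (here refl) (here refl) u∈ p = contradiction (inj₁ p) (mates-proper u∈)
      mates-in-triple (here refl) (there (here refl)) u∈ p = inj₁ (inj₁ p)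
      mates-in-triple (here refl) (there (there (here refl))) u∈ p = inj₂ (inj₁ (inj₁ p))
      mates-in-triple (there (here refl)) (here refl) u∈ p = inj₁ (inj₂ p)
      mates-in-triple (there (here refl)) (there (here refl)) u∈ p = contradiction (inj₁ p) (mates-proper u∈)
      mates-in-triple (there (here refl)) (there (there (here refl))) u∈ p = inj₂ (inj₂ (inj₁ p))
      mates-in-triple (there (there (here refl))) (here refl) u∈ p = inj₂ (inj₁ (inj₂ p))
      mates-in-triple (there (there (here refl))) (there (here refl)) u∈ p = inj₂ (inj₂ (inj₂ p))
      mates-in-triple (there (there (here refl))) (there (there (here refl))) u∈ p = contradiction (inj₁ p) (mates-proper u∈)

      module _ {s j : ℕ} (m : Fin M) (s< : s < b) (j< : j < b) where

        el : Fin 4 → Element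
        el ρ = s , j , m , ρ

        private
          clash : ∀ {ρ σ τ} {A : Set} → Mates (el ρ) (el σ) → Mates (el ρ) (el τ) → σ ≢ τ → A
          clash {ρ} {σ} {τ} p q σ≢τ with refl ← mates-unique {el ρ} {el σ} {el τ} (s< , j<) (s< , j<) (s< , j<) p q = contradiction refl σ≢τ

          of-triple : ∀ {d ρ σ τ} → d ∈ triples m → membersAt x d s j ≡ el ρ ∷ el σ ∷ el τ ∷ [] →
            Holds (Demand.guard d) x (s ∷ j ∷ []) →
            Mates (el ρ) (el σ) ⊎ Mates (el ρ) (el τ) ⊎ Mates (el σ) (el τ)
          of-triple d∈ eq g with solves-covers sol (triple-∈ d∈) s< j< g
          ... | u , w , u∈ , _ , p , u∈d , w∈d = mates-in-triple (subst (u ∈_) eq u∈d) (subst (w ∈_) eq w∈d) u∈ p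

        perfect : (Mates (el (# 0)) (el (# 1)) × Mates (el (# 2)) (el (# 3))) ⊎
                  (Mates (el (# 0)) (el (# 2)) × Mates (el (# 1)) (el (# 3))) ⊎
                  (Mates (el (# 1)) (el (# 2)) × Mates (el (# 0)) (el (# 3)))
        -- Whichever pair lies in the triple 0, 1, 2, one of the other two triples has a single pair
        -- disjoint from it, namely the complementary one.
        perfect with of-triple (here refl) refl refl | of-triple (there (here refl)) refl refl
                   | of-triple (there (there (here refl))) refl refl
        ... | inj₁ p        | _               | inj₁ q        = clash (mates-sym p) q λ ()
        ... | inj₁ p        | _               | inj₂ (inj₁ q) = clash (mates-sym p) q λ ()
        ... | inj₁ p        | _               | inj₂ (inj₂ q) = inj₁ (p , q)
        ... | inj₂ (inj₁ p) | inj₁ q          | _             = clash p q λ ()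
        ... | inj₂ (inj₁ p) | inj₂ (inj₁ q)   | _             = clash p q λ ()
        ... | inj₂ (inj₁ p) | inj₂ (inj₂ q)   | _             = inj₂ (inj₁ (p , q))
        ... | inj₂ (inj₂ p) | inj₁ q          | _             = clash p (mates-sym q) λ ()
        ... | inj₂ (inj₂ p) | inj₂ (inj₁ q)   | _             = inj₂ (inj₂ (p , q))
        ... | inj₂ (inj₂ p) | inj₂ (inj₂ q)   | _             = clash p q λ ()

        mate : ∀ ρ → ∃[ σ ] Mates (el ρ) (el σ)
        mate ρ with perfect | ρ
        ... | inj₁ (p , q)        | zero               = _ , p
        ... | inj₁ (p , q)        | suc zero           = _ , mates-sym p
        ... | inj₁ (p , q)        | suc (suc zero)     = _ , q
        ... | inj₁ (p , q)        | suc (suc (suc zero)) = _ , mates-sym q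
        ... | inj₂ (inj₁ (p , q)) | zero               = _ , p
        ... | inj₂ (inj₁ (p , q)) | suc zero           = _ , q
        ... | inj₂ (inj₁ (p , q)) | suc (suc zero)     = _ , mates-sym p
        ... | inj₂ (inj₁ (p , q)) | suc (suc (suc zero)) = _ , mates-sym q
        ... | inj₂ (inj₂ (p , q)) | zero               = _ , q
        ... | inj₂ (inj₂ (p , q)) | suc zero           = _ , p
        ... | inj₂ (inj₂ (p , q)) | suc (suc zero)     = _ , mates-sym p
        ... | inj₂ (inj₂ (p , q)) | suc (suc (suc zero)) = _ , mates-sym q

      v : ℕ → ℕ → Fin M → Bool
      v s j m = P (s , j , m , # 0) (s , j , m , # 1) ∨ P (s , j , m , # 1) (s , j , m , # 0)

      v-true : ∀ {s j m} → Mates (s , j , m , # 0) (s , j , m , # 1) → v s j m ≡ true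
      v-true (inj₁ p) rewrite p = refl
      v-true {s} {j} {m} (inj₂ p) rewrite p = Bool.∨-zeroʳ (P (s , j , m , # 0) (s , j , m , # 1))

      v-false : ∀ {s j m} → s < b → j < b → Mates (s , j , m , # 0) (s , j , m , # 2) → v s j m ≡ false
      v-false {s} {j} {m} s< j< p with P (s , j , m , # 0) (s , j , m , # 1) in eq | P (s , j , m , # 1) (s , j , m , # 0) in eq′
      ... | true  | _     = case mates-unique {w = _ , _ , _ , # 2} {w′ = _ , _ , _ , # 1} (s< , j<) (s< , j<) (s< , j<) p (inj₁ eq) of λ ()
      ... | false | true  = case mates-unique {w = _ , _ , _ , # 2} {w′ = _ , _ , _ , # 1} (s< , j<) (s< , j<) (s< , j<) p (inj₂ eq′) of λ ()
      ... | false | false = refl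

      v-side : ∀ {s j m} a → s < b → j < b → Mates (s , j , m , # 0) (s , j , m , side a) → v s j m ≡ a
      v-side true  _  _  = v-true
      v-side false s< j< = v-false s< j<

      -- A pair of 0 with a side fixes the truth value. If instead the two sides 1 and 2 are paired,
      -- both signs of the variable occur in the clause, and one of them is true in any case.
      either-literal : ∀ {s j m ρ ρ′ a a′} → s < b → j < b → Mates (s , j , m , ρ) (s , j , m , ρ′) →
        ρ ≡ # 0 ⊎ ρ ≡ side a → ρ′ ≡ # 0 ⊎ ρ′ ≡ side a′ → v s j m ≡ a ⊎ v s j m ≡ a′
      either-literal s< j< p (inj₁ refl) (inj₁ refl) = contradiction p (mates-proper (s< , j<))
      either-literal s< j< p (inj₁ refl) (inj₂ refl) = inj₂ (v-side _ s< j< p)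
      either-literal s< j< p (inj₂ refl) (inj₁ refl) = inj₁ (v-side _ s< j< (mates-sym p))
      either-literal {s} {j} {m} {a = a} {a′} s< j< p (inj₂ refl) (inj₂ refl) = differ a a′ (v s j m) p
        where
        differ : ∀ a a′ c → Mates (s , j , m , side a) (s , j , m , side a′) → c ≡ a ⊎ c ≡ a′
        differ true  true  _     p = contradiction p (mates-proper (s< , j<))
        differ false false _     p = contradiction p (mates-proper (s< , j<))
        differ true  false true  _ = inj₁ refl
        differ true  false false _ = inj₂ refl
        differ false true  true  _ = inj₂ refl
        differ false true  false _ = inj₁ refl

      -- Each element already has its mate within its own variable, so no pair joins two variables.
      -- A covered clause set therefore owes its pair to one variable.
      same-variable : ∀ {s j m ρ w} → s < b → j < b → In x w → Mates (s , j , m , ρ) w →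
        ∃[ σ ] w ≡ (s , j , m , σ)
      same-variable {s} {j} {m} {ρ} {w} s< j< w∈ p = let σ , q = mate m s< j< ρ in
        σ , mates-unique {s , j , m , ρ} {w} {s , j , m , σ} (s< , j<) w∈ (s< , j<) p q

      satisfied : ∀ {s j g s′ j′ m ρ ρ′} ls → s′ < b → j′ < b → Mates (s′ , j′ , m , ρ) (s′ , j′ , m , ρ′) →
        (s′ , j′ , m , ρ) ∈ membersAt x (clauseDemand (clause g ls)) s j →
        (s′ , j′ , m , ρ′) ∈ membersAt x (clauseDemand (clause g ls)) s j → Satisfied v s j ls
      satisfied {s} {j} {g} {s′} {j′} {m} ls s′< j′< p u∈ w∈ =
        let a , t , u , l∈ , s≡ , j≡ , r = members-literal {g = g} ls u∈
            a′ , t′ , u′ , l∈′ , s≡′ , j≡′ , r′ = members-literal {g = g} ls w∈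
        in [ found l∈ s≡ j≡ , found l∈′ s≡′ j≡′ ]′ (either-literal {s′} {j′} {m} s′< j′< p r r′)
        where
        found : ∀ {a t u} → (a , t , u , m) ∈ ls → s′ ≡ eval t x (s ∷ j ∷ []) → j′ ≡ eval u x (s ∷ j ∷ []) →
          v s′ j′ m ≡ a → Satisfied v s j ls
        found l∈ s≡ j≡ eq = _ , _ , _ , m , l∈ , subst (_< b) s≡ s′< , subst (_< b) j≡ j′< ,
          trans (cong₂ (λ s j → v s j m) (sym s≡) (sym j≡)) eq

      satisfies : Satisfies v
      satisfies (clause g ls) c∈ s j s< j< h =
        let (s′ , j′ , m , ρ) , w , (s′< , j′<) , w∈ , p , u∈d , w∈d = solves-covers sol (clause-∈ c∈) s< j< h
            σ , w≡ = same-variable {s′} {j′} {m} {ρ} {w} s′< j′< w∈ (inj₁ p)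
        in satisfied {s} {j} {g} {s′} {j′} {m} {ρ} {σ} ls s′< j′< (subst (Mates (s′ , j′ , m , ρ)) w≡ (inj₁ p)) u∈d
             (subst (_∈ membersAt x (clauseDemand (clause g ls)) s j) w≡ w∈d)

    satisfiable⇔pds : 0 < b → ∃ Satisfies ⇔ PairingDominatingSet (adjacencyWord x)
    satisfiable⇔pds 0<b = mk⇔
      (λ (v , sat) → to pds⇔ (FromAssignment.P v sat , FromAssignment.solves v sat))
      (λ pds → let P , sol = from pds⇔ pds in FromPairs.v P sol , FromPairs.satisfies P sol)
      where
      open Equivalence
      pds⇔ = solvable⇔pds x 0<b λ {P} sol →
        let u , w , u∈ , w∈ , p , _ = solves-covers sol (triple-∈ {m₀} (here refl)) 0<b 0<b refl in u , w , u∈ , w∈ , p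

-- From computations to clauses

_≟ₛ_ : ∀ {aux} (σ τ : Symbol aux) → Dec (σ ≡ τ)
blank   ≟ₛ blank   = yes refl
blank   ≟ₛ bit _   = no λ ()
blank   ≟ₛ other _ = no λ ()
bit _   ≟ₛ blank   = no λ ()
bit a   ≟ₛ bit b   with a Bool.≟ b
... | yes refl = yes refl
... | no a≢b   = no λ { refl → a≢b refl }
bit _   ≟ₛ other _ = no λ ()
other _ ≟ₛ blank   = no λ ()
other _ ≟ₛ bit _   = no λ ()
other f ≟ₛ other g with f Fin.≟ g
... | yes refl = yes refl
... | no f≢g   = no λ { refl → f≢g refl }

symbols : ∀ aux → List (Symbol aux)
symbols aux = blank ∷ bit false ∷ bit true ∷ List.map other (List.allFin aux)

∈-symbols : ∀ {aux} (σ : Symbol aux) → σ ∈ symbols aux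
∈-symbols blank       = here refl
∈-symbols (bit false) = there (here refl)
∈-symbols (bit true)  = there (there (here refl))
∈-symbols (other f)   = there (there (there (∈.∈-map⁺ other (∈.∈-allFin f))))

vectors : ∀ {A : Set} → List A → ∀ n → List (Vec A n)
vectors as zero    = [] ∷ []
vectors as (suc n) = List.cartesianProductWith _∷_ as (vectors as n)

∈-vectors : ∀ {A : Set} {as : List A} → (∀ a → a ∈ as) → ∀ {n} (v : Vec A n) → v ∈ vectors as n
∈-vectors all []      = here refl
∈-vectors all (a ∷ v) = ∈.∈-cartesianProductWith⁺ _∷_ (all a) (∈-vectors all v)

-- Cell 0 lies as many cells left of the head as steps remain. Each step lowers this distance by one
-- while the head moves, so the numbering shifts by 0, 1 or 2.
shift : Move → ℕ
shift left  = 0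
shift stay  = 1
shift right = 2

shift≤2 : ∀ m → shift m ≤ 2
shift≤2 left  = z≤n
shift≤2 stay  = s≤s z≤n
shift≤2 right = ≤-refl

module _ {aux : ℕ} where

  -- The s nearest cells on the left are carried over to the right-hand list, with blanks where the
  -- tape has not been visited.
  window : ℕ → List (Symbol aux) → List (Symbol aux) → ℕ → Symbol aux
  window zero    ls       rs j = nth blank rs j
  window (suc s) []       rs j = window s [] (blank ∷ rs) j
  window (suc s) (l ∷ ls) rs j = window s ls (l ∷ rs) j

  -- The cell at offset j - s from the head.
  view : ℕ → Tape aux → ℕ → Symbol aux
  view s (tape ls h rs) j = window s ls (h ∷ rs) j

  window-cong : ∀ s ls {rs rs′} → (∀ i → nth blank rs i ≡ nth blank rs′ i) → ∀ j → window s ls rs j ≡ window s ls rs′ j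
  window-cong zero    ls       h j = h j
  window-cong (suc s) []       h j = window-cong s [] (λ { zero → refl ; (suc i) → h i }) j
  window-cong (suc s) (l ∷ ls) h j = window-cong s ls (λ { zero → refl ; (suc i) → h i }) j

  window-suc : ∀ s ls rs j → window s ls rs j ≡ window (suc s) ls rs (suc j)
  window-suc zero    []       rs j = refl
  window-suc zero    (l ∷ ls) rs j = refl
  window-suc (suc s) []       rs j = window-suc s [] (blank ∷ rs) j
  window-suc (suc s) (l ∷ ls) rs j = window-suc s ls (l ∷ rs) j

  window-+ : ∀ s ls rs i → window s ls rs (s + i) ≡ nth blank rs i
  window-+ zero    ls       rs i = refl
  window-+ (suc s) []       rs i = trans (cong (window s [] (blank ∷ rs)) (sym (+-suc s i))) (window-+ s [] (blank ∷ rs) (suc i))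
  window-+ (suc s) (l ∷ ls) rs i = trans (cong (window s ls (l ∷ rs)) (sym (+-suc s i))) (window-+ s ls (l ∷ rs) (suc i))

  window-head : ∀ s ls r rs → window s ls (r ∷ rs) s ≡ r
  window-head s ls r rs = trans (cong (window s ls (r ∷ rs)) (sym (+-identityʳ s))) (window-+ s ls (r ∷ rs) 0)

  window-< : ∀ s ls rs rs′ {j} → j < s → window s ls rs j ≡ window s ls rs′ j
  window-< (suc s) ls rs rs′ {j} (s≤s j≤) with m≤n⇒m<n∨m≡n j≤ | ls
  ... | inj₁ j<   | []     = window-< s [] (blank ∷ rs) (blank ∷ rs′) j<
  ... | inj₁ j<   | l ∷ ls = window-< s ls (l ∷ rs) (l ∷ rs′) j<
  ... | inj₂ refl | []     = trans (window-head s [] blank rs) (sym (window-head s [] blank rs′))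
  ... | inj₂ refl | l ∷ ls = trans (window-head s ls l rs) (sym (window-head s ls l rs′))

  view-head : ∀ s t → view s t s ≡ Tape.head t
  view-head s (tape ls h rs) = window-head s ls h rs

  view-move : ∀ m s t j → view s (move m t) j ≡ view (suc s) t (shift m + j)
  view-move left  s (tape []       h rs) j = refl
  view-move left  s (tape (l ∷ ls) h rs) j = refl
  view-move stay  s (tape ls h rs)       j = window-suc s ls (h ∷ rs) j
  view-move right s (tape ls h (r ∷ rs)) j =
    trans (window-suc s (h ∷ ls) (r ∷ rs) j) (window-suc s ls (h ∷ r ∷ rs) (suc j))
  view-move right s (tape ls h [])       j =
    trans (window-suc s (h ∷ ls) (blank ∷ []) j) (trans (window-suc s ls (h ∷ blank ∷ []) (suc j))
      (window-cong (suc s) ls (λ { zero → refl ; (suc zero) → refl ; (suc (suc i)) → refl }) (suc (suc j))))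

  view-write : ∀ σ s t {j} → j ≢ s → view s (write σ t) j ≡ view s t j
  view-write σ s (tape ls h rs) {j} j≢s with <-cmp j s
  ... | tri< j< _ _ = window-< s ls _ _ j<
  ... | tri≈ _ eq _ = contradiction eq j≢s
  ... | tri> _ _ s< with k , refl ← m≤n⇒∃[o]m+o≡n s< =
    subst (λ i → window s ls (σ ∷ rs) i ≡ window s ls (h ∷ rs) i) (+-suc s k)
      (trans (window-+ s ls (σ ∷ rs) (suc k)) (sym (window-+ s ls (h ∷ rs) (suc k))))

  view-blank : ∀ s j → view s (load []) j ≡ blank
  view-blank s j = go s (blank ∷ []) (λ { zero → refl ; (suc i) → refl }) j
    where
    go : ∀ s rs → (∀ i → nth blank rs i ≡ blank) → ∀ j → window s [] rs j ≡ blank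
    go zero    rs h j = h j
    go (suc s) rs h j = go s (blank ∷ rs) (λ { zero → refl ; (suc i) → h i }) j

  view-load-< : ∀ s y {j} → j < s → view s (load y) j ≡ blank
  view-load-< s []      j< = view-blank s _
  view-load-< s (b ∷ y) j< = trans (window-< s [] _ (blank ∷ []) j<) (view-blank s _)

  view-load-+ : ∀ s y i → view s (load y) (s + i) ≡ nth blank (List.map bit y) i
  view-load-+ s []      i = view-blank s (s + i)
  view-load-+ s (b ∷ y) i = window-+ s [] (bit b ∷ List.map bit y) i

module _ (M : Machine) where
  open Machine M

  -- Halting becomes a step that changes nothing, so that the same clauses describe it.
  total : Fin states → Vec (Symbol aux) (suc extra) → Fin states × Vec (Symbol aux × Move) (suc extra)
  total q h = maybe′ id (q , Vec.map (_, stay) h) (δ q h)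

  record Steps (d : Fin states × Vec (Symbol aux × Move) (suc extra)) (ts : Vec (Tape aux) (suc extra)) (c : Config M) : Set where
    field
      state≡ : Config.state c ≡ proj₁ d
      tape≡  : ∀ k → let σ , m = lookup (proj₂ d) k in lookup (Config.tapes c) k ≡ move m (write σ (lookup ts k))

  step-total : ∀ c {q h} → Config.state c ≡ q → Vec.map Tape.head (Config.tapes c) ≡ h →
    Steps (total q h) (Config.tapes c) (step M c)
  step-total c@(config q ts) refl refl = go (δ q (Vec.map Tape.head ts))
    where
    go : ∀ d → Steps (maybe′ id (q , Vec.map (_, stay) (Vec.map Tape.head ts)) d) ts
      (maybe′ (λ (q , as) → config q (Vec.zipWith (λ (s , m) → move m ∘ write s) as ts)) c d)
    go (just (q′ , as)) = record { state≡ = refl ; tape≡ = λ k → Vec.lookup-zipWith _ k as ts }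
    go nothing          = record { state≡ = refl ; tape≡ = λ k → sym (cong (λ (σ , m) → move m (write σ (lookup ts k))) {y = Tape.head (lookup ts k) , stay}
      (trans (Vec.lookup-map k (_, stay) (Vec.map Tape.head ts)) (cong (_, stay) (Vec.lookup-map k Tape.head ts)))) }

halve : ∀ n {i} → i < n + n → ∃[ l ] l < n × (i ≡ l + l ⊎ i ≡ suc (l + l))
halve (suc n) {zero}        _ = 0 , s≤s z≤n , inj₁ refl
halve (suc n) {suc zero}    _ = 0 , s≤s z≤n , inj₂ refl
halve (suc n) {suc (suc i)} (s≤s i<) with halve n (s≤s⁻¹ (subst (suc i <_) (+-suc n n) i<))
... | l , l< , inj₁ refl = suc l , s≤s l< , inj₁ (cong suc (sym (+-suc l l)))
... | l , l< , inj₂ refl = suc l , s≤s l< , inj₂ (cong (λ m → suc (suc m)) (sym (+-suc l l)))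

nth-map-bit : ∀ {aux} y {i} → i < length y → nth (blank {aux}) (List.map bit y) i ≡ bit (y ! i)
nth-map-bit (b ∷ y) {zero}  _        = refl
nth-map-bit (b ∷ y) {suc i} (s≤s i<) = nth-map-bit y i<

-- The facts about a run are indexed by the number s of remaining steps, and cell j at that time is
-- at offset j - s from the head.  Hence cell j depends only on cells j, j + 1 and j + 2 of the step
-- before, and the answer only on the cells 0, …, 2s.
module Tableau (machine : Machine) (p q : Poly) where
  open Machine machine

  Kind : Set
  Kind = Fin states ⊎ (Fin (suc extra) × Symbol aux)

  kinds : List Kind
  kinds = List.map inj₁ (List.allFin states) ++ List.map inj₂ (List.cartesianProduct (List.allFin (suc extra)) (symbols aux))

  ∈-kinds : ∀ κ → κ ∈ kinds
  ∈-kinds (inj₁ q)       = ∈.∈-++⁺ˡ (∈.∈-map⁺ inj₁ (∈.∈-allFin q))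
  ∈-kinds (inj₂ (k , σ)) = ∈.∈-++⁺ʳ (List.map inj₁ (List.allFin states))
    (∈.∈-map⁺ inj₂ (∈.∈-cartesianProduct⁺ (∈.∈-allFin k) (∈-symbols σ)))

  M : ℕ
  M = length kinds

  numbered : Kind → Fin M
  numbered κ = Any.index (∈-kinds κ)

  lookup-numbered : ∀ κ → List.lookup kinds (numbered κ) ≡ κ
  lookup-numbered κ = sym (Any.lookup-index (∈-kinds κ))

  -- The certificate starts at cell guessed of the initial configuration and ends at cell guessed ⊕ q.
  steps guessed bound′ : Poly
  steps   = p ∘ₚ ((var ⊕ var) ⊕ (const 2 ⊕ q))
  guessed = steps ⊕ ((var ⊕ var) ⊕ const 2)
  bound′  = const 1 ⊕ ((steps ⊕ steps) ⊕ (guessed ⊕ q))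

  -- Each rule yields one clause schema in s and j. The first three describe a step, `acceptR` the
  -- answer, and the others the initial tapes and state. In the part reserved for the certificate,
  -- `guessR` allows bits or blanks, `extendR` continues a blank to the right, and `afterR` puts
  -- blanks beyond the maximal length.
  data Rule : Set where
    stateR  : Fin states → Vec (Symbol aux) (suc extra) → Rule
    writeR  : Fin states → Vec (Symbol aux) (suc extra) → Fin (suc extra) → Rule
    keepR   : Fin states → Vec (Symbol aux) (suc extra) → Fin (suc extra) → Symbol aux → Rule
    emptyR  : Fin extra → Rule
    inputR  : Bool → Rule
    acceptR : Symbol aux → Rule
    startR leftR zeroR oneR guessR extendR afterR : Rule

  scans : List (Fin states × Vec (Symbol aux) (suc extra))
  scans = List.cartesianProduct (List.allFin states) (vectors (symbols aux) (suc extra))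

  ∈-scans : ∀ q h → (q , h) ∈ scans
  ∈-scans q h = ∈.∈-cartesianProduct⁺ (∈.∈-allFin q) (∈-vectors ∈-symbols h)

  tapeScans : List ((Fin states × Vec (Symbol aux) (suc extra)) × Fin (suc extra))
  tapeScans = List.cartesianProduct scans (List.allFin (suc extra))

  ∈-tapeScans : ∀ q h k → ((q , h) , k) ∈ tapeScans
  ∈-tapeScans q h k = ∈.∈-cartesianProduct⁺ (∈-scans q h) (∈.∈-allFin k)

  rules : List Rule
  rules =
    startR ∷ leftR ∷ zeroR ∷ oneR ∷ guessR ∷ extendR ∷ afterR ∷ inputR false ∷ inputR true ∷
    List.map (λ (q , h) → stateR q h) scans ++
    List.map (λ ((q , h) , k) → writeR q h k) tapeScans ++
    List.cartesianProductWith (λ ((q , h) , k) → keepR q h k) tapeScans (symbols aux) ++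
    List.map emptyR (List.allFin extra) ++
    List.map acceptR (symbols aux)

  ∈-rules : ∀ r → r ∈ rules
  ∈-rules startR         = here refl
  ∈-rules leftR          = there (here refl)
  ∈-rules zeroR          = there (there (here refl))
  ∈-rules oneR           = there (there (there (here refl)))
  ∈-rules guessR         = there (there (there (there (here refl))))
  ∈-rules extendR        = there (there (there (there (there (here refl)))))
  ∈-rules afterR         = there (there (there (there (there (there (here refl))))))
  ∈-rules (inputR false) = there (there (there (there (there (there (there (here refl)))))))
  ∈-rules (inputR true)  = there (there (there (there (there (there (there (there (here refl))))))))
  -- Nine rules are listed one by one in front of the concatenated families.
  ∈-rules (stateR q h)   = ∈.∈-++⁺ʳ (List.take 9 rules) (∈.∈-++⁺ˡ (∈.∈-map⁺ _ (∈-scans q h)))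
  ∈-rules (writeR q h k) = ∈.∈-++⁺ʳ (List.take 9 rules) (∈.∈-++⁺ʳ (List.map _ scans) (∈.∈-++⁺ˡ
    (∈.∈-map⁺ (λ ((q , h) , k) → writeR q h k) (∈-tapeScans q h k))))
  ∈-rules (keepR q h k σ) = ∈.∈-++⁺ʳ (List.take 9 rules) (∈.∈-++⁺ʳ (List.map _ scans) (∈.∈-++⁺ʳ (List.map _ tapeScans)
    (∈.∈-++⁺ˡ (∈.∈-cartesianProductWith⁺ (λ ((q , h) , k) → keepR q h k) (∈-tapeScans q h k) (∈-symbols σ)))))
  ∈-rules (emptyR k) = ∈.∈-++⁺ʳ (List.take 9 rules) (∈.∈-++⁺ʳ (List.map _ scans) (∈.∈-++⁺ʳ (List.map _ tapeScans)
    (∈.∈-++⁺ʳ (List.cartesianProductWith _ tapeScans (symbols aux)) (∈.∈-++⁺ˡ (∈.∈-map⁺ emptyR (∈.∈-allFin k))))))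
  ∈-rules (acceptR σ) = ∈.∈-++⁺ʳ (List.take 9 rules) (∈.∈-++⁺ʳ (List.map _ scans) (∈.∈-++⁺ʳ (List.map _ tapeScans)
    (∈.∈-++⁺ʳ (List.cartesianProductWith _ tapeScans (symbols aux)) (∈.∈-++⁺ʳ (List.map _ (List.allFin extra))
      (∈.∈-map⁺ acceptR (∈-symbols σ))))))

  Literal : Set
  Literal = Bool × Term 2 × Term 2 × Fin M

  -- The state does not depend on a cell; by convention its facts are kept at cell 0.
  stateLit : Bool → Term 2 → Fin states → Literal
  stateLit a s q = a , s , num 0 , numbered (inj₁ q)

  cellLit : Bool → Term 2 → Term 2 → Fin (suc extra) → Symbol aux → Literal
  cellLit a s j k σ = a , s , j , numbered (inj₂ (k , σ))

  -- The negated premises of a step clause: state q and scanned symbols h one step earlier. With s +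
  -- 1 steps left, the scanned cell has number s + 1.
  scanLits : Fin states → Vec (Symbol aux) (suc extra) → List Literal
  scanLits q h = stateLit false (num 1 ⊞ v0) q ∷
    List.map (λ k → cellLit false (num 1 ⊞ v0) (num 1 ⊞ v0) k (lookup h k)) (List.allFin (suc extra))

  action′ : Fin states → Vec (Symbol aux) (suc extra) → Fin (suc extra) → Symbol aux × Move
  action′ q h k = lookup (proj₂ (total machine q h)) k

  isTrue : Symbol aux → Bool
  isTrue (bit b) = b
  isTrue _       = false

  always : Form 2
  always = num 0 ≐ num 0

  inGuess : Form 2
  inGuess = poly guessed ≼ v1 ∧′ num 1 ⊞ v1 ≼ poly (guessed ⊕ q)

  guardOf : Rule → Form 2
  guardOf (stateR q h)    = num 1 ⊞ v0 ≼ poly steps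
  guardOf (writeR q h k)  = num 1 ⊞ v0 ≼ poly steps ∧′ num (shift (proj₂ (action′ q h k))) ⊞ v1 ≐ num 1 ⊞ v0
  -- Restricting j to at most 2s keeps the cell of the step before, at most j + 2, within the range
  -- of the variables.
  guardOf (keepR q h k σ) = num 1 ⊞ v0 ≼ poly steps ∧′ v1 ≼ v0 ⊞ v0 ∧′
    ¬′ (num (shift (proj₂ (action′ q h k))) ⊞ v1 ≐ num 1 ⊞ v0)
  guardOf (inputR b)      = ∃< len (bitAt v0 ≐ num (bitℕ b) ∧′
    (v2 ≐ poly steps ⊞ (v0 ⊞ v0) ∨′ v2 ≐ poly steps ⊞ (num 1 ⊞ (v0 ⊞ v0))))
  guardOf leftR           = num 1 ⊞ v1 ≼ poly steps
  guardOf guessR          = inGuess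
  guardOf extendR         = inGuess
  guardOf afterR          = poly (guessed ⊕ q) ≼ v1
  guardOf _               = always

  literalsOf : Rule → List Literal
  literalsOf (stateR q h)    = scanLits q h ++ stateLit true v0 (proj₁ (total machine q h)) ∷ []
  literalsOf (writeR q h k)  = scanLits q h ++ cellLit true v0 v1 k (proj₁ (action′ q h k)) ∷ []
  literalsOf (keepR q h k σ) = scanLits q h ++
    cellLit false (num 1 ⊞ v0) (num (shift (proj₂ (action′ q h k))) ⊞ v1) k σ ∷ cellLit true v0 v1 k σ ∷ []
  literalsOf startR          = stateLit true (poly steps) start ∷ []
  literalsOf (emptyR k)      = cellLit true (poly steps) v1 (suc k) blank ∷ []
  literalsOf leftR           = cellLit true (poly steps) v1 zero blank ∷ []
  literalsOf (inputR b)      = cellLit true (poly steps) v1 zero (bit b) ∷ []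
  literalsOf zeroR           = cellLit true (poly steps) (poly (steps ⊕ (var ⊕ var))) zero (bit false) ∷ []
  literalsOf oneR            = cellLit true (poly steps) (poly (steps ⊕ (const 1 ⊕ (var ⊕ var)))) zero (bit true) ∷ []
  literalsOf guessR          = List.map (cellLit true (poly steps) v1 zero) (bit false ∷ bit true ∷ blank ∷ [])
  literalsOf extendR         =
    cellLit false (poly steps) v1 zero blank ∷ cellLit true (poly steps) (num 1 ⊞ v1) zero blank ∷ []
  literalsOf afterR          = cellLit true (poly steps) v1 zero blank ∷ []
  -- For σ = `bit true` this demands the fact, and for every other symbol it forbids it.
  literalsOf (acceptR σ)     = cellLit (isTrue σ) (num 0) (num 0) zero σ ∷ []

  clauseOf : Rule → Clause M
  clauseOf r = clause (guardOf r) (literalsOf r)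

  open Satisfiability (numbered (inj₁ start)) bound′ (List.map clauseOf rules) public
    using (Satisfied; Satisfies; adjacencyWord; adjacencyWord-PolyTime; satisfiable⇔pds)

  module _ (x : List Bool) where

    private
      n = length x
      b = ⟦ bound′ ⟧ n
      S = ⟦ steps ⟧ n
      D = ⟦ guessed ⟧ n
      Q = ⟦ q ⟧ n

    -- The bound exceeds all numbers in use: the number S of steps, the last cell 2S that can
    -- influence the answer, and the end D + Q of the certificate.
    S<b : S < b
    S<b = s≤s (≤-trans (m≤m+n S S) (m≤m+n _ _))

    2S<b : S + S < b
    2S<b = s≤s (m≤m+n _ _)

    D+Q<b : D + Q < b
    D+Q<b = s≤s (m≤n+m _ (S + S))

    0<b : 0 < b
    0<b = s≤s z≤n

    module Run (u : List Bool) where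

      y : List Bool
      y = ⟨ x , u ⟩

      conf : ℕ → Config machine
      conf s = run machine (S ∸ s) (initial machine y)

      tapeAt : ℕ → Fin (suc extra) → Tape aux
      tapeAt s = lookup (Config.tapes (conf s))

      cellAt : ℕ → Fin (suc extra) → ℕ → Symbol aux
      cellAt s k j = view s (tapeAt s k) j

      conf-start : conf S ≡ initial machine y
      conf-start = cong (λ t → run machine t (initial machine y)) (n∸n≡0 S)

      conf-step : ∀ {s} → s < S → conf s ≡ step machine (conf (suc s))
      conf-step {s} s< = begin
        run machine (S ∸ s) c              ≡⟨ cong (λ t → run machine t c) (+-∸-assoc 1 s<) ⟩
        run machine (1 + (S ∸ suc s)) c    ≡⟨ cong (λ t → run machine t c) (+-comm 1 (S ∸ suc s)) ⟩
        run machine ((S ∸ suc s) + 1) c    ≡⟨ run-+ machine (S ∸ suc s) 1 c ⟩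
        step machine (conf (suc s))        ∎
        where
        open ≡-Reasoning
        c = initial machine y

      steps-conf : ∀ {s q h} → s < S → Config.state (conf (suc s)) ≡ q → (∀ k → cellAt (suc s) k (suc s) ≡ lookup h k) →
        Steps machine (total machine q h) (Config.tapes (conf (suc s))) (conf s)
      steps-conf {s} {q} {h} s< q≡ h≡ = subst (Steps machine (total machine q h) (Config.tapes (conf (suc s)))) (sym (conf-step s<))
        (step-total machine (conf (suc s)) q≡ (lookup-extensional _ _ λ k →
          trans (Vec.lookup-map k Tape.head (Config.tapes (conf (suc s)))) (trans (sym (view-head (suc s) (tapeAt (suc s) k))) (h≡ k))))

      cell-written : ∀ {s q h} → Steps machine (total machine q h) (Config.tapes (conf (suc s))) (conf s) → ∀ k j →
        shift (proj₂ (action′ q h k)) + j ≡ suc s → cellAt s k j ≡ proj₁ (action′ q h k)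
      cell-written {s} {q} {h} st k j eq = trans (cong (λ t → view s t j) (Steps.tape≡ st k))
        (trans (view-move (proj₂ (action′ q h k)) s (write (proj₁ (action′ q h k)) (tapeAt (suc s) k)) j)
        (trans (cong (view (suc s) (write (proj₁ (action′ q h k)) (tapeAt (suc s) k))) eq)
          (view-head (suc s) (write (proj₁ (action′ q h k)) (tapeAt (suc s) k)))))

      cell-kept : ∀ {s q h} → Steps machine (total machine q h) (Config.tapes (conf (suc s))) (conf s) → ∀ k j →
        shift (proj₂ (action′ q h k)) + j ≢ suc s → cellAt s k j ≡ cellAt (suc s) k (shift (proj₂ (action′ q h k)) + j)
      cell-kept {s} {q} {h} st k j ne = trans (cong (λ t → view s t j) (Steps.tape≡ st k))
        (trans (view-move (proj₂ (action′ q h k)) s (write (proj₁ (action′ q h k)) (tapeAt (suc s) k)) j)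
          (view-write (proj₁ (action′ q h k)) (suc s) (tapeAt (suc s) k) ne))

      start-state : Config.state (conf S) ≡ start
      start-state = cong Config.state conf-start

      start-input : tapeAt S zero ≡ load y
      start-input = cong (λ c → lookup (Config.tapes c) zero) conf-start

      cell-empty : ∀ k j → cellAt S (suc k) j ≡ blank
      cell-empty k j = trans (cong (λ t → view S t j) (trans (cong (λ c → lookup (Config.tapes c) (suc k)) conf-start)
        (Vec.lookup-replicate k (load [])))) (view-blank S j)

      cell-left : ∀ {j} → j < S → cellAt S zero j ≡ blank
      cell-left {j} j< = trans (cong (λ t → view S t j) start-input) (view-load-< S y j<)

      cell-input : ∀ i → cellAt S zero (S + i) ≡ nth blank (List.map bit y) i
      cell-input i = trans (cong (λ t → view S t (S + i)) start-input) (view-load-+ S y i)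

      2n≤y : n + n ≤ length y
      2n≤y = ≤-trans (m≤m+n (n + n) _) (≤-reflexive (sym (length-pairing x u)))

      cell-even : ∀ {l} → l < n → cellAt S zero (S + (l + l)) ≡ bit (x ! l)
      cell-even {l} l< = trans (cell-input (l + l)) (trans (nth-map-bit y (<-≤-trans (+-mono-< l< l<) 2n≤y))
        (cong bit (nth-even x u l l<)))

      cell-odd : ∀ {l} → l < n → cellAt S zero (S + suc (l + l)) ≡ bit (x ! l)
      cell-odd {l} l< = trans (cell-input (suc (l + l)))
        (trans (nth-map-bit y (<-≤-trans (subst (_≤ n + n) (cong suc (+-suc l l)) (+-mono-≤ l< l<)) 2n≤y))
        (cong bit (nth-odd x u l l<)))

      cell-tail : ∀ m → cellAt S zero (S + (n + n + m)) ≡ nth blank (List.map bit (false ∷ true ∷ u)) m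
      cell-tail m = trans (cell-input (n + n + m)) (nth-tail bit x u m)

      D+ : ∀ l → D + l ≡ S + (n + n + (2 + l))
      D+ l = trans (+-assoc S (n + n + 2) l) (cong (S +_) (+-assoc (n + n) 2 l))

      cell-guess : ∀ l → cellAt S zero (D + l) ≡ nth blank (List.map bit u) l
      cell-guess l = trans (cong (cellAt S zero) (D+ l)) (cell-tail (2 + l))

    module Sound (v : ℕ → ℕ → Fin M → Bool) (sat : Satisfies x v) where

      Asserted : ℕ → ℕ → Kind → Set
      Asserted s j κ = v s j (numbered κ) ≡ true

      by-rule : ∀ r {s j} → s < b → j < b → Holds (guardOf r) x (s ∷ j ∷ []) → Satisfied x v s j (literalsOf r)
      by-rule r s< j< = sat (clauseOf r) (∈.∈-map⁺ clauseOf (∈-rules r)) _ _ s< j<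

      split : ∀ {s j a t u m ls} → Satisfied x v s j ((a , t , u , m) ∷ ls) →
        v (eval t x (s ∷ j ∷ [])) (eval u x (s ∷ j ∷ [])) m ≡ a ⊎ Satisfied x v s j ls
      split (_ , _ , _ , _ , here refl , _ , _ , eq) = inj₁ eq
      split (_ , _ , _ , _ , there l∈ , rest)        = inj₂ (_ , _ , _ , _ , l∈ , rest)

      sole : ∀ {s j a t u m} → Satisfied x v s j ((a , t , u , m) ∷ []) →
        v (eval t x (s ∷ j ∷ [])) (eval u x (s ∷ j ∷ [])) m ≡ a
      sole {t = t} {u} h = [ id , (λ { (_ , _ , _ , _ , () , _) }) ]′ (split {t = t} {u} h)

      resolve : ∀ {s j t u m ls} → v (eval t x (s ∷ j ∷ [])) (eval u x (s ∷ j ∷ [])) m ≡ true →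
        Satisfied x v s j ((false , t , u , m) ∷ ls) → Satisfied x v s j ls
      resolve {t = t} {u} true′ h = [ (λ false′ → case trans (sym true′) false′ of λ ()) , id ]′ (split {t = t} {u} h)

      resolve-scan : ∀ {s j q h ls} → Asserted (suc s) 0 (inj₁ q) → (∀ k → Asserted (suc s) (suc s) (inj₂ (k , lookup h k))) →
        Satisfied x v s j (scanLits q h ++ ls) → Satisfied x v s j ls
      resolve-scan {s} {j} {q} {h} {ls} state heads sat′ = go (List.allFin (suc extra)) (resolve {t = num 1 ⊞ v0} {num 0} state sat′)
        where
        go : ∀ ks → Satisfied x v s j (List.map (λ k → cellLit false (num 1 ⊞ v0) (num 1 ⊞ v0) k (lookup h k)) ks ++ ls) → Satisfied x v s j ls
        go []       r = r
        go (k ∷ ks) r = go ks (resolve {t = num 1 ⊞ v0} {num 1 ⊞ v0} (heads k) r)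

      state-step : ∀ {s q h} → s < S → Asserted (suc s) 0 (inj₁ q) → (∀ k → Asserted (suc s) (suc s) (inj₂ (k , lookup h k))) →
        Asserted s 0 (inj₁ (proj₁ (total machine q h)))
      state-step {s} {q} {h} s< state heads = sole {t = v0} {num 0}
        (resolve-scan {h = h} state heads (by-rule (stateR q h) {s} {0} (<-trans s< S<b) 0<b (<poly⇐ {p = steps} s<)))

      cell-step : ∀ {s q h j k σ} → s < S → j ≤ s + s → Asserted (suc s) 0 (inj₁ q) →
        (∀ k → Asserted (suc s) (suc s) (inj₂ (k , lookup h k))) →
        let ω , m = action′ q h k in Asserted (suc s) (shift m + j) (inj₂ (k , σ)) →
        (shift m + j ≡ suc s × Asserted s j (inj₂ (k , ω))) ⊎ (shift m + j ≢ suc s × Asserted s j (inj₂ (k , σ)))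
      cell-step {s} {q} {h} {j} {k} {σ} s< j≤ state heads cell′ with shift (proj₂ (action′ q h k)) + j ≟ suc s
      ... | yes eq = inj₁ (eq , sole {t = v0} {v1}
              (resolve-scan {h = h} state heads (by-rule (writeR q h k) (<-trans s< S<b) j<b (<poly⇐ {p = steps} s< , eq))))
        where j<b = ≤-<-trans j≤ (≤-<-trans (+-mono-≤ (<⇒≤ s<) (<⇒≤ s<)) 2S<b)
      ... | no ne = inj₂ (ne , sole {t = v0} {v1} (resolve {t = num 1 ⊞ v0} {num (shift (proj₂ (action′ q h k))) ⊞ v1} cell′
              (resolve-scan {h = h} state heads (by-rule (keepR q h k σ) (<-trans s< S<b) j<b (<poly⇐ {p = steps} s< , j≤ , ne)))))
        where j<b = ≤-<-trans j≤ (≤-<-trans (+-mono-≤ (<⇒≤ s<) (<⇒≤ s<)) 2S<b)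

      at-start : ∀ (ρ : Vec ℕ 2) {j κ} → v (eval (poly steps) x ρ) j (numbered κ) ≡ true → Asserted S j κ
      at-start ρ {j} {κ} = subst (λ s → v s j (numbered κ) ≡ true) (eval-poly steps x ρ)

      Guessed : ℕ → Symbol aux → Set
      Guessed l σ = Asserted S (D + l) (inj₂ (zero , σ))

      in-guess : ∀ {l} → l < Q → Holds inGuess x (S ∷ D + l ∷ [])
      in-guess {l} l< = ≤-trans (≤-reflexive (eval-poly guessed x _)) (m≤m+n D l) ,
        <poly⇐ {p = guessed ⊕ q} (+-monoʳ-< D l<)

      guess : ∀ l → l < Q → Guessed l (bit false) ⊎ Guessed l (bit true) ⊎ Guessed l blank
      guess l l< with split {t = poly steps} {v1} (by-rule guessR {S} {D + l} S<b (<-trans (+-monoʳ-< D l<) D+Q<b) (in-guess l<))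
      ... | inj₁ e = inj₁ (at-start (S ∷ D + l ∷ []) {κ = inj₂ (zero , bit false)} e)
      ... | inj₂ r with split {t = poly steps} {v1} r
      ...   | inj₁ e  = inj₂ (inj₁ (at-start (S ∷ D + l ∷ []) {κ = inj₂ (zero , bit true)} e))
      ...   | inj₂ r′ = inj₂ (inj₂ (at-start (S ∷ D + l ∷ []) {κ = inj₂ (zero , blank)} (sole {t = poly steps} {v1} r′)))

      after-guess : ∀ l → Q ≤ l → D + l < b → Guessed l blank
      after-guess l Q≤ l< = at-start (S ∷ D + l ∷ []) {κ = inj₂ (zero , blank)} (sole {t = poly steps} {v1}
        (by-rule afterR {S} {D + l} S<b l< (≤-trans (≤-reflexive (eval-poly (guessed ⊕ q) x _)) (+-monoʳ-≤ D Q≤))))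

      extend-blank : ∀ l → l < Q → Guessed l blank → Guessed (suc l) blank
      extend-blank l l< e = subst (λ j → Asserted S j (inj₂ (zero , blank))) (sym (+-suc D l))
        (at-start (S ∷ D + l ∷ []) {κ = inj₂ (zero , blank)} (sole {t = poly steps} {num 1 ⊞ v1}
          (resolve {t = poly steps} {v1}
            (subst (λ s → v s (D + l) (numbered (inj₂ (zero , blank))) ≡ true) (sym (eval-poly steps x (S ∷ D + l ∷ []))) e)
            (by-rule extendR {S} {D + l} S<b (<-trans (+-monoʳ-< D l<) D+Q<b) (in-guess l<)))))

      blanks : ∀ l i → D + (l + i) < b → Guessed l blank → Guessed (l + i) blank
      blanks l zero    _  e = subst (λ l → Guessed l blank) (sym (+-identityʳ l)) e
      blanks l (suc i) l< e with l + i <? Q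
      ... | yes li< = subst (λ l → Guessed l blank) (sym (+-suc l i)) (extend-blank (l + i) li<
              (blanks l i (<-trans (+-monoʳ-< D (+-monoʳ-< l ≤-refl)) l<) e))
      ... | no li≮  = after-guess (l + suc i) (≤-trans (≮⇒≥ li≮) (+-monoʳ-≤ l (n≤1+n i))) l<

      -- Bits are read off until a cell is asserted blank. From there `extendR` and then `afterR`
      -- assert blanks throughout, which is what `nth blank` returns past the end of u. A cell may
      -- be asserted to hold several symbols; one that `guess` returns is enough.
      certificateFrom : ∀ r l → l + r ≡ Q → ∃[ u ] length u ≤ r ×
        (∀ i → D + (l + i) < b → Guessed (l + i) (nth blank (List.map bit u) i))
      certificateFrom zero    l eq = [] , z≤n , λ i → after-guess (l + i)
        (≤-trans (≤-reflexive (trans (sym eq) (+-identityʳ l))) (m≤m+n l i))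
      certificateFrom (suc r) l eq = choose (guess l (≤-trans (m<m+n l (s≤s z≤n)) (≤-reflexive eq)))
        where
        Result = ∃[ u ] length u ≤ suc r × (∀ i → D + (l + i) < b → Guessed (l + i) (nth blank (List.map bit u) i))
        prepend : ∀ c → Guessed l (bit c) → Result
        prepend c e = let u , u≤ , h = certificateFrom r (suc l) (trans (sym (+-suc l r)) eq) in
          c ∷ u , s≤s u≤ , λ where
            zero    _  → subst (λ l → Guessed l (bit c)) (sym (+-identityʳ l)) e
            (suc i) l< → subst (λ l → Guessed l (nth blank (List.map bit u) i)) (sym (+-suc l i))
                           (h i (subst (λ l → D + l < b) (+-suc l i) l<))
        choose : Guessed l (bit false) ⊎ Guessed l (bit true) ⊎ Guessed l blank → Result
        choose (inj₁ e)        = prepend false e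
        choose (inj₂ (inj₁ e)) = prepend true e
        choose (inj₂ (inj₂ e)) = [] , z≤n , λ i l< → blanks l i l< e

      private
        certificate′ = certificateFrom Q 0 refl
        u = proj₁ certificate′

      open Run u

      -- The facts of the actual run are asserted; the assignment may assert others as well. Nothing
      -- stronger is needed, since `acceptR` for the symbol really in the answer cell turns its
      -- assertion into acceptance.
      Observed : ℕ → Set
      Observed s = Asserted s 0 (inj₁ (Config.state (conf s))) × (∀ k j → j ≤ s + s → Asserted s j (inj₂ (k , cellAt s k j)))

      observed-input : ∀ i → S + i ≤ S + S → Asserted S (S + i) (inj₂ (zero , cellAt S zero (S + i)))
      observed-input i Si≤ with i <? n + n
      ... | yes i< with halve n i<
      ...   | l , l< , inj₁ refl = subst (λ σ → Asserted S (S + i) (inj₂ (zero , σ))) (sym (cell-even l<))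
              (at-start (S ∷ S + i ∷ []) {κ = inj₂ (zero , bit (x ! l))} (sole {t = poly steps} {v1}
                (by-rule (inputR (x ! l)) {S} {S + i} S<b (≤-<-trans Si≤ 2S<b)
                  (l , l< , refl , inj₁ (cong (_+ (l + l)) (sym (eval-poly steps x _)))))))
      ...   | l , l< , inj₂ refl = subst (λ σ → Asserted S (S + i) (inj₂ (zero , σ))) (sym (cell-odd l<))
              (at-start (S ∷ S + i ∷ []) {κ = inj₂ (zero , bit (x ! l))} (sole {t = poly steps} {v1}
                (by-rule (inputR (x ! l)) {S} {S + i} S<b (≤-<-trans Si≤ 2S<b)
                  (l , l< , refl , inj₂ (cong (_+ suc (l + l)) (sym (eval-poly steps x _)))))))
      -- Beyond the doubled input there are the two separator bits, given by `zeroR` and `oneR`, and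
      -- then the certificate.
      observed-input i Si≤ | no i≮ with m , refl ← m≤n⇒∃[o]m+o≡n (≮⇒≥ i≮) = go m Si≤
        where
        go : ∀ m → S + (n + n + m) ≤ S + S → Asserted S (S + (n + n + m)) (inj₂ (zero , cellAt S zero (S + (n + n + m))))
        go zero    h = subst₂ (λ j σ → Asserted S j (inj₂ (zero , σ)))
          (trans (eval-poly (steps ⊕ (var ⊕ var)) x _) (cong (S +_) (sym (+-identityʳ (n + n))))) (sym (cell-tail 0))
          (at-start (S ∷ 0 ∷ []) {κ = inj₂ (zero , bit false)}
            (sole {t = poly steps} {poly (steps ⊕ (var ⊕ var))} (by-rule zeroR {S} {0} S<b 0<b refl)))
        go (suc zero) h = subst₂ (λ j σ → Asserted S j (inj₂ (zero , σ)))
          (trans (eval-poly (steps ⊕ (const 1 ⊕ (var ⊕ var))) x _) (cong (S +_) (+-comm 1 (n + n)))) (sym (cell-tail 1))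
          (at-start (S ∷ 0 ∷ []) {κ = inj₂ (zero , bit true)}
            (sole {t = poly steps} {poly (steps ⊕ (const 1 ⊕ (var ⊕ var)))} (by-rule oneR {S} {0} S<b 0<b refl)))
        go (suc (suc l)) h = subst₂ (λ j σ → Asserted S j (inj₂ (zero , σ))) (D+ l) (sym (cell-tail (2 + l)))
          (proj₂ (proj₂ certificate′) l (≤-<-trans (subst (_≤ S + S) (sym (D+ l)) h) 2S<b))

      observed-start : Observed S
      observed-start = subst (λ q → Asserted S 0 (inj₁ q)) (sym start-state)
          (at-start (S ∷ 0 ∷ []) {κ = inj₁ start} (sole {t = poly steps} {num 0} (by-rule startR {S} {0} S<b 0<b refl))) , cells
        where
        cells : ∀ k j → j ≤ S + S → Asserted S j (inj₂ (k , cellAt S k j))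
        cells (suc k) j j≤ = subst (λ σ → Asserted S j (inj₂ (suc k , σ))) (sym (cell-empty k j))
          (at-start (S ∷ j ∷ []) {κ = inj₂ (suc k , blank)} (sole {t = poly steps} {v1} (by-rule (emptyR k) {S} {j} S<b (≤-<-trans j≤ 2S<b) refl)))
        cells zero j j≤ with j <? S
        ... | yes j< = subst (λ σ → Asserted S j (inj₂ (zero , σ))) (sym (cell-left j<))
          (at-start (S ∷ j ∷ []) {κ = inj₂ (zero , blank)} (sole {t = poly steps} {v1} (by-rule leftR {S} {j} S<b (≤-<-trans j≤ 2S<b) (<poly⇐ {p = steps} j<))))
        ... | no j≮ with i , refl ← m≤n⇒∃[o]m+o≡n (≮⇒≥ j≮) = observed-input i j≤

      observed-step : ∀ {s} → s < S → Observed (suc s) → Observed s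
      observed-step {s} s< (state , cells) =
        subst (λ q → Asserted s 0 (inj₁ q)) (sym (Steps.state≡ st)) (state-step {h = h} s< state scannedFacts) , cells′
        where
        q₀ = Config.state (conf (suc s))
        h = Vec.map Tape.head (Config.tapes (conf (suc s)))
        scanned≡ : ∀ k → cellAt (suc s) k (suc s) ≡ lookup h k
        scanned≡ k = trans (view-head (suc s) (tapeAt (suc s) k)) (sym (Vec.lookup-map k Tape.head (Config.tapes (conf (suc s)))))
        st = steps-conf {h = h} s< refl scanned≡
        scannedFacts : ∀ k → Asserted (suc s) (suc s) (inj₂ (k , lookup h k))
        scannedFacts k = subst (λ σ → Asserted (suc s) (suc s) (inj₂ (k , σ))) (scanned≡ k) (cells k (suc s) (m≤m+n (suc s) (suc s)))
        cells′ : ∀ k j → j ≤ s + s → Asserted s j (inj₂ (k , cellAt s k j))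
        cells′ k j j≤ with cell-step {s} {q₀} {h} {j} {k} s< j≤ state scannedFacts
            (cells k (shift (proj₂ (action′ q₀ h k)) + j)
              (≤-trans (+-mono-≤ (shift≤2 (proj₂ (action′ q₀ h k))) j≤) (≤-reflexive (cong suc (sym (+-suc s s))))))
        ... | inj₁ (eq , e) = subst (λ σ → Asserted s j (inj₂ (k , σ))) (sym (cell-written st k j eq)) e
        ... | inj₂ (ne , e) = subst (λ σ → Asserted s j (inj₂ (k , σ))) (sym (cell-kept st k j ne)) e

      observed : ∀ d {s} → s + d ≡ S → Observed s
      observed zero    {s} eq = subst Observed (trans (sym eq) (+-identityʳ s)) observed-start
      observed (suc d) {s} eq = observed-step (≤-trans (m<m+n s (s≤s z≤n)) (≤-reflexive eq))
        (observed d (trans (sym (+-suc s d)) eq))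

      accepted : ∃[ u ] length u ≤ Q × isTrue (Run.cellAt u 0 zero 0) ≡ true
      accepted = u , proj₁ (proj₂ certificate′) ,
        trans (sym (sole {t = num 0} {num 0} (by-rule (acceptR (cellAt 0 zero 0)) {0} {0} 0<b 0<b refl)))
          (proj₂ (observed S {0} refl) zero 0 z≤n)

    module Complete (u : List Bool) (u≤Q : length u ≤ Q) (accepting : isTrue (Run.cellAt u 0 zero 0) ≡ true) where

      open Run u

      Fact : ℕ → ℕ → Kind → Set
      Fact s j (inj₁ q)       = Config.state (conf s) ≡ q
      Fact s j (inj₂ (k , σ)) = cellAt s k j ≡ σ

      fact? : ∀ s j κ → Dec (Fact s j κ)
      fact? s j (inj₁ q)       = Config.state (conf s) Fin.≟ q
      fact? s j (inj₂ (k , σ)) = cellAt s k j ≟ₛ σ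

      v : ℕ → ℕ → Fin M → Bool
      v s j m = does (fact? s j (List.lookup kinds m))

      v-numbered : ∀ s j κ → v s j (numbered κ) ≡ does (fact? s j κ)
      v-numbered s j κ = cong (λ κ → does (fact? s j κ)) (lookup-numbered κ)

      InRange Fails : ℕ → ℕ → Literal → Set
      InRange s j (a , t , u , m) = eval t x (s ∷ j ∷ []) < b × eval u x (s ∷ j ∷ []) < b
      Fails s j (a , t , u , m) = v (eval t x (s ∷ j ∷ [])) (eval u x (s ∷ j ∷ [])) m ≢ a

      untrue : ∀ {s j} κ → v s j (numbered κ) ≢ true → ¬ Fact s j κ
      untrue {s} {j} κ ≢true fact = ≢true (trans (v-numbered s j κ) (dec-true (fact? s j κ) fact))

      unfalse : ∀ {s j} κ → v s j (numbered κ) ≢ false → Fact s j κ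
      unfalse {s} {j} κ ≢false with fact? s j κ in eq
      ... | yes fact = fact
      ... | no _     = contradiction (trans (v-numbered s j κ) (cong does eq)) ≢false

      untrue-start : ∀ (ρ : Vec ℕ 2) {j} κ → v (eval (poly steps) x ρ) j (numbered κ) ≢ true → ¬ Fact S j κ
      untrue-start ρ {j} κ = subst (λ s → v s j (numbered κ) ≢ true → ¬ Fact S j κ) (sym (eval-poly steps x ρ)) (untrue κ)

      start-in-range : ∀ (ρ : Vec ℕ 2) → eval (poly steps) x ρ < b
      start-in-range ρ = subst (_< b) (sym (eval-poly steps x ρ)) S<b

      next-in-range : ∀ {s} {ρ : Vec ℕ 2} → suc s ≤ eval (poly steps) x ρ → suc s < b
      next-in-range s< = ≤-<-trans (<poly⇒ {p = steps} s<) S<b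

      scan-in-range : ∀ {s j} q h → suc s < b → All (InRange s j) (scanLits q h)
      scan-in-range {s} {j} q h s< = (s< , 0<b) ∷ go (List.allFin (suc extra))
        where
        go : ∀ ks → All (InRange s j) (List.map (λ k → cellLit false (num 1 ⊞ v0) (num 1 ⊞ v0) k (lookup h k)) ks)
        go []       = []
        go (k ∷ ks) = (s< , s<) ∷ go ks

      in-range : ∀ r s j → s < b → j < b → Holds (guardOf r) x (s ∷ j ∷ []) → All (InRange s j) (literalsOf r)
      in-range (stateR q h) s j s<b j<b s< = All.++⁺ (scan-in-range q h (next-in-range s<)) ((s<b , 0<b) ∷ [])
      in-range (writeR q h k) s j s<b j<b (s< , _) = All.++⁺ (scan-in-range q h (next-in-range s<)) ((s<b , j<b) ∷ [])
      in-range (keepR q h k σ) s j s<b j<b (s< , j≤ , _) = All.++⁺ (scan-in-range q h (next-in-range s<))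
        ((next-in-range s< , ≤-<-trans (+-mono-≤ (shift≤2 (proj₂ (action′ q h k))) j≤)
          (≤-<-trans (≤-trans (≤-reflexive (cong suc (sym (+-suc s s)))) (+-mono-≤ s<S s<S)) 2S<b)) ∷ (s<b , j<b) ∷ [])
        where s<S = <poly⇒ {p = steps} s<
      in-range (emptyR k)  s j s<b j<b _ = (start-in-range _ , j<b) ∷ []
      in-range (inputR c)  s j s<b j<b _ = (start-in-range _ , j<b) ∷ []
      in-range (acceptR σ) s j s<b j<b _ = (0<b , 0<b) ∷ []
      in-range startR      s j s<b j<b _ = (start-in-range _ , 0<b) ∷ []
      in-range leftR       s j s<b j<b _ = (start-in-range _ , j<b) ∷ []
      in-range zeroR       s j s<b j<b _ = (start-in-range _ , subst (_< b) (sym (eval-poly (steps ⊕ (var ⊕ var)) x _))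
        (s≤s (≤-trans (+-monoʳ-≤ S (m≤m+n (n + n) 2)) (≤-trans (m≤m+n D Q) (m≤n+m _ (S + S)))))) ∷ []
      in-range oneR        s j s<b j<b _ = (start-in-range _ , subst (_< b) (sym (eval-poly (steps ⊕ (const 1 ⊕ (var ⊕ var))) x _))
        (s≤s (≤-trans (+-monoʳ-≤ S (≤-trans (≤-reflexive (+-comm 1 (n + n))) (+-monoʳ-≤ (n + n) (n≤1+n 1)))) (≤-trans (m≤m+n D Q) (m≤n+m _ (S + S)))))) ∷ []
      in-range guessR      s j s<b j<b _ = (start-in-range _ , j<b) ∷ (start-in-range _ , j<b) ∷ (start-in-range _ , j<b) ∷ []
      in-range extendR     s j s<b j<b (_ , j<) = (start-in-range _ , j<b) ∷
        (start-in-range _ , ≤-<-trans (<poly⇒ {p = guessed ⊕ q} j<) D+Q<b) ∷ []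
      in-range afterR      s j s<b j<b _ = (start-in-range _ , j<b) ∷ []

      scan-fails : ∀ {s j q h} → All (Fails s j) (scanLits q h) →
        Config.state (conf (suc s)) ≡ q × (∀ k → cellAt (suc s) k (suc s) ≡ lookup h k)
      scan-fails {s} {j} {q} {h} (f ∷ fs) = unfalse {suc s} {0} (inj₁ q) f , λ k →
        unfalse {suc s} {suc s} (inj₂ (k , lookup h k)) (All.lookup (All.map⁻ fs) (∈.∈-allFin k))

      bit-or-blank : ∀ u l → let σ = nth (blank {aux}) (List.map bit u) l in
        σ ≡ bit false ⊎ σ ≡ bit true ⊎ σ ≡ blank
      bit-or-blank []          l       = inj₂ (inj₂ refl)
      bit-or-blank (false ∷ u) zero    = inj₁ refl
      bit-or-blank (true ∷ u)  zero    = inj₂ (inj₁ refl)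
      bit-or-blank (_ ∷ u)     (suc l) = bit-or-blank u l

      blank-suc : ∀ u l → nth (blank {aux}) (List.map bit u) l ≡ blank → nth (blank {aux}) (List.map bit u) (suc l) ≡ blank
      blank-suc []      l       eq = refl
      blank-suc (_ ∷ u) (suc l) eq = blank-suc u l eq

      isTrue-unique : ∀ σ → isTrue σ ≡ true → σ ≡ bit true
      isTrue-unique (bit true) _ = refl

      -- Literals are decidable, so a clause holds once its literals cannot all fail. A failing
      -- negative literal supplies a premise, and a failing positive one contradicts the fact that
      -- the run then yields.
      refute : ∀ r s j → Holds (guardOf r) x (s ∷ j ∷ []) → All (Fails s j) (literalsOf r) → ⊥
      refute (stateR q h) s j s< fs with All.++⁻ (scanLits q h) fs
      ... | scan , f ∷ [] = let q≡ , h≡ = scan-fails {j = j} {h = h} scan in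
        untrue {s} {0} (inj₁ _) f (Steps.state≡ (steps-conf {h = h} (<poly⇒ {p = steps} s<) q≡ h≡))
      refute (writeR q h k) s j (s< , eq) fs with All.++⁻ (scanLits q h) fs
      ... | scan , f ∷ [] = let q≡ , h≡ = scan-fails {j = j} {h = h} scan in
        untrue {s} {j} (inj₂ (k , _)) f (cell-written (steps-conf {h = h} (<poly⇒ {p = steps} s<) q≡ h≡) k j eq)
      refute (keepR q h k σ) s j (s< , _ , ne) fs with All.++⁻ (scanLits q h) fs
      ... | scan , f ∷ f′ ∷ [] = let q≡ , h≡ = scan-fails {j = j} {h = h} scan in
        untrue {s} {j} (inj₂ (k , σ)) f′ (trans (cell-kept (steps-conf {h = h} (<poly⇒ {p = steps} s<) q≡ h≡) k j ne)
          (unfalse {suc s} {shift (proj₂ (action′ q h k)) + j} (inj₂ (k , σ)) f))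
      refute (emptyR k) s j _ (f ∷ []) = untrue-start (s ∷ j ∷ []) {j} (inj₂ (suc k , blank)) f (cell-empty k j)
      refute (inputR c) s j (l , l< , bit≡ , inj₁ j≡) (f ∷ []) = untrue-start (s ∷ j ∷ []) {j} (inj₂ (zero , bit c)) f
        (trans (cong (cellAt S zero) (trans j≡ (cong (_+ (l + l)) (eval-poly steps x _)))) (trans (cell-even l<) (cong bit (bitℕ-injective bit≡))))
      refute (inputR c) s j (l , l< , bit≡ , inj₂ j≡) (f ∷ []) = untrue-start (s ∷ j ∷ []) {j} (inj₂ (zero , bit c)) f
        (trans (cong (cellAt S zero) (trans j≡ (cong (_+ suc (l + l)) (eval-poly steps x _)))) (trans (cell-odd l<) (cong bit (bitℕ-injective bit≡))))
      refute (acceptR σ) s j _ (f ∷ []) = f (trans (v-numbered 0 0 (inj₂ (zero , σ))) agree)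
        where
        agree : does (cellAt 0 zero 0 ≟ₛ σ) ≡ isTrue σ
        agree with cellAt 0 zero 0 ≟ₛ σ
        ... | yes refl = sym accepting
        ... | no ne with isTrue σ in eq
        ...   | true  = contradiction (trans (isTrue-unique _ accepting) (sym (isTrue-unique σ eq))) ne
        ...   | false = refl
      refute startR s j _ (f ∷ []) = untrue-start (s ∷ j ∷ []) {0} (inj₁ start) f start-state
      refute leftR s j j< (f ∷ []) = untrue-start (s ∷ j ∷ []) {j} (inj₂ (zero , blank)) f (cell-left (<poly⇒ {p = steps} j<))
      refute zeroR s j _ (f ∷ []) = untrue-start (s ∷ j ∷ []) (inj₂ (zero , bit false)) f
        (trans (cong (cellAt S zero) (trans (eval-poly (steps ⊕ (var ⊕ var)) x _) (cong (S +_) (sym (+-identityʳ (n + n)))))) (cell-tail 0))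
      refute oneR s j _ (f ∷ []) = untrue-start (s ∷ j ∷ []) (inj₂ (zero , bit true)) f
        (trans (cong (cellAt S zero) (trans (eval-poly (steps ⊕ (const 1 ⊕ (var ⊕ var))) x _) (cong (S +_) (+-comm 1 (n + n))))) (cell-tail 1))
      refute guessR s j (D≤ , _) (f ∷ f′ ∷ f″ ∷ [])
        with l , refl ← m≤n⇒∃[o]m+o≡n (≤-trans (≤-reflexive (sym (eval-poly guessed x (s ∷ j ∷ [])))) D≤)
        with bit-or-blank u l
      ... | inj₁ eq        = untrue-start (s ∷ j ∷ []) {D + l} (inj₂ (zero , bit false)) f (trans (cell-guess l) eq)
      ... | inj₂ (inj₁ eq) = untrue-start (s ∷ j ∷ []) {D + l} (inj₂ (zero , bit true)) f′ (trans (cell-guess l) eq)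
      ... | inj₂ (inj₂ eq) = untrue-start (s ∷ j ∷ []) {D + l} (inj₂ (zero , blank)) f″ (trans (cell-guess l) eq)
      refute extendR s j (D≤ , _) (f ∷ f′ ∷ [])
        with l , refl ← m≤n⇒∃[o]m+o≡n (≤-trans (≤-reflexive (sym (eval-poly guessed x (s ∷ j ∷ [])))) D≤) =
        untrue-start (s ∷ j ∷ []) {suc (D + l)} (inj₂ (zero , blank)) f′
          (trans (cong (cellAt S zero) (sym (+-suc D l))) (trans (cell-guess (suc l)) (blank-suc u l (trans (sym (cell-guess l))
            (unfalse {S} {D + l} (inj₂ (zero , blank)) (subst (λ s → v s (D + l) (numbered (inj₂ (zero , blank))) ≢ false) (eval-poly steps x _) f))))))
      refute afterR s j D+Q≤ (f ∷ [])
        with l , refl ← m≤n⇒∃[o]m+o≡n (≤-trans (≤-reflexive (sym (eval-poly (guessed ⊕ q) x (s ∷ j ∷ [])))) D+Q≤) =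
        untrue-start (s ∷ j ∷ []) {D + Q + l} (inj₂ (zero , blank)) f
          (trans (cong (cellAt S zero) (+-assoc D Q l)) (trans (cell-guess (Q + l))
            (nth-beyond (List.map bit u) (≤-trans (≤-reflexive (List.length-map bit u)) (≤-trans u≤Q (m≤m+n Q l))))))

      fails-or-satisfied : ∀ {s j ls} → All (InRange s j) ls → All (Fails s j) ls ⊎ Satisfied x v s j ls
      fails-or-satisfied [] = inj₁ []
      fails-or-satisfied {s} {j} {(a , t , u , m) ∷ ls} ((t< , u<) ∷ rs)
        with v (eval t x (s ∷ j ∷ [])) (eval u x (s ∷ j ∷ [])) m Bool.≟ a | fails-or-satisfied rs
      ... | yes eq | _       = inj₂ (a , t , u , m , here refl , t< , u< , eq)
      ... | no ne  | inj₁ fs = inj₁ (ne ∷ fs)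
      ... | no _   | inj₂ (_ , _ , _ , _ , l∈ , rest) = inj₂ (_ , _ , _ , _ , there l∈ , rest)

      satisfied-rule : ∀ r s j → s < b → j < b → Holds (guardOf r) x (s ∷ j ∷ []) → Satisfied x v s j (literalsOf r)
      satisfied-rule r s j s< j< g = [ (λ fs → contradiction fs (refute r s j g)) , id ]′ (fails-or-satisfied (in-range r s j s< j< g))

      satisfies : Satisfies x v
      satisfies c c∈ s j s< j< g with ∈.∈-map⁻ clauseOf {xs = rules} c∈
      ... | r , _ , refl = satisfied-rule r s j s< j< g

    accepting⇔pds : (∃[ u ] length u ≤ Q × isTrue (Run.cellAt u 0 zero 0) ≡ true) ⇔ PairingDominatingSet (adjacencyWord x)
    accepting⇔pds = mk⇔
      (λ (u , u≤ , acc) → to (satisfiable⇔pds x 0<b) (Complete.v u u≤ acc , Complete.satisfies u u≤ acc))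
      (λ pds → let v , sat = from (satisfiable⇔pds x 0<b) pds in Sound.accepted v sat)
      where open Equivalence

-- Hardness and completeness

pds-NPHard : NPHard PairingDominatingSet
pds-NPHard L (R , (χ , (V , p , computes) , χ⇔) , q , L⇔) =
  adjacencyWord , adjacencyWord-PolyTime , λ x → mk⇔ (to (accepting⇔pds x) ∘ accepting x) (member x ∘ from (accepting⇔pds x))
  where
  open Equivalence
  open Tableau V p q
  -- The verifier halts with a one-bit word beginning at the scanned cell of tape 0, and this cell
  -- has number 0 when no steps remain.
  accepts⇔ : ∀ x u → length u ≤ ⟦ q ⟧ (length x) → (χ ⟨ x , u ⟩ ≡ true) ⇔ (isTrue (Run.cellAt x u 0 zero 0) ≡ true)
  accepts⇔ x u u≤ = mk⇔ (λ e → subst (λ c → isTrue (Tape.head c) ≡ true) tape≡ (⇒ (lookup (Config.tapes c₀) zero) (trans output≡ (cong (_∷ []) e))))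
    (λ e → ⇐ (lookup (Config.tapes c₀) zero) (subst (λ c → isTrue (Tape.head c) ≡ true) (sym tape≡) e) output≡)
    where
    y = ⟨ x , u ⟩
    T = ⟦ p ⟧ (length y)
    c₀ = run V T (initial V y)
    T≤ : T ≤ ⟦ steps ⟧ (length x)
    -- `steps` is the time allowed on a pairing with a certificate of maximal length. A shorter
    -- certificate lets the verifier halt earlier, and its configuration then stays as it is.
    T≤ = ≤-trans (⟦⟧-mono p (≤-trans (≤-reflexive (length-pairing x u)) (+-monoʳ-≤ (length x + length x) (+-monoʳ-≤ 2 u≤))))
      (≤-reflexive (sym (⟦∘ₚ⟧ p ((var ⊕ var) ⊕ (const 2 ⊕ q)) (length x))))
    conf≡ : run V (⟦ steps ⟧ (length x)) (initial V y) ≡ c₀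
    conf≡ = trans (cong (λ t → run V t (initial V y)) (sym (m+[n∸m]≡n T≤)))
      (trans (run-+ V T _ _) (run-halted V c₀ (⟦ steps ⟧ (length x) ∸ T) (proj₁ (computes y))))
    tape≡ : lookup (Config.tapes c₀) zero ≡ Run.tapeAt x u 0 zero
    tape≡ = cong (λ c → lookup (Config.tapes c) zero) (sym conf≡)
    head≡lookup : ∀ {A : Set} {k} (as : Vec A (suc k)) → Vec.head as ≡ lookup as zero
    head≡lookup (_ ∷ _) = refl
    output≡ : unload (lookup (Config.tapes c₀) zero) ≡ χ y ∷ []
    output≡ = trans (cong unload (sym (head≡lookup (Config.tapes c₀)))) (proj₂ (computes y))
    ⇒ : ∀ t → unload t ≡ true ∷ [] → isTrue (Tape.head t) ≡ true
    ⇒ (tape _ (bit true) _) _ = refl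
    ⇐ : ∀ t {b} → isTrue (Tape.head t) ≡ true → unload t ≡ b ∷ [] → b ≡ true
    ⇐ (tape _ (bit true) _) _ eq = sym (List.∷-injectiveˡ eq)
  Accepting : List Bool → Set
  Accepting x = ∃[ u ] length u ≤ ⟦ q ⟧ (length x) × isTrue (Run.cellAt x u 0 zero 0) ≡ true
  accepting : ∀ x → L x → Accepting x
  accepting x x∈L = let u , u≤ , r = to (L⇔ x) x∈L in u , u≤ , to (accepts⇔ x u u≤) (to (χ⇔ ⟨ x , u ⟩) r)
  member : ∀ x → Accepting x → L x
  member x (u , u≤ , acc) = from (L⇔ x) (u , u≤ , from (χ⇔ ⟨ x , u ⟩) (from (accepts⇔ x u u≤) acc))

theorem3 : NPComplete PairingDominatingSet
theorem3 = pds-InNP , pds-NPHard
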